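{- There is a constant $c\in\mathbb R_{>0}$ such that, for all integers $k\ge2$ and $n\ge c(k\log k)^2$, there are colored graphs $G_n,H_n$ such that (a) $|V(G_n)|=|V(H_n)|\le c\cdot k^2\cdot n$, (b) $k$-WL distinguishes $G_n$ and $H_n$ (i.e. after some number of rounds), and (c) $k$-WL requires at least $n^{k/2}$ rounds to distinguish $G_n$ and $H_n$ (i.e. for no integer $r<n^{k/2}$ does $k$-WL distinguish $G_n$ and $H_n$ after $r$ rounds).
   Context: All graphs are finite, simple, undirected and (vertex-)colored: a colored graph is $G=(V,E,c)$ with $c\colon V\to\mathbb N$ an arbitrary vertex coloring; isomorphisms preserve colors. The $k$-dimensional Weisfeiler-Leman algorithm ($k$-WL, $k\ge2$) computes for each colored graph $G$ colorings $\chi_k^{(r)}[G]$ of $V(G)^k$ for $r=0,1,2,\dots$, with colors comparable across graphs. Initially, for tuples $\bar u\in V(G)^k$ and $\bar v\in V(H)^k$ (of the same or of different graphs), $\chi_k^{(0)}[G](\bar u)=\chi_k^{(0)}[H](\bar v)$ if and only if $u_i\mapsto v_i$ ($1\le i\le k$) defines an isomorphism of colored graphs from $G[\{u_1,\dots,u_k\}]$ to $H[\{v_1,\dots,v_k\}]$. Then $$\chi_k^{(r+1)}[G](\bar u)=\Big(\chi_k^{(r)}[G](\bar u),\ \big\{\!\!\big\{\big(\chi_k^{(r)}[G](\bar u[w/1]),\dots,\chi_k^{(r)}[G](\bar u[w/k])\big)\ \big|\ w\in V(G)\big\}\!\!\big\}\Big),$$ where $\{\!\!\{\cdot\}\!\!\}$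 denotes a multiset and $\bar u[w/i]$ is $\bar u$ with its $i$-th entry replaced by $w$. $k$-WL distinguishes $G$ and $H$ after $r$ rounds if there is a color $q$ such that the number of $\bar u\in V(G)^k$ with $\chi_k^{(r)}[G](\bar u)=q$ differs from the number of $\bar v\in V(H)^k$ with $\chi_k^{(r)}[H](\bar v)=q$. The base of the logarithm is immaterial (it is absorbed in $c$); take the natural logarithm. -}

module Defs where

open import Data.Bool.Base using (Bool; false)
import Data.Bool.Properties as Bool
open import Data.Fin.Base using (Fin)
import Data.Fin.Properties as Fin
open import Data.Integer.Base as ℤ using (+_)
import Data.Integer.Properties as ℤ
open import Data.List.Base as List using (List; []; _∷_; _++_; length; filter; allFin; cartesianProductWith)
import Data.List.Membership.Setoid as Membership
import Data.List.Membership.Setoid.Properties as MembershipProperties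
import Data.List.Relation.Binary.Permutation.Setoid as Permutation
import Data.List.Relation.Binary.Permutation.Setoid.Properties as PermutationProperties
open import Data.List.Relation.Unary.Any using (here; any?)
open import Data.Nat.Base as ℕ using (ℕ; zero; suc)
import Data.Nat.Properties as ℕ
import Data.Nat.Solver as ℕ
open import Data.Product.Base using (∃; _×_; _,_; proj₁; proj₂)
open import Data.Product.Relation.Binary.Pointwise.NonDependent using (×-decSetoid)
open import Data.Rational.Base as ℚ using (ℚ; 0ℚ; 1ℚ; _/_; ∣_∣; mkℚ; toℚᵘ)
import Data.Rational.Properties as ℚ
import Data.Rational.Solver as ℚ
import Data.Rational.Unnormalised.Base as ℚᵘ
import Data.Rational.Unnormalised.Properties as ℚᵘ
open import Data.Sum.Base using (inj₁; inj₂)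
open import Data.Vec.Base using (Vec; []; _∷_; lookup; tabulate; _[_]≔_)
import Data.Vec.Relation.Binary.Pointwise.Inductive as Vec

open import Function.Bundles using (_⇔_; mk⇔; Equivalence)
open import Function.Properties.Equivalence using (⇔-isEquivalence)
open import Level using (0ℓ)
open import Relation.Binary.Bundles using (DecSetoid)
open import Relation.Binary.Definitions using (Decidable)
open import Relation.Binary.PropositionalEquality.Core using (_≡_; _≢_; refl; sym; trans; cong; cong₂; subst; subst₂)
open import Relation.Binary.Structures using (IsEquivalence)
open import Relation.Nullary.Decidable using (Dec; yes; no; _×-dec_; _→-dec_; map′)

record ColoredGraph : Set where
  field
    order     : ℕ
    adjacent  : Fin order → Fin order → Bool
    symmetric : ∀ x y → adjacent x y ≡ adjacent y x
    loopless  : ∀ x → adjacent x x ≡ false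
    color     : Fin order → ℕ

  Vertex : Set
  Vertex = Fin order

open ColoredGraph public

module _ (S : DecSetoid 0ℓ 0ℓ) where
  open DecSetoid S using (Carrier; _≈_; _≟_; setoid)
  open Permutation setoid
  private
    module P = PermutationProperties setoid
    open Membership setoid using (_∈_)

  ↭-dec : Decidable _↭_
  ↭-dec []       []       = yes ↭-refl
  ↭-dec []       (y ∷ ys) = no λ p → P.¬x∷xs↭[] (↭-sym p)
  ↭-dec (x ∷ xs) ys with any? (x ≟_) ys
  ... | no  x∉ys = no λ p → x∉ys (P.∈-resp-↭ p (here (DecSetoid.refl S)))
  ... | yes x∈ys with MembershipProperties.∈-∃++ setoid x∈ys
  ... | as , bs , w , x≈w , ys≋ = map′ to from (↭-dec xs (as ++ bs))
    where
    ys↭ : ys ↭ x ∷ as ++ bs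
    ys↭ = ↭-trans (↭-reflexive-≋ ys≋) (P.shift (DecSetoid.sym S x≈w) as bs)
    to : xs ↭ as ++ bs → x ∷ xs ↭ ys
    to p = ↭-trans (↭-prep x p) (↭-sym ys↭)
    from : x ∷ xs ↭ ys → xs ↭ as ++ bs
    from p = P.drop-∷ (↭-trans p ys↭)

  multisetDecSetoid : DecSetoid 0ℓ 0ℓ
  multisetDecSetoid = record
    { Carrier = List Carrier
    ; _≈_ = _↭_
    ; isDecEquivalence = record { isEquivalence = ↭-isEquivalence ; _≟_ = ↭-dec }
    }

module _ (k : ℕ) where

  Pointed : Set
  Pointed = ∃ λ (G : ColoredGraph) → Vec (Vertex G) k

  -- uᵢ ↦ vᵢ defines an isomorphism G[u₁,…,uₖ] → H[v₁,…,vₖ] of colored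
  -- graphs.  The first component says that it is a well-defined (⇒) and
  -- injective (⇐) map; it is surjective by construction.
  TupleIso : Pointed → Pointed → Set
  TupleIso (G , u) (H , v) =
      (∀ i j → (lookup u i ≡ lookup u j) ⇔ (lookup v i ≡ lookup v j))
    × (∀ i j → adjacent G (lookup u i) (lookup u j) ≡ adjacent H (lookup v i) (lookup v j))
    × (∀ i → color G (lookup u i) ≡ color H (lookup v i))

  tupleIso-isEquivalence : IsEquivalence TupleIso
  tupleIso-isEquivalence = record
    { refl  = (λ _ _ → ⇔.refl) , (λ _ _ → refl) , (λ _ → refl)
    ; sym   = λ (e , a , c) → (λ i j → ⇔.sym (e i j)) , (λ i j → sym (a i j)) , (λ i → sym (c i))
    ; trans = λ (e , a , c) (e′ , a′ , c′) →
        (λ i j → ⇔.trans (e i j) (e′ i j)) , (λ i j → trans (a i j) (a′ i j)) , (λ i → trans (c i) (c′ i))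
    }
    where module ⇔ = IsEquivalence (⇔-isEquivalence {0ℓ})

  tupleIso? : Decidable TupleIso
  tupleIso? (G , u) (H , v) =
    Fin.all? (λ i → Fin.all? λ j →
      (lookup u i Fin.≟ lookup u j) ⇔? (lookup v i Fin.≟ lookup v j))
    ×-dec Fin.all? (λ i → Fin.all? λ j →
      adjacent G (lookup u i) (lookup u j) Bool.≟ adjacent H (lookup v i) (lookup v j))
    ×-dec Fin.all? (λ i → color G (lookup u i) ℕ.≟ color H (lookup v i))
    where
    _⇔?_ : {A B : Set} → Dec A → Dec B → Dec (A ⇔ B)
    a? ⇔? b? = map′ (λ (f , g) → mk⇔ f g) (λ e → Equivalence.to e , Equivalence.from e)
                    ((a? →-dec b?) ×-dec (b? →-dec a?))

  -- The colors after r rounds, for tuples of all graphs at once; "the same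
  -- color" is the setoid equality.  An initial color is a graph with a
  -- k-tuple, taken up to TupleIso.
  colorDecSetoid : ℕ → DecSetoid 0ℓ 0ℓ
  colorDecSetoid zero = record
    { Carrier = Pointed
    ; _≈_ = TupleIso
    ; isDecEquivalence = record { isEquivalence = tupleIso-isEquivalence ; _≟_ = tupleIso? }
    }
  colorDecSetoid (suc r) =
    ×-decSetoid (colorDecSetoid r) (multisetDecSetoid (Vec.decSetoid (colorDecSetoid r) k))

  Color : ℕ → Set
  Color r = DecSetoid.Carrier (colorDecSetoid r)

  χ : (r : ℕ) (G : ColoredGraph) → Vec (Vertex G) k → Color r
  χ zero    G u = G , u
  χ (suc r) G u =
    χ r G u , List.map (λ w → tabulate λ i → χ r G (u [ i ]≔ w)) (allFin (order G))

tuples : (k n : ℕ) → List (Vec (Fin n) k)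
tuples zero    n = [] ∷ []
tuples (suc k) n = cartesianProductWith _∷_ (allFin n) (tuples k n)

colorCount : (k r : ℕ) → ColoredGraph → Color k r → ℕ
colorCount k r G q = length (filter (λ u → χ k r G u ≟ q) (tuples k (order G)))
  where open DecSetoid (colorDecSetoid k r) using (_≟_)

DistinguishesAfter : (k r : ℕ) → ColoredGraph → ColoredGraph → Set
DistinguishesAfter k r G H = ∃ λ (q : Color k r) → colorCount k r G q ≢ colorCount k r H q

IsCauchy : (ℕ → ℚ) → Set
IsCauchy x = ∀ ε → 0ℚ ℚ.< ε →
  ∃ λ N → ∀ m n → N ℕ.≤ m → N ℕ.≤ n → ∣ x m ℚ.- x n ∣ ℚ.≤ ε

record ℝ : Set where
  constructor real
  field
    seq    : ℕ → ℚ
    cauchy : IsCauchy seq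

open ℝ public

infix  4 _≤ᴿ_ _<ᴿ_
infixl 7 _*ᴿ_
infix  8 _²

_≤ᴿ_ : ℝ → ℝ → Set
x ≤ᴿ y = ∀ ε → 0ℚ ℚ.< ε → ∃ λ N → ∀ n → N ℕ.≤ n → seq x n ℚ.≤ seq y n ℚ.+ ε

_<ᴿ_ : ℝ → ℝ → Set
x <ᴿ y = ∃ λ ε → 0ℚ ℚ.< ε × ∃ λ N → ∀ n → N ℕ.≤ n → seq x n ℚ.+ ε ℚ.≤ seq y n

fromℚ : ℚ → ℝ
fromℚ p = real (λ _ → p) λ ε 0<ε → 0 , λ _ _ _ _ →
  ℚ.≤-trans (ℚ.≤-reflexive (cong ∣_∣ (ℚ.+-inverseʳ p))) (ℚ.<⇒≤ 0<ε)

fromℕ : ℕ → ℝ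
fromℕ n = fromℚ (+ n / 1)

private
  bound : (x : ℝ) → ∃ λ B → 0ℚ ℚ.< B × ∃ λ N → ∀ n → N ℕ.≤ n → ∣ seq x n ∣ ℚ.≤ B
  bound x with cauchy x 1ℚ (ℚ.positive⁻¹ 1ℚ)
  ... | N , close = 1ℚ ℚ.+ ∣ seq x N ∣ , 0<B , N , λ n N≤n → begin
    ∣ seq x n ∣                              ≡⟨ cong ∣_∣ (split (seq x n) (seq x N)) ⟩
    ∣ (seq x n ℚ.- seq x N) ℚ.+ seq x N ∣    ≤⟨ ℚ.∣p+q∣≤∣p∣+∣q∣ (seq x n ℚ.- seq x N) (seq x N) ⟩
    ∣ seq x n ℚ.- seq x N ∣ ℚ.+ ∣ seq x N ∣  ≤⟨ ℚ.+-monoˡ-≤ ∣ seq x N ∣ (close n N N≤n ℕ.≤-refl) ⟩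
    1ℚ ℚ.+ ∣ seq x N ∣                       ∎
    where
    open ℚ.≤-Reasoning
    open ℚ.+-*-Solver
    split : ∀ a b → a ≡ (a ℚ.- b) ℚ.+ b
    split = solve 2 (λ a b → a := (a :- b) :+ b) refl
    0<B : 0ℚ ℚ.< 1ℚ ℚ.+ ∣ seq x N ∣
    0<B = ℚ.+-mono-<-≤ (ℚ.positive⁻¹ 1ℚ) (ℚ.0≤∣p∣ (seq x N))

  product-difference : ∀ a b c d → a ℚ.* b ℚ.- c ℚ.* d ≡ a ℚ.* (b ℚ.- d) ℚ.+ (a ℚ.- c) ℚ.* d
  product-difference = solve 4 (λ a b c d → a :* b :- c :* d := a :* (b :- d) :+ (a :- c) :* d) refl
    where open ℚ.+-*-Solver

  collect : ∀ a b e i → a ℚ.* (e ℚ.* i) ℚ.+ (e ℚ.* i) ℚ.* b ≡ e ℚ.* ((a ℚ.+ b) ℚ.* i)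
  collect = solve 4 (λ a b e i → a :* (e :* i) :+ (e :* i) :* b := e :* ((a :+ b) :* i)) refl
    where open ℚ.+-*-Solver

  *-mono-≤ : ∀ {a b a′ b′} → 0ℚ ℚ.≤ b → 0ℚ ℚ.≤ a′ → a ℚ.≤ a′ → b ℚ.≤ b′ → a ℚ.* b ℚ.≤ a′ ℚ.* b′
  *-mono-≤ {a} {b} {a′} {b′} 0≤b 0≤a′ a≤a′ b≤b′ =
    ℚ.≤-trans (ℚ.*-monoʳ-≤-nonNeg b {{ℚ.nonNegative 0≤b}} a≤a′)
              (ℚ.*-monoˡ-≤-nonNeg a′ {{ℚ.nonNegative 0≤a′}} b≤b′)

  product-close : ∀ {A B δ} xm xn ym yn → 0ℚ ℚ.≤ A → 0ℚ ℚ.≤ δ →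
    ∣ xm ∣ ℚ.≤ A → ∣ yn ∣ ℚ.≤ B → ∣ xm ℚ.- xn ∣ ℚ.≤ δ → ∣ ym ℚ.- yn ∣ ℚ.≤ δ →
    ∣ xm ℚ.* ym ℚ.- xn ℚ.* yn ∣ ℚ.≤ A ℚ.* δ ℚ.+ δ ℚ.* B
  product-close {A} {B} {δ} xm xn ym yn 0≤A 0≤δ x≤A y≤B x-close y-close = begin
    ∣ xm ℚ.* ym ℚ.- xn ℚ.* yn ∣
      ≡⟨ cong ∣_∣ (product-difference xm ym xn yn) ⟩
    ∣ xm ℚ.* (ym ℚ.- yn) ℚ.+ (xm ℚ.- xn) ℚ.* yn ∣
      ≤⟨ ℚ.∣p+q∣≤∣p∣+∣q∣ (xm ℚ.* (ym ℚ.- yn)) ((xm ℚ.- xn) ℚ.* yn) ⟩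
    ∣ xm ℚ.* (ym ℚ.- yn) ∣ ℚ.+ ∣ (xm ℚ.- xn) ℚ.* yn ∣
      ≡⟨ cong₂ ℚ._+_ (ℚ.∣p*q∣≡∣p∣*∣q∣ xm (ym ℚ.- yn)) (ℚ.∣p*q∣≡∣p∣*∣q∣ (xm ℚ.- xn) yn) ⟩
    ∣ xm ∣ ℚ.* ∣ ym ℚ.- yn ∣ ℚ.+ ∣ xm ℚ.- xn ∣ ℚ.* ∣ yn ∣
      ≤⟨ ℚ.+-mono-≤ (*-mono-≤ (ℚ.0≤∣p∣ (ym ℚ.- yn)) 0≤A x≤A y-close)
                    (*-mono-≤ (ℚ.0≤∣p∣ yn) 0≤δ x-close y≤B) ⟩
    A ℚ.* δ ℚ.+ δ ℚ.* B ∎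
    where open ℚ.≤-Reasoning

  precision : ∀ A B ε → 0ℚ ℚ.< A → 0ℚ ℚ.< B → 0ℚ ℚ.< ε →
    ∃ λ δ → 0ℚ ℚ.< δ × A ℚ.* δ ℚ.+ δ ℚ.* B ≡ ε
  precision A B ε 0<A 0<B 0<ε =
    ε ℚ.* ℚ.1/ (A ℚ.+ B) ,
    ℚ.positive⁻¹ (ε ℚ.* ℚ.1/ (A ℚ.+ B)) {{ℚ.pos*pos⇒pos ε {{ℚ.positive 0<ε}} (ℚ.1/ (A ℚ.+ B)) {{ℚ.1/pos⇒pos (A ℚ.+ B)}}}} ,
    trans (collect A B ε (ℚ.1/ (A ℚ.+ B)))
      (trans (cong (ε ℚ.*_) (ℚ.*-inverseʳ (A ℚ.+ B))) (ℚ.*-identityʳ ε))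
    where
    instance
      pos : ℚ.Positive (A ℚ.+ B)
      pos = ℚ.positive (ℚ.+-mono-< 0<A 0<B)
      nonZero : ℚ.NonZero (A ℚ.+ B)
      nonZero = ℚ.pos⇒nonZero (A ℚ.+ B)

  *-cauchy : (x y : ℝ) → IsCauchy (λ n → seq x n ℚ.* seq y n)
  *-cauchy x y ε 0<ε =
    let A , 0<A , M , x≤A = bound x
        B , 0<B , N , y≤B = bound y
        δ , 0<δ , δ-eq = precision A B ε 0<A 0<B 0<ε
        P , x-close = cauchy x δ 0<δ
        Q , y-close = cauchy y δ 0<δ
        K   = (M ℕ.⊔ N) ℕ.⊔ (P ℕ.⊔ Q)
        M≤K = ℕ.≤-trans (ℕ.m≤m⊔n M N) (ℕ.m≤m⊔n (M ℕ.⊔ N) (P ℕ.⊔ Q))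
        N≤K = ℕ.≤-trans (ℕ.m≤n⊔m M N) (ℕ.m≤m⊔n (M ℕ.⊔ N) (P ℕ.⊔ Q))
        P≤K = ℕ.≤-trans (ℕ.m≤m⊔n P Q) (ℕ.m≤n⊔m (M ℕ.⊔ N) (P ℕ.⊔ Q))
        Q≤K = ℕ.≤-trans (ℕ.m≤n⊔m P Q) (ℕ.m≤n⊔m (M ℕ.⊔ N) (P ℕ.⊔ Q))
    in K , λ m n K≤m K≤n → ℚ.≤-trans
      (product-close (seq x m) (seq x n) (seq y m) (seq y n) (ℚ.<⇒≤ 0<A) (ℚ.<⇒≤ 0<δ)
        (x≤A m (ℕ.≤-trans M≤K K≤m)) (y≤B n (ℕ.≤-trans N≤K K≤n))
        (x-close m n (ℕ.≤-trans P≤K K≤m) (ℕ.≤-trans P≤K K≤n))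
        (y-close m n (ℕ.≤-trans Q≤K K≤m) (ℕ.≤-trans Q≤K K≤n)))
      (ℚ.≤-reflexive δ-eq)

_*ᴿ_ : ℝ → ℝ → ℝ
x *ᴿ y = real (λ n → seq x n ℚ.* seq y n) (*-cauchy x y)

_² : ℝ → ℝ
x ² = x *ᴿ x

dyadic : ℕ → ℕ → ℚ
dyadic a j = _/_ (+ a) (2 ℕ.^ j) {{ℕ.m^n≢0 2 j}}

private
  /-mono : ∀ a m b n .{{_ : ℕ.NonZero m}} .{{_ : ℕ.NonZero n}} →
           a ℕ.* n ℕ.≤ b ℕ.* m → + a / m ℚ.≤ + b / n
  /-mono a (suc m) b (suc n) h = ℚ.toℚᵘ-cancel-≤ (begin
    toℚᵘ (+ a / suc m)      ≃⟨ ℚ.toℚᵘ-fromℚᵘ (ℚᵘ.mkℚᵘ (+ a) m) ⟩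
    ℚᵘ.mkℚᵘ (+ a) m         ≤⟨ ℚᵘ.*≤* (subst₂ ℤ._≤_ (ℤ.pos-* a (suc n)) (ℤ.pos-* b (suc m)) (ℤ.+≤+ h)) ⟩
    ℚᵘ.mkℚᵘ (+ b) n         ≃⟨ ℚ.toℚᵘ-fromℚᵘ (ℚᵘ.mkℚᵘ (+ b) n) ⟨
    toℚᵘ (+ b / suc n)      ∎)
    where open ℚᵘ.≤-Reasoning

  /-+ : ∀ a m b n c d .{{_ : ℕ.NonZero m}} .{{_ : ℕ.NonZero n}} .{{_ : ℕ.NonZero d}} →
        (a ℕ.* n ℕ.+ b ℕ.* m) ℕ.* d ≡ c ℕ.* (m ℕ.* n) → + a / m ℚ.+ + b / n ≡ + c / d
  /-+ a (suc m) b (suc n) c (suc d) eq = ℚ.toℚᵘ-injective (begin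
    toℚᵘ (+ a / suc m ℚ.+ + b / suc n)
      ≈⟨ ℚ.toℚᵘ-homo-+ (+ a / suc m) (+ b / suc n) ⟩
    toℚᵘ (+ a / suc m) ℚᵘ.+ toℚᵘ (+ b / suc n)
      ≈⟨ ℚᵘ.+-cong (ℚ.toℚᵘ-fromℚᵘ (ℚᵘ.mkℚᵘ (+ a) m)) (ℚ.toℚᵘ-fromℚᵘ (ℚᵘ.mkℚᵘ (+ b) n)) ⟩
    ℚᵘ.mkℚᵘ (+ a) m ℚᵘ.+ ℚᵘ.mkℚᵘ (+ b) n
      ≡⟨ cong (λ z → ℚᵘ.mkℚᵘ z (n ℕ.+ m ℕ.* suc n))
           (trans (cong₂ ℤ._+_ (sym (ℤ.pos-* a (suc n))) (sym (ℤ.pos-* b (suc m))))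
                  (sym (ℤ.pos-+ (a ℕ.* suc n) (b ℕ.* suc m)))) ⟩
    ℚᵘ.mkℚᵘ (+ (a ℕ.* suc n ℕ.+ b ℕ.* suc m)) (n ℕ.+ m ℕ.* suc n)
      ≈⟨ ℚᵘ.*≡* (trans (sym (ℤ.pos-* (a ℕ.* suc n ℕ.+ b ℕ.* suc m) (suc d)))
                  (trans (cong +_ eq) (ℤ.pos-* c (suc m ℕ.* suc n)))) ⟩
    ℚᵘ.mkℚᵘ (+ c) d
      ≈⟨ ℚ.toℚᵘ-fromℚᵘ (ℚᵘ.mkℚᵘ (+ c) d) ⟨
    toℚᵘ (+ c / suc d) ∎)
    where open ℚᵘ.≃-Reasoning

  n≤2^n : ∀ n → n ℕ.≤ 2 ℕ.^ n
  n≤2^n zero    = ℕ.z≤n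
  n≤2^n (suc n) = ℕ.+-mono-≤ (ℕ.m^n>0 2 n) (ℕ.≤-trans (n≤2^n n) (ℕ.m≤m+n (2 ℕ.^ n) 0))

  archimedean : ∀ ε → 0ℚ ℚ.< ε → ∃ λ N → dyadic 1 N ℚ.≤ ε
  archimedean ε@(mkℚ (+ suc p) d _) 0<ε = suc d , ℚ.≤-trans
    (/-mono 1 (2 ℕ.^ suc d) (suc p) (suc d) {{ℕ.m^n≢0 2 (suc d)}}
      (ℕ.≤-trans (ℕ.≤-reflexive (ℕ.*-identityˡ (suc d)))
        (ℕ.≤-trans (n≤2^n (suc d)) (ℕ.m≤m+n _ _))))
    (ℚ.≤-reflexive (ℚ.↥p/↧p≡p ε))
  archimedean (mkℚ (+ 0) d _)        (ℚ.*<* (ℤ.+<+ ()))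
  archimedean (mkℚ ℤ.-[1+ p ] d _)   (ℚ.*<* ())

  enclosed-cauchy : (lo x hi : ℕ → ℚ) →
    (∀ N m → N ℕ.≤ m → lo N ℚ.≤ x m) → (∀ N m → N ℕ.≤ m → x m ℚ.≤ hi N) →
    (∀ N → hi N ℚ.≤ lo N ℚ.+ dyadic 1 N) → IsCauchy x
  enclosed-cauchy lo x hi lo≤ ≤hi width ε 0<ε with archimedean ε 0<ε
  ... | N , small = N , λ m n N≤m N≤n → close m n N≤m N≤n
    where
    open ℚ.≤-Reasoning
    open ℚ.+-*-Solver
    one : ∀ m n → N ℕ.≤ m → N ℕ.≤ n → x m ℚ.- x n ℚ.≤ ε
    one m n N≤m N≤n = begin
      x m ℚ.- x n           ≤⟨ ℚ.+-mono-≤ (≤hi N m N≤m) (ℚ.neg-antimono-≤ (lo≤ N n N≤n)) ⟩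
      hi N ℚ.- lo N         ≤⟨ ℚ.+-monoˡ-≤ (ℚ.- lo N) (ℚ.≤-trans (width N) (ℚ.+-monoʳ-≤ (lo N) small)) ⟩
      lo N ℚ.+ ε ℚ.- lo N   ≡⟨ solve 2 (λ a e → a :+ e :- a := e) refl (lo N) ε ⟩
      ε                     ∎
    close : ∀ m n → N ℕ.≤ m → N ℕ.≤ n → ∣ x m ℚ.- x n ∣ ℚ.≤ ε
    close m n N≤m N≤n with ℚ.∣p∣≡p∨∣p∣≡-p (x m ℚ.- x n)
    ... | inj₁ e = ℚ.≤-trans (ℚ.≤-reflexive e) (one m n N≤m N≤n)
    ... | inj₂ e = ℚ.≤-trans
      (ℚ.≤-reflexive (trans e (solve 2 (λ a b → :- (a :- b) := b :- a) refl (x m) (x n))))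
      (one n m N≤n N≤m)

  mono-from-step : (f : ℕ → ℚ) → (∀ j → f j ℚ.≤ f (suc j)) → ∀ N m → N ℕ.≤ m → f N ℚ.≤ f m
  mono-from-step f step N m N≤m = go (ℕ.≤⇒≤′ N≤m)
    where
    go : ∀ {m} → N ℕ.≤′ m → f N ℚ.≤ f m
    go ℕ.≤′-refl     = ℚ.≤-refl
    go (ℕ.≤′-step p) = ℚ.≤-trans (go p) (step _)

  anti-from-step : (f : ℕ → ℚ) → (∀ j → f (suc j) ℚ.≤ f j) → ∀ N m → N ℕ.≤ m → f m ℚ.≤ f N
  anti-from-step f step N m N≤m = go (ℕ.≤⇒≤′ N≤m)
    where
    go : ∀ {m} → N ℕ.≤′ m → f m ℚ.≤ f N
    go ℕ.≤′-refl     = ℚ.≤-refl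
    go (ℕ.≤′-step p) = ℚ.≤-trans (step _) (go p)

  module Nested
    (lo hi : ℕ → ℚ)
    (lo-step : ∀ j → lo j ℚ.≤ lo (suc j))
    (hi-step : ∀ j → hi (suc j) ℚ.≤ hi j)
    (lo≤hi : ∀ j → lo j ℚ.≤ hi j)
    (width : ∀ j → hi j ℚ.≤ lo j ℚ.+ dyadic 1 j)
    where

    lo-cauchy : IsCauchy lo
    lo-cauchy = enclosed-cauchy lo lo hi (mono-from-step lo lo-step)
      (λ N m N≤m → ℚ.≤-trans (lo≤hi m) (anti-from-step hi hi-step N m N≤m)) width

    hi-cauchy : IsCauchy hi
    hi-cauchy = enclosed-cauchy lo hi hi
      (λ N m N≤m → ℚ.≤-trans (mono-from-step lo lo-step N m N≤m) (lo≤hi m))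
      (anti-from-step hi hi-step) width

-- 1/(a+1) + 1/(a+2) + … + 1/(a+n)
harmonic : ℕ → ℕ → ℚ
harmonic a zero    = 0ℚ
harmonic a (suc n) = harmonic a n ℚ.+ + 1 / suc (a ℕ.+ n)

-- The right Riemann sum of ∫₁ᵏ dt/t with mesh 2⁻ʲ, where N = (k-1)·2ʲ:
-- Σ_{1 ≤ i ≤ N} 2⁻ʲ · 1/(1 + i·2⁻ʲ) = Σ_{1 ≤ i ≤ N} 1/(2ʲ + i).
logSeq : ℕ → ℕ → ℚ
logSeq k j = harmonic (2 ℕ.^ j) ((k ℕ.∸ 1) ℕ.* 2 ℕ.^ j)

private
  recip-anti : ∀ m n → m ℕ.≤ n → + 1 / suc n ℚ.≤ + 1 / suc m
  recip-anti m n m≤n = /-mono 1 (suc n) 1 (suc m) (ℕ.+-monoˡ-≤ 0 (ℕ.s≤s m≤n))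

  harmonic-shift : ∀ a n →
    harmonic a n ℚ.+ + 1 / suc (a ℕ.+ n) ≡ harmonic (suc a) n ℚ.+ + 1 / suc a
  harmonic-shift a zero = cong (λ z → 0ℚ ℚ.+ + 1 / suc z) (ℕ.+-identityʳ a)
  harmonic-shift a (suc n) = trans
    (cong₂ ℚ._+_ (harmonic-shift a n) (cong (λ z → + 1 / suc z) (ℕ.+-suc a n)))
    (exchange (harmonic (suc a) n) (+ 1 / suc a) (+ 1 / suc (suc a ℕ.+ n)))
    where
    exchange : ∀ h x y → h ℚ.+ x ℚ.+ y ≡ h ℚ.+ y ℚ.+ x
    exchange = solve 3 (λ h x y → h :+ x :+ y := h :+ y :+ x) refl
      where open ℚ.+-*-Solver

  harmonic-width : ∀ a n → harmonic a n ℚ.≤ harmonic (suc a) n ℚ.+ + 1 / suc a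
  harmonic-width a n = begin
    harmonic a n                            ≡⟨ ℚ.+-identityʳ (harmonic a n) ⟨
    harmonic a n ℚ.+ 0ℚ                     ≤⟨ ℚ.+-monoʳ-≤ (harmonic a n) (/-mono 0 1 1 (suc (a ℕ.+ n)) ℕ.z≤n) ⟩
    harmonic a n ℚ.+ + 1 / suc (a ℕ.+ n)    ≡⟨ harmonic-shift a n ⟩
    harmonic (suc a) n ℚ.+ + 1 / suc a      ∎
    where open ℚ.≤-Reasoning

  harmonic-anti : ∀ a n → harmonic (suc a) n ℚ.≤ harmonic a n
  harmonic-anti a zero    = ℚ.≤-refl
  harmonic-anti a (suc n) = ℚ.+-mono-≤ (harmonic-anti a n)
    (recip-anti (a ℕ.+ n) (suc a ℕ.+ n) (ℕ.n≤1+n (a ℕ.+ n)))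

  double : ∀ s → + 1 / suc (suc (s ℕ.* 2)) ℚ.+ + 1 / suc (suc (s ℕ.* 2)) ≡ + 1 / suc s
  double s = /-+ 1 (suc (suc (s ℕ.* 2))) 1 (suc (suc (s ℕ.* 2))) 1 (suc s) (eq s)
    where
    eq : ∀ s → (1 ℕ.* (2 ℕ.+ s ℕ.* 2) ℕ.+ 1 ℕ.* (2 ℕ.+ s ℕ.* 2)) ℕ.* (1 ℕ.+ s)
               ≡ 1 ℕ.* ((2 ℕ.+ s ℕ.* 2) ℕ.* (2 ℕ.+ s ℕ.* 2))
    eq = solve 1 (λ s → (con 1 :* (con 2 :+ s :* con 2) :+ con 1 :* (con 2 :+ s :* con 2)) :* (con 1 :+ s)
                        := con 1 :* ((con 2 :+ s :* con 2) :* (con 2 :+ s :* con 2))) refl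
      where open ℕ.+-*-Solver

  upper-refine : ∀ a n → harmonic (suc (a ℕ.* 2)) (n ℕ.* 2) ℚ.≤ harmonic a n
  upper-refine a zero    = ℚ.≤-refl
  upper-refine a (suc n) = begin
    H ℚ.+ + 1 / suc (suc (a ℕ.* 2) ℕ.+ n ℕ.* 2) ℚ.+ + 1 / suc (suc (a ℕ.* 2) ℕ.+ suc (n ℕ.* 2))
      ≡⟨ ℚ.+-assoc H (+ 1 / suc (suc (a ℕ.* 2) ℕ.+ n ℕ.* 2)) (+ 1 / suc (suc (a ℕ.* 2) ℕ.+ suc (n ℕ.* 2))) ⟩
    H ℚ.+ (+ 1 / suc (suc (a ℕ.* 2) ℕ.+ n ℕ.* 2) ℚ.+ + 1 / suc (suc (a ℕ.* 2) ℕ.+ suc (n ℕ.* 2)))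
      ≤⟨ ℚ.+-mono-≤ (upper-refine a n) (ℚ.+-mono-≤
           (recip-anti (suc ((a ℕ.+ n) ℕ.* 2)) (suc (a ℕ.* 2) ℕ.+ n ℕ.* 2) (ℕ.s≤s distrib))
           (recip-anti (suc ((a ℕ.+ n) ℕ.* 2)) (suc (a ℕ.* 2) ℕ.+ suc (n ℕ.* 2))
             (ℕ.s≤s (ℕ.≤-trans distrib (ℕ.+-monoʳ-≤ (a ℕ.* 2) (ℕ.n≤1+n (n ℕ.* 2))))))) ⟩
    harmonic a n ℚ.+ (+ 1 / suc (suc ((a ℕ.+ n) ℕ.* 2)) ℚ.+ + 1 / suc (suc ((a ℕ.+ n) ℕ.* 2)))
      ≡⟨ cong (harmonic a n ℚ.+_) (double (a ℕ.+ n)) ⟩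
    harmonic a n ℚ.+ + 1 / suc (a ℕ.+ n) ∎
    where
    open ℚ.≤-Reasoning
    H = harmonic (suc (a ℕ.* 2)) (n ℕ.* 2)
    distrib : (a ℕ.+ n) ℕ.* 2 ℕ.≤ a ℕ.* 2 ℕ.+ n ℕ.* 2
    distrib = ℕ.≤-reflexive (ℕ.*-distribʳ-+ 2 a n)

  lower-refine : ∀ a n → harmonic a n ℚ.≤ harmonic (a ℕ.* 2) (n ℕ.* 2)
  lower-refine a zero    = ℚ.≤-refl
  lower-refine a (suc n) = begin
    harmonic a n ℚ.+ + 1 / suc (a ℕ.+ n)
      ≡⟨ cong (harmonic a n ℚ.+_) (double (a ℕ.+ n)) ⟨
    harmonic a n ℚ.+ (+ 1 / suc (suc ((a ℕ.+ n) ℕ.* 2)) ℚ.+ + 1 / suc (suc ((a ℕ.+ n) ℕ.* 2)))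
      ≤⟨ ℚ.+-mono-≤ (lower-refine a n) (ℚ.+-mono-≤
           (recip-anti (a ℕ.* 2 ℕ.+ n ℕ.* 2) (suc ((a ℕ.+ n) ℕ.* 2)) (ℕ.m≤n⇒m≤1+n distrib))
           (recip-anti (a ℕ.* 2 ℕ.+ suc (n ℕ.* 2)) (suc ((a ℕ.+ n) ℕ.* 2))
             (ℕ.≤-trans (ℕ.≤-reflexive (ℕ.+-suc (a ℕ.* 2) (n ℕ.* 2))) (ℕ.s≤s distrib)))) ⟩
    H ℚ.+ (+ 1 / suc (a ℕ.* 2 ℕ.+ n ℕ.* 2) ℚ.+ + 1 / suc (a ℕ.* 2 ℕ.+ suc (n ℕ.* 2)))
      ≡⟨ ℚ.+-assoc H (+ 1 / suc (a ℕ.* 2 ℕ.+ n ℕ.* 2)) (+ 1 / suc (a ℕ.* 2 ℕ.+ suc (n ℕ.* 2))) ⟨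
    H ℚ.+ + 1 / suc (a ℕ.* 2 ℕ.+ n ℕ.* 2) ℚ.+ + 1 / suc (a ℕ.* 2 ℕ.+ suc (n ℕ.* 2)) ∎
    where
    open ℚ.≤-Reasoning
    H = harmonic (a ℕ.* 2) (n ℕ.* 2)
    distrib : a ℕ.* 2 ℕ.+ n ℕ.* 2 ℕ.≤ (a ℕ.+ n) ℕ.* 2
    distrib = ℕ.≤-reflexive (sym (ℕ.*-distribʳ-+ 2 a n))

  log-cauchy : ∀ k → IsCauchy (logSeq k)
  log-cauchy k = Nested.lo-cauchy (logSeq k) hi lo-step hi-step lo≤hi width
    where
    steps : ℕ → ℕ
    steps j = (k ℕ.∸ 1) ℕ.* 2 ℕ.^ j

    p : ℕ → ℕ
    p j = ℕ.pred (2 ℕ.^ j)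

    suc-p : ∀ j → suc (p j) ≡ 2 ℕ.^ j
    suc-p j = ℕ.suc-pred (2 ℕ.^ j) {{ℕ.m^n≢0 2 j}}

    -- left Riemann sums
    hi : ℕ → ℚ
    hi j = harmonic (p j) (steps j)

    pow : ∀ j → 2 ℕ.^ j ℕ.* 2 ≡ 2 ℕ.^ suc j
    pow j = ℕ.*-comm (2 ℕ.^ j) 2

    steps-suc : ∀ j → steps j ℕ.* 2 ≡ steps (suc j)
    steps-suc j = trans (ℕ.*-assoc (k ℕ.∸ 1) (2 ℕ.^ j) 2) (cong ((k ℕ.∸ 1) ℕ.*_) (pow j))

    p-suc : ∀ j → suc (p j ℕ.* 2) ≡ p (suc j)
    p-suc j = ℕ.suc-injective
      (trans (trans (cong (ℕ._* 2) (suc-p j)) (pow j)) (sym (suc-p (suc j))))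

    lo-step : ∀ j → logSeq k j ℚ.≤ logSeq k (suc j)
    lo-step j = subst₂ (λ a n → logSeq k j ℚ.≤ harmonic a n) (pow j) (steps-suc j)
      (lower-refine (2 ℕ.^ j) (steps j))

    hi-step : ∀ j → hi (suc j) ℚ.≤ hi j
    hi-step j = subst₂ (λ a n → harmonic a n ℚ.≤ hi j) (p-suc j) (steps-suc j)
      (upper-refine (p j) (steps j))

    lo≤hi : ∀ j → logSeq k j ℚ.≤ hi j
    lo≤hi j = subst (λ a → harmonic a (steps j) ℚ.≤ hi j) (suc-p j) (harmonic-anti (p j) (steps j))

    width : ∀ j → hi j ℚ.≤ logSeq k j ℚ.+ dyadic 1 j
    width j = ℚ.≤-trans
      (subst (λ a → hi j ℚ.≤ harmonic a (steps j) ℚ.+ + 1 / suc (p j)) (suc-p j) (harmonic-width (p j) (steps j)))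
      (ℚ.+-monoʳ-≤ (logSeq k j)
        (/-mono 1 (suc (p j)) 1 (2 ℕ.^ j) {{_}} {{ℕ.m^n≢0 2 j}}
          (ℕ.≤-reflexive (cong (1 ℕ.*_) (sym (suc-p j))))))

-- The natural logarithm ∫₁ᵏ dt/t, with junk value log 0 = 0.
log : ℕ → ℝ
log k = real (logSeq k) (log-cauchy k)

-- ⌊√n⌋, given that a = ⌊√(n-1)⌋
isqrtStep : (n a : ℕ) → ℕ
isqrtStep n a with suc a ℕ.* suc a ℕ.≤? n
... | yes _ = suc a
... | no  _ = a

isqrt : ℕ → ℕ
isqrt zero    = 0
isqrt (suc n) = isqrtStep (suc n) (isqrt n)

-- √n rounded down to a multiple of 2⁻ʲ
sqrtSeq : ℕ → ℕ → ℚ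
sqrtSeq n j = dyadic (isqrt (n ℕ.* 4 ℕ.^ j)) j

private
  isqrt-lower : ∀ n → isqrt n ℕ.* isqrt n ℕ.≤ n
  isqrt-lower zero = ℕ.z≤n
  isqrt-lower (suc n) with suc (isqrt n) ℕ.* suc (isqrt n) ℕ.≤? suc n
  ... | yes p = p
  ... | no  _ = ℕ.m≤n⇒m≤1+n (isqrt-lower n)

  square-mono : ∀ {a b} → a ℕ.< b → a ℕ.* a ℕ.< b ℕ.* b
  square-mono {a} {b} a<b = ℕ.*-mono-< {a} {b} {a} {b} a<b a<b

  isqrt-upper : ∀ n → n ℕ.< suc (isqrt n) ℕ.* suc (isqrt n)
  isqrt-upper zero = ℕ.s≤s ℕ.z≤n
  isqrt-upper (suc n) with suc (isqrt n) ℕ.* suc (isqrt n) ℕ.≤? suc n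
  ... | yes _ = ℕ.≤-<-trans (isqrt-upper n) (square-mono (ℕ.n<1+n (suc (isqrt n))))
  ... | no  p = ℕ.≰⇒> p

  square-cancel : ∀ a b → a ℕ.* a ℕ.< b ℕ.* b → a ℕ.< b
  square-cancel a b h = ℕ.≰⇒> λ b≤a → ℕ.<⇒≱ h (ℕ.*-mono-≤ b≤a b≤a)

  quadruple : ∀ a → (a ℕ.* 2) ℕ.* (a ℕ.* 2) ≡ 4 ℕ.* (a ℕ.* a)
  quadruple = solve 1 (λ a → (a :* con 2) :* (a :* con 2) := con 4 :* (a :* a)) refl
    where open ℕ.+-*-Solver

  isqrt-4-lower : ∀ n → isqrt n ℕ.* 2 ℕ.≤ isqrt (4 ℕ.* n)
  isqrt-4-lower n = ℕ.≤-pred (square-cancel (isqrt n ℕ.* 2) (suc (isqrt (4 ℕ.* n)))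
    (ℕ.≤-<-trans (ℕ.≤-trans (ℕ.≤-reflexive (quadruple (isqrt n))) (ℕ.*-monoʳ-≤ 4 (isqrt-lower n)))
                 (isqrt-upper (4 ℕ.* n))))

  isqrt-4-upper : ∀ n → isqrt (4 ℕ.* n) ℕ.< suc (isqrt n) ℕ.* 2
  isqrt-4-upper n = square-cancel (isqrt (4 ℕ.* n)) (suc (isqrt n) ℕ.* 2)
    (ℕ.≤-<-trans (isqrt-lower (4 ℕ.* n))
      (ℕ.<-≤-trans (ℕ.*-monoʳ-< 4 (isqrt-upper n)) (ℕ.≤-reflexive (sym (quadruple (suc (isqrt n)))))))

  halve-lower : ∀ a b j → a ℕ.* 2 ℕ.≤ b → dyadic a j ℚ.≤ dyadic b (suc j)
  halve-lower a b j h = /-mono a (2 ℕ.^ j) b (2 ℕ.^ suc j) {{ℕ.m^n≢0 2 j}} {{ℕ.m^n≢0 2 (suc j)}}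
    (ℕ.≤-trans (ℕ.≤-reflexive (sym (ℕ.*-assoc a 2 (2 ℕ.^ j)))) (ℕ.*-monoˡ-≤ (2 ℕ.^ j) h))

  halve-upper : ∀ a b j → b ℕ.≤ a ℕ.* 2 → dyadic b (suc j) ℚ.≤ dyadic a j
  halve-upper a b j h = /-mono b (2 ℕ.^ suc j) a (2 ℕ.^ j) {{ℕ.m^n≢0 2 (suc j)}} {{ℕ.m^n≢0 2 j}}
    (ℕ.≤-trans (ℕ.*-monoˡ-≤ (2 ℕ.^ j) h) (ℕ.≤-reflexive (ℕ.*-assoc a 2 (2 ℕ.^ j))))

  sqrt-cauchy : ∀ n → IsCauchy (sqrtSeq n)
  sqrt-cauchy n = Nested.lo-cauchy (sqrtSeq n) hi
    (λ j → halve-lower (a j) (a (suc j)) j (subst (λ z → a j ℕ.* 2 ℕ.≤ isqrt z) (four j) (isqrt-4-lower (n ℕ.* 4 ℕ.^ j))))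
    (λ j → halve-upper (suc (a j)) (suc (a (suc j))) j (subst (λ z → isqrt z ℕ.< suc (a j) ℕ.* 2) (four j) (isqrt-4-upper (n ℕ.* 4 ℕ.^ j))))
    (λ j → /-mono (a j) (2 ℕ.^ j) (suc (a j)) (2 ℕ.^ j) {{ℕ.m^n≢0 2 j}} {{ℕ.m^n≢0 2 j}} (ℕ.*-monoˡ-≤ (2 ℕ.^ j) (ℕ.n≤1+n (a j))))
    width
    where
    a : ℕ → ℕ
    a j = isqrt (n ℕ.* 4 ℕ.^ j)
    hi : ℕ → ℚ
    hi j = dyadic (suc (a j)) j
    four : ∀ j → 4 ℕ.* (n ℕ.* 4 ℕ.^ j) ≡ n ℕ.* 4 ℕ.^ suc j
    four j = solve 2 (λ n f → con 4 :* (n :* f) := n :* (con 4 :* f)) refl n (4 ℕ.^ j)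
      where open ℕ.+-*-Solver
    width : ∀ j → hi j ℚ.≤ sqrtSeq n j ℚ.+ dyadic 1 j
    width j = ℚ.≤-reflexive (sym (/-+ (a j) (2 ℕ.^ j) 1 (2 ℕ.^ j) (suc (a j)) (2 ℕ.^ j)
      {{ℕ.m^n≢0 2 j}} {{ℕ.m^n≢0 2 j}} {{ℕ.m^n≢0 2 j}}
      (solve 2 (λ a d → (a :* d :+ con 1 :* d) :* d := (con 1 :+ a) :* (d :* d)) refl (a j) (2 ℕ.^ j))))
      where open ℕ.+-*-Solver

√ : ℕ → ℝ
√ n = real (sqrtSeq n) (sqrt-cauchy n)

{-# OPTIONS --safe #-}
-- Take k cells on a ring, each at one of O(k + √n) positions on a path, and k rows, each of
-- which sees two neighbouring cells. Constraints on the pairs of positions seen by the rows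
-- turn the middle parts of the paths into a boustrophedon counter with more than n^(k/2)
-- values. In the graphs every state of a row carries a value in F₂, and gadgets as in the
-- construction of Cai, Fürer and Immerman make the sum of the k values at a configuration
-- invariant under moving a cell. The colors force this sum to be 0 at the first configuration
-- and, in H only, to be 1 at the last one.
--
-- With k + 1 pebbles Spoiler carries the sum along the counter, so k-WL distinguishes G and H.
-- Conversely, adding to the values potentials of the cells and a twist between two adjacent
-- positions respects the colors and all constraints away from the twist. Duplicator keeps the
-- twist unpebbled near one of the two ends of the paths. The pebbles hinder the twist from
-- moving to the other end only while they show a configuration, which reveals on which side
-- of it the twist is. Since a round changes the value of the counter by at most 1, this does
-- no harm for half as many rounds as the counter has values.

module Submission where

open import Defs
open import Data.Bool.Base using (Bool; true; false; _∧_; _∨_; _xor_; not; if_then_else_)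
import Data.Bool.Properties as Bool
open import Data.Bool.Solver using (module xor-∧-Solver)
open import Data.Empty using (⊥; ⊥-elim)
open import Data.Fin.Base as Fin using (Fin; zero; suc; toℕ; inject₁)
open import Data.Fin.Patterns using (0F; 1F; 2F)
import Data.Fin.Properties as Fin
open import Data.Fin.Relation.Unary.Top using (view; ‵fromℕ; ‵inject₁)
import Data.Integer.Base as ℤ
import Data.Integer.Properties as ℤ
open import Data.List.Base as List using (List; []; _∷_; length; filter; allFin)
open import Data.List.Membership.Propositional using (_∈_)
open import Data.List.Membership.Propositional.Properties using (∈-allFin; ∈-map⁺; ∈-cartesianProductWith⁺; ∈-filter⁺)
open import Data.List.Membership.Propositional.Properties.WithK using (unique∧set⇒bag)
import Data.List.Properties as List
open import Data.List.Relation.Binary.BagAndSetEquality using (∼bag⇒↭)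
import Data.List.Relation.Binary.Permutation.Propositional as Perm
import Data.List.Relation.Binary.Permutation.Propositional.Properties as Perm
import Data.List.Relation.Binary.Permutation.Setoid as SetoidPerm
import Data.List.Relation.Binary.Permutation.Setoid.Properties as SetoidPermP
import Data.List.Relation.Unary.All as All
import Data.List.Relation.Unary.AllPairs as AllPairs
open import Data.List.Relation.Unary.Any as Any using (here)
import Data.List.Relation.Unary.Any.Properties as Any
open import Data.List.Relation.Unary.Unique.Propositional using (Unique)
import Data.List.Relation.Unary.Unique.Propositional.Properties as Unique
open import Data.Nat.Base
import Data.Nat.Properties as ℕ
import Data.Nat.Solver as ℕ
open import Data.Product.Base using (∃; ∃₂; _×_; _,_; proj₁; proj₂)
open import Data.Product.Function.NonDependent.Propositional using (_×-↔_)
import Data.Product.Properties as Product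
open import Data.Rational.Base as ℚ using (ℚ; 0ℚ; 1ℚ; toℚᵘ)
import Data.Rational.Properties as ℚ
import Data.Rational.Unnormalised.Base as ℚᵘ
import Data.Rational.Unnormalised.Properties as ℚᵘ
open import Data.Sum.Base using (_⊎_; inj₁; inj₂; swap)
open import Data.Unit.Base using (⊤; tt)
open import Data.Vec.Base as Vec using (Vec; []; _∷_; lookup; tabulate; replicate; head; _[_]≔_)
import Data.Vec.Properties as Vec
import Data.Vec.Relation.Binary.Pointwise.Inductive as Pointwise
open import Function.Base using (_∘_; id; case_of_)
open import Function.Bundles using (mk⇔; _↔_; Inverse)
open import Function.Properties.Inverse using (↔-refl; ↔-sym; ↔-trans)
open import Relation.Binary.Bundles using (DecSetoid)
open import Relation.Binary.Construct.Closure.Equivalence as EqC using (EqClosure)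
open import Relation.Binary.Construct.Closure.ReflexiveTransitive using (ε; _◅_; _◅◅_)
open import Relation.Binary.Construct.Closure.Symmetric using (fwd; bwd)
open import Relation.Binary.PropositionalEquality hiding (setoid)
import Relation.Binary.PropositionalEquality as ≡
open import Relation.Nullary
open import Relation.Nullary.Decidable using (map′; _×-dec_; _⊎-dec_; _→-dec_; ¬?; dec-true; dec-false; does-⇔)

-- The twist cannot hide in the middle of the paths: a pebble there may see two distant positions
-- and cut every gap between them. In the end parts adjacent cells stay within distance 1, so a
-- pebble cuts at most one gap, and `k + 2` gaps leave one that none of `k + 1` pebbles cuts. This
-- fixes the length `E` of the end parts. The bound `k * k <= n`, extracted from the hypothesis on
-- `n`, keeps them from outgrowing the middle, whose length is proportional to the integer root of
-- `n`.
--
-- The obstacle is that the same pebbles may show several configurations at once, which differ in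
-- many cells by 1 each. Their counter values must nevertheless differ by at most 1. Therefore the
-- value counts the moves of the fastest digit only, and a slower digit contributes through the
-- number of full sweeps behind it. Both ends of the counter are then more than `T` steps away only
-- if the counter has more than `2 T + 1` steps, which is where half of its length comes from.

-- Weisfeiler-Leman rounds as a game

-- All of Duplicator's bijections add elements of F₂ and are their own inverses, so this is the only
-- source of permutations needed for `match` and `indistinguishable`.
involution-↭ : {A : Set} {f : A → A} → (∀ x → f (f x) ≡ x) → (xs : List A) → Unique xs →
               (∀ x → x ∈ xs) → List.map f xs Perm.↭ xs
involution-↭ {f = f} inv xs unique complete =
  ∼bag⇒↭ (unique∧set⇒bag
    (Unique.map⁺ (λ {x} {y} e → trans (sym (inv x)) (trans (cong f e) (inv y))) unique) unique
    (mk⇔ (λ _ → complete _) (λ _ → subst (_∈ List.map f xs) (inv _) (∈-map⁺ f (complete _)))))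

tuples-complete : ∀ {n} k (u : Vec (Fin n) k) → u ∈ tuples k n
tuples-complete zero    []      = here refl
tuples-complete (suc k) (x ∷ u) = ∈-cartesianProductWith⁺ _∷_ (∈-allFin x) (tuples-complete k u)

tuples-unique : ∀ k n → Unique (tuples k n)
tuples-unique zero    n = All.[] AllPairs.∷ AllPairs.[]
tuples-unique (suc k) n =
  Unique.cartesianProductWith⁺ _∷_ Vec.∷-injective (Unique.allFin⁺ n) (tuples-unique k n)

module _ {k : ℕ} where

  abstract
    SameColor : ℕ → (G H : ColoredGraph) → Vec (Vertex G) k → Vec (Vertex H) k → Set
    SameColor r G H u v = χ k r G u ≈ χ k r H v
      where open DecSetoid (colorDecSetoid k r) using (_≈_)

    sameColor⇒tupleIso : ∀ r {G H u v} → SameColor r G H u v → TupleIso k (G , u) (H , v)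
    sameColor⇒tupleIso zero    same = same
    sameColor⇒tupleIso (suc r) same = sameColor⇒tupleIso r (proj₁ same)

    tupleIso⇒sameColor : ∀ {G H u v} → TupleIso k (G , u) (H , v) → SameColor 0 G H u v
    tupleIso⇒sameColor iso = iso

  module _ (r : ℕ) (G H : ColoredGraph) (u : Vec (Vertex G) k) (v : Vec (Vertex H) k) where
    private
      S = Pointwise.decSetoid (colorDecSetoid k r) k
      open DecSetoid S using (setoid; _≈_)
      open SetoidPerm setoid
      f : Vertex G → Vec (Color k r) k
      f w = tabulate λ i → χ k r G (u [ i ]≔ w)
      g : Vertex H → Vec (Color k r) k
      g w = tabulate λ i → χ k r H (v [ i ]≔ w)

    abstract
      -- One answer `w′` serves all places `i`, because a round collects the `k` colors obtained
      -- from the same `w`. So `w` acts as pebble number `k + 1`: it can be compared with every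
      -- entry of `u` before it replaces one of them.
      reply : SameColor (suc r) G H u v → (w : Vertex G) →
              ∃ λ w′ → ∀ i → SameColor r G H (u [ i ]≔ w) (v [ i ]≔ w′)
      reply (_ , perm) w with Any.satisfied (Any.map⁻
        (SetoidPermP.∈-resp-↭ setoid perm (Any.map⁺ (Any.map (λ { refl → DecSetoid.refl S }) (∈-allFin w)))))
      ... | w′ , same = w′ , Pointwise.tabulate⁻ same

      match : SameColor r G H u v → (β : Vertex G → Vertex H) → List.map β (allFin _) Perm.↭ allFin _ →
              (∀ w i → SameColor r G H (u [ i ]≔ w) (v [ i ]≔ β w)) → SameColor (suc r) G H u v
      match same β perm sames = same ,
        ↭-trans (pointwise (allFin _)) (SetoidPermP.map⁺ (≡.setoid (Vertex H)) setoid (λ { refl → DecSetoid.refl S }) (Perm.↭⇒↭ₛ perm))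
        where
        pointwise : ∀ ws → List.map f ws ↭ List.map g (List.map β ws)
        pointwise []       = ↭-refl
        pointwise (w ∷ ws) = prep (Pointwise.tabulate⁺ (sames w)) (pointwise ws)

  module _ (r : ℕ) (G H : ColoredGraph) where
    open DecSetoid (colorDecSetoid k r) renaming (trans to ≈-trans; sym to ≈-sym; refl to ≈-refl)

    abstract
      indistinguishable : (π : Vec (Vertex G) k → Vec (Vertex H) k) →
        List.map π (tuples k (order G)) Perm.↭ tuples k (order H) →
        (∀ u → SameColor r G H u (π u)) → ¬ DistinguishesAfter k r G H
      indistinguishable π perm same (q , differ) = differ (begin
        length (filter (λ u → χ k r G u ≟ q) us)
          ≡⟨ count us ⟩
        length (filter (λ v → χ k r H v ≟ q) (List.map π us))
          ≡⟨ Perm.↭-length (Perm.filter-↭ (λ v → χ k r H v ≟ q) perm) ⟩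
        length (filter (λ v → χ k r H v ≟ q) (tuples k (order H))) ∎)
        where
        open ≡-Reasoning
        us : List (Vec (Vertex G) k)
        us = tuples k (order G)
        count : ∀ us → length (filter (λ u → χ k r G u ≟ q) us) ≡
                       length (filter (λ v → χ k r H v ≟ q) (List.map π us))
        count [] = refl
        count (u ∷ us) with χ k r G u ≟ q | χ k r H (π u) ≟ q
        ... | yes _ | yes _ = cong suc (count us)
        ... | no  _ | no  _ = count us
        ... | yes p | no ¬p = ⊥-elim (¬p (≈-trans (≈-sym (same u)) p))
        ... | no ¬p | yes p = ⊥-elim (¬p (≈-trans (same u) p))

      distinguishable : (u : Vec (Vertex G) k) → (∀ v → ¬ SameColor r G H u v) → DistinguishesAfter k r G H
      distinguishable u differ = χ k r G u , λ eq →
        positive (filter _ (tuples k (order G)))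
          (∈-filter⁺ (λ u′ → χ k r G u′ ≟ χ k r G u) (tuples-complete k u) ≈-refl)
          (trans eq (cong length (List.filter-none (λ v → χ k r H v ≟ χ k r G u)
            {tuples k (order H)} (All.tabulate λ {v} _ s → differ v (≈-sym s)))))
        where
        positive : {x : Vec (Vertex G) k} (xs : List _) → x ∈ xs → length xs ≡ 0 → ⊥
        positive (_ ∷ _) _ ()

-- The counter

Close : ℕ → ℕ → Set
Close x y = x ≤ suc y × y ≤ suc x

close-refl : ∀ {x} → Close x x
close-refl = ℕ.n≤1+n _ , ℕ.n≤1+n _

close-sym : ∀ {x y} → Close x y → Close y x
close-sym (p , q) = q , p

-- A position q ≡ 0 or 2 (mod 4) of a digit is a gate, which it may only occupy while
-- the next faster digit is at its lower end 0 or its upper end t respectively.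
Gate : (t q x : ℕ) → Set
Gate t 0 x = x ≡ 0
Gate t 1 x = ⊤
Gate t 2 x = x ≡ t
Gate t 3 x = ⊤
Gate t (suc (suc (suc (suc q)))) x = Gate t q x

gate? : ∀ t q x → Dec (Gate t q x)
gate? t 0 x = x ℕ.≟ 0
gate? t 1 x = yes tt
gate? t 2 x = x ℕ.≟ t
gate? t 3 x = yes tt
gate? t (suc (suc (suc (suc q)))) x = gate? t q x

-- Serves to replace the next digit by the value of all faster digits: at the ends of its range that
-- digit determines the value, so a gate becomes a condition on a single number.
gate-map : ∀ {t x t′ x′} → (x ≡ 0 → x′ ≡ 0) → (x ≡ t → x′ ≡ t′) → ∀ q → Gate t q x → Gate t′ q x′
gate-map f g 0 = f
gate-map f g 1 = id
gate-map f g 2 = g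
gate-map f g 3 = id
gate-map f g (suc (suc (suc (suc q)))) = gate-map f g q

-- The value of a counter whose slowest digit is q and whose remaining digits, which
-- count up to w and back again between consecutive gates of q, have the value x.
boustrophedon : (w x q : ℕ) → ℕ
boustrophedon w x 0 = 0
boustrophedon w x 1 = x
boustrophedon w x 2 = w
boustrophedon w x 3 = w + (w ∸ x)
boustrophedon w x (suc (suc (suc (suc q)))) = w + (w + boustrophedon w x q)

-- Moving the slow digit adds nothing by itself: at a gate `x` is at an end of its range, where the
-- formulas on both sides of the gate agree. Hence `q` and `x` may move together at the cost of one
-- step, and closeness keeps `q` from jumping over a gate.
boustrophedon-close : ∀ {w x y} → x ≤ w → y ≤ w → Close x y → ∀ q r → Gate w q x → Gate w r y → Close q r →
  boustrophedon w x q ≤ suc (boustrophedon w y r)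
boustrophedon-close x≤w y≤w xy 0 _ _ _ _ = z≤n
boustrophedon-close x≤w y≤w xy 1 0 g h _ = ℕ.≤-trans (proj₁ xy) (s≤s (ℕ.≤-reflexive h))
boustrophedon-close x≤w y≤w xy 1 1 g h _ = proj₁ xy
boustrophedon-close x≤w y≤w xy 1 2 g h _ = ℕ.m≤n⇒m≤1+n x≤w
boustrophedon-close x≤w y≤w xy 1 (suc (suc (suc r))) g h (_ , s≤s (s≤s ()))
boustrophedon-close x≤w y≤w xy 2 0 g h (s≤s () , _)
boustrophedon-close x≤w y≤w xy 2 1 g h _ = ℕ.≤-trans (ℕ.≤-reflexive (sym g)) (proj₁ xy)
boustrophedon-close x≤w y≤w xy 2 2 g h _ = ℕ.n≤1+n _
boustrophedon-close x≤w y≤w xy 2 3 g h _ = ℕ.m≤n⇒m≤1+n (ℕ.m≤m+n _ _)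
boustrophedon-close x≤w y≤w xy 2 (suc (suc (suc (suc r)))) g h _ = ℕ.m≤n⇒m≤1+n (ℕ.m≤m+n _ _)
boustrophedon-close x≤w y≤w xy 3 0 g h (s≤s () , _)
boustrophedon-close x≤w y≤w xy 3 1 g h (s≤s (s≤s ()) , _)
boustrophedon-close {w} {x} {y} x≤w y≤w xy 3 2 g h _ = begin
  w + (w ∸ x) ≤⟨ ℕ.+-monoʳ-≤ w (ℕ.m≤n+o⇒m∸n≤o w x (ℕ.≤-trans (ℕ.≤-reflexive (sym h)) (ℕ.≤-trans (proj₂ xy) (ℕ.≤-reflexive (ℕ.+-comm 1 x))))) ⟩
  w + 1       ≡⟨ ℕ.+-comm w 1 ⟩
  suc w       ∎
  where open ℕ.≤-Reasoning
boustrophedon-close {w} {x} {y} x≤w y≤w xy 3 3 g h _ = begin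
  w + (w ∸ x)     ≤⟨ ℕ.+-monoʳ-≤ w (ℕ.m≤n+o⇒m∸n≤o w x (begin
      w                ≡⟨ ℕ.m+[n∸m]≡n y≤w ⟨
      y + (w ∸ y)      ≤⟨ ℕ.+-monoˡ-≤ (w ∸ y) (proj₂ xy) ⟩
      suc x + (w ∸ y)  ≡⟨ ℕ.+-suc x (w ∸ y) ⟨
      x + suc (w ∸ y)  ∎)) ⟩
  w + suc (w ∸ y) ≡⟨ ℕ.+-suc w (w ∸ y) ⟩
  suc (w + (w ∸ y)) ∎
  where open ℕ.≤-Reasoning
boustrophedon-close {w} {x} x≤w y≤w xy 3 (suc (suc (suc (suc r)))) g h _ = ℕ.m≤n⇒m≤1+n (begin
  w + (w ∸ x)  ≤⟨ ℕ.+-monoʳ-≤ w (ℕ.≤-trans (ℕ.m∸n≤m w x) (ℕ.m≤m+n w _)) ⟩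
  w + (w + _)  ∎)
  where open ℕ.≤-Reasoning
boustrophedon-close x≤w y≤w xy (suc (suc (suc (suc q)))) 0 g h (s≤s () , _)
boustrophedon-close x≤w y≤w xy (suc (suc (suc (suc q)))) 1 g h (s≤s (s≤s ()) , _)
boustrophedon-close x≤w y≤w xy (suc (suc (suc (suc q)))) 2 g h (s≤s (s≤s (s≤s ())) , _)
boustrophedon-close {w} {x} {y} x≤w y≤w xy (suc (suc (suc (suc zero)))) 3 g h _ = begin
  w + (w + 0)       ≡⟨ cong (w +_) (ℕ.+-identityʳ w) ⟩
  w + w             ≤⟨ ℕ.+-monoʳ-≤ w (ℕ.≤-trans (ℕ.≤-reflexive (sym (ℕ.m∸n+n≡m y≤w)))
      (ℕ.+-monoʳ-≤ (w ∸ y) (ℕ.≤-trans (proj₂ xy) (s≤s (ℕ.≤-reflexive g))))) ⟩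
  w + ((w ∸ y) + 1) ≡⟨ ℕ.+-assoc w (w ∸ y) 1 ⟨
  w + (w ∸ y) + 1   ≡⟨ ℕ.+-comm _ 1 ⟩
  suc (w + (w ∸ y)) ∎
  where open ℕ.≤-Reasoning
boustrophedon-close x≤w y≤w xy (suc (suc (suc (suc (suc q))))) 3 g h (s≤s (s≤s (s≤s (s≤s ()))) , _)
boustrophedon-close {w} {x} {y} x≤w y≤w xy (suc (suc (suc (suc q)))) (suc (suc (suc (suc r)))) g h (qr , rq) = begin
  w + (w + boustrophedon w x q)       ≤⟨ ℕ.+-monoʳ-≤ w (ℕ.+-monoʳ-≤ w (boustrophedon-close x≤w y≤w xy q r g h
                                            (s≤s⁻¹ (s≤s⁻¹ (s≤s⁻¹ (s≤s⁻¹ qr))) , s≤s⁻¹ (s≤s⁻¹ (s≤s⁻¹ (s≤s⁻¹ rq)))))) ⟩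
  w + (w + suc (boustrophedon w y r)) ≡⟨ cong (w +_) (ℕ.+-suc w _) ⟩
  w + suc (w + boustrophedon w y r)   ≡⟨ ℕ.+-suc w _ ⟩
  suc (w + (w + boustrophedon w y r)) ∎
  where open ℕ.≤-Reasoning

module Counter (μ : ℕ) where

  top : ℕ
  top = μ * 4 + 2

  gate-top : ∀ t → Gate t top t
  gate-top t = go μ
    where
    go : ∀ m → Gate t (m * 4 + 2) t
    go zero    = refl
    go (suc m) = go m

  maximum : ℕ → ℕ
  maximum zero    = top
  maximum (suc m) = boustrophedon (maximum m) 0 top

  boustrophedon-top : ∀ w x m → boustrophedon w x (m * 4 + 2) ≡ (2 * m + 1) * w
  boustrophedon-top w x zero    = sym (ℕ.+-identityʳ w)
  boustrophedon-top w x (suc m) = trans (cong (λ z → w + (w + z)) (boustrophedon-top w x m))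
    (solve 2 (λ w m → w :+ (w :+ (con 2 :* m :+ con 1) :* w) := (con 2 :* (con 1 :+ m) :+ con 1) :* w) refl w m)
    where open ℕ.+-*-Solver

  boustrophedon-≤ : ∀ {w x} → x ≤ w → ∀ q → q ≤ top → boustrophedon w x q ≤ boustrophedon w 0 top
  boustrophedon-≤ {w} {x} x≤w = go μ
    where
    go : ∀ m q → q ≤ m * 4 + 2 → boustrophedon w x q ≤ boustrophedon w 0 (m * 4 + 2)
    go m       0 _ = z≤n
    go zero    1 _ = x≤w
    go (suc m) 1 _ = ℕ.≤-trans x≤w (ℕ.m≤m+n _ _)
    go zero    2 _ = ℕ.≤-refl
    go (suc m) 2 _ = ℕ.m≤m+n _ _
    go zero    (suc (suc (suc q))) (s≤s (s≤s ()))
    go (suc m) 3 _ = ℕ.+-monoʳ-≤ w (ℕ.≤-trans (ℕ.m∸n≤m w x) (ℕ.m≤m+n w _))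
    go (suc m) (suc (suc (suc (suc q)))) (s≤s (s≤s (s≤s (s≤s p)))) = ℕ.+-monoʳ-≤ w (ℕ.+-monoʳ-≤ w (go m q p))

  -- The gates 0, 2, ..., `top` bound `2 * μ + 1` intervals, and each contributes one full sweep of
  -- the faster digits.
  maximum-power : ∀ m → maximum m ≡ 2 * (2 * μ + 1) ^ suc m
  maximum-power zero    = solve 1 (λ m → m :* con 4 :+ con 2 := con 2 :* ((con 2 :* m :+ con 1) :* con 1)) refl μ
    where open ℕ.+-*-Solver
  maximum-power (suc m) = begin
    boustrophedon (maximum m) 0 top          ≡⟨ boustrophedon-top (maximum m) 0 μ ⟩
    (2 * μ + 1) * maximum m                  ≡⟨ cong ((2 * μ + 1) *_) (maximum-power m) ⟩
    (2 * μ + 1) * (2 * (2 * μ + 1) ^ suc m)  ≡⟨ solve 2 (λ a b → a :* (con 2 :* b) := con 2 :* (a :* b)) refl (2 * μ + 1) ((2 * μ + 1) ^ suc m) ⟩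
    2 * (2 * μ + 1) ^ suc (suc m)            ∎
    where
    open ≡-Reasoning
    open ℕ.+-*-Solver

  -- Slowest digit first.
  value : ∀ {m} → Vec ℕ (suc m) → ℕ
  value (q ∷ [])     = q
  value {suc m} (q ∷ p ∷ ps) = boustrophedon (maximum m) (value (p ∷ ps)) q

  data Chain : ∀ {m} → Vec ℕ (suc m) → Set where
    [_] : ∀ {q} → q ≤ top → Chain (q ∷ [])
    _∷_ : ∀ {m q} {ps : Vec ℕ (suc m)} → q ≤ top × Gate top q (head ps) → Chain ps → Chain (q ∷ ps)

  chain : ∀ {m} (v : Vec ℕ (suc m)) → (∀ i → lookup v i ≤ top) →
          (∀ i → Gate top (lookup v (inject₁ i)) (lookup v (suc i))) → Chain v
  chain (q ∷ [])     bounds gates = [ bounds zero ]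
  chain (q ∷ p ∷ ps) bounds gates = (bounds zero , gates zero) ∷ chain (p ∷ ps) (bounds ∘ suc) (gates ∘ suc)

  chain-bound : ∀ {m} {v : Vec ℕ (suc m)} → Chain v → ∀ i → lookup v i ≤ top
  chain-bound [ q≤ ]        zero    = q≤
  chain-bound ((q≤ , _) ∷ _) zero    = q≤
  chain-bound (_ ∷ c)       (suc i) = chain-bound c i

  chain-gate : ∀ {m} {v : Vec ℕ (suc m)} → Chain v → ∀ i → Gate top (lookup v (inject₁ i)) (lookup v (suc i))
  chain-gate {v = q ∷ p ∷ ps} ((_ , g) ∷ c) zero    = g
  chain-gate {v = q ∷ p ∷ ps} (_ ∷ c)       (suc i) = chain-gate c i

  value-≤ : ∀ {m} {v : Vec ℕ (suc m)} → Chain v → value v ≤ maximum m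
  value-≤ [ q≤ ]                         = q≤
  value-≤ {v = q ∷ p ∷ ps} ((q≤ , _) ∷ c) = boustrophedon-≤ (value-≤ c) q q≤

  value-bottom : ∀ {m} (v : Vec ℕ (suc m)) → head v ≡ 0 → value v ≡ 0
  value-bottom (q ∷ [])     refl = refl
  value-bottom (q ∷ p ∷ ps) refl = refl

  value-top : ∀ {m} (v : Vec ℕ (suc m)) → head v ≡ top → value v ≡ maximum m
  value-top (q ∷ [])     refl = refl
  value-top {suc m} (q ∷ p ∷ ps) refl = trans (boustrophedon-top (maximum m) _ μ) (sym (boustrophedon-top (maximum m) 0 μ))

  value-close : ∀ {m} {v v′ : Vec ℕ (suc m)} → Chain v → Chain v′ →
                (∀ i → Close (lookup v i) (lookup v′ i)) → Close (value v) (value v′)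
  value-close [ _ ] [ _ ] close = close zero
  value-close {v = q ∷ p ∷ ps} {q′ ∷ p′ ∷ ps′} ((_ , g) ∷ c) ((_ , g′) ∷ c′) close =
    boustrophedon-close (value-≤ c) (value-≤ c′) xy q q′ G G′ (close zero) ,
    boustrophedon-close (value-≤ c′) (value-≤ c) (close-sym xy) q′ q G′ G (close-sym (close zero))
    where
    xy = value-close c c′ (close ∘ suc)
    G  = gate-map (value-bottom (p ∷ ps)) (value-top (p ∷ ps)) q g
    G′ = gate-map (value-bottom (p′ ∷ ps′)) (value-top (p′ ∷ ps′)) q′ g′

  -- While the counter advances, its digits move up as well as down. A tick is oriented by the
  -- growth of the digit, not by that of the value, so a run of the counter is a path in the
  -- equivalence closure.
  record Tick {m} (v v′ : Vec ℕ (suc m)) : Set where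
    constructor tick
    field
      digit     : Fin (suc m)
      increment : lookup v′ digit ≡ suc (lookup v digit)
      elsewhere : ∀ i → i ≢ digit → lookup v′ i ≡ lookup v i
      before    : Chain v
      after     : Chain v′

  tick-head : ∀ {m q} {ps : Vec ℕ m} → Chain (q ∷ ps) → Chain (suc q ∷ ps) → Tick (q ∷ ps) (suc q ∷ ps)
  tick-head c c′ = tick zero refl (λ { zero ne → ⊥-elim (ne refl) ; (suc i) _ → refl }) c c′

  tick-tail : ∀ {m q} {ps ps′ : Vec ℕ (suc m)} → q ≤ top → (∀ p → Gate top q p) → Tick ps ps′ → Tick (q ∷ ps) (q ∷ ps′)
  tick-tail q≤ g (tick j inc els b a) = tick (suc j) inc
    (λ { zero _ → refl ; (suc i) ne → els i (ne ∘ cong suc) }) ((q≤ , g _) ∷ b) ((q≤ , g _) ∷ a)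

  chain-bottom : ∀ m → Chain (replicate (suc m) 0)
  chain-bottom zero    = [ z≤n ]
  chain-bottom (suc m) = (z≤n , refl) ∷ chain-bottom m

  chain-top : ∀ m → Chain (replicate (suc m) top)
  chain-top zero    = [ ℕ.≤-refl ]
  chain-top (suc m) = (ℕ.≤-refl , gate-top top) ∷ chain-top m

  sweep : ∀ m → EqClosure Tick (replicate (suc m) 0) (replicate (suc m) top)
  sweep zero = go top ℕ.≤-refl
    where
    go : ∀ q → q ≤ top → EqClosure Tick (0 ∷ []) (q ∷ [])
    go zero    _  = ε
    go (suc q) q< = go q (ℕ.<⇒≤ q<) ◅◅ (fwd (tick-head [ ℕ.<⇒≤ q< ] [ q< ]) ◅ ε)
  sweep (suc m) = subst (λ q → EqClosure Tick (0 ∷ 0s) (q ∷ ⊤s)) (ℕ.+-comm 2 (μ * 4)) (half μ ℕ.≤-refl)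
    where
    0s = replicate (suc m) 0
    ⊤s = replicate (suc m) top

    periodic : ∀ {x} n r → Gate top r x → Gate top (r + n * 4) x
    periodic {x} zero    r g = subst (λ q → Gate top q x) (sym (ℕ.+-identityʳ r)) g
    periodic {x} (suc n) r g = subst (λ q → Gate top q x) (shift 4 r (n * 4)) (periodic n r g)
      where
      shift : ∀ a b c → a + (b + c) ≡ b + (a + c)
      shift a b c = trans (sym (ℕ.+-assoc a b c)) (trans (cong (_+ c) (ℕ.+-comm a b)) (ℕ.+-assoc b a c))

    bound : ∀ r {n} → n ≤ μ → r ≤ 2 → r + n * 4 ≤ top
    bound r {n} n≤μ r≤2 = ℕ.≤-trans (ℕ.+-mono-≤ r≤2 (ℕ.*-monoˡ-≤ 4 n≤μ)) (ℕ.≤-reflexive (ℕ.+-comm 2 (μ * 4)))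

    gated : ∀ q → q ≤ top → ∀ {ps : Vec ℕ (suc m)} → Chain ps → Gate top q (head ps) → Chain (q ∷ ps)
    gated q q≤ c g = (q≤ , g) ∷ c

    -- In each period of the slow digit the faster ones run up at `1 + n * 4` and return along the
    -- reversed path at `3 + n * 4`.
    full : ∀ n → n ≤ μ → EqClosure Tick (0 ∷ 0s) (n * 4 ∷ 0s)
    half : ∀ n → n ≤ μ → EqClosure Tick (0 ∷ 0s) (2 + n * 4 ∷ ⊤s)

    half n n≤μ = full n n≤μ
      ◅◅ fwd (tick-head (gated (n * 4) b₀ (chain-bottom m) (periodic n 0 refl))
                        (gated (1 + n * 4) b₁ (chain-bottom m) (periodic n 1 tt)))
      ◅ EqC.gmap (1 + n * 4 ∷_) (tick-tail b₁ (λ _ → periodic n 1 tt)) (sweep m)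
      ◅◅ fwd (tick-head (gated (1 + n * 4) b₁ (chain-top m) (periodic n 1 tt))
                        (gated (2 + n * 4) b₂ (chain-top m) (periodic n 2 refl)))
      ◅ ε
      where
      b₀ = bound 0 n≤μ z≤n
      b₁ = bound 1 n≤μ (s≤s z≤n)
      b₂ = bound 2 n≤μ (s≤s (s≤s z≤n))

    full zero    _   = ε
    full (suc n) n<μ = half n (ℕ.<⇒≤ n<μ)
      ◅◅ fwd (tick-head (gated (2 + n * 4) b₂ (chain-top m) (periodic n 2 refl))
                        (gated (3 + n * 4) b₃ (chain-top m) (periodic n 3 tt)))
      ◅ EqC.gmap (3 + n * 4 ∷_) (tick-tail b₃ (λ _ → periodic n 3 tt)) (EqC.symmetric Tick (sweep m))
      ◅◅ fwd (tick-head (gated (3 + n * 4) b₃ (chain-bottom m) (periodic n 3 tt))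
                        (gated (4 + n * 4) b₄ (chain-bottom m) (periodic (suc n) 0 refl)))
      ◅ ε
      where
      b₄ = bound 0 n<μ z≤n
      b₃ = ℕ.≤-trans (ℕ.n≤1+n _) b₄
      b₂ = ℕ.≤-trans (ℕ.n≤1+n _) b₃

-- Estimates for the logarithm and the square root

fraction : ℕ → ℕ → ℚ
fraction a d = ℤ.+ a ℚ./ suc d

fraction-≤ : ∀ a d b e → a * suc e ≤ b * suc d → fraction a d ℚ.≤ fraction b e
fraction-≤ a d b e h = ℚ.toℚᵘ-cancel-≤ (begin
  toℚᵘ (fraction a d)  ≃⟨ ℚ.toℚᵘ-fromℚᵘ (ℚᵘ.mkℚᵘ (ℤ.+ a) d) ⟩
  ℚᵘ.mkℚᵘ (ℤ.+ a) d         ≤⟨ ℚᵘ.*≤* (subst₂ ℤ._≤_ (ℤ.pos-* a (suc e)) (ℤ.pos-* b (suc d)) (ℤ.+≤+ h)) ⟩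
  ℚᵘ.mkℚᵘ (ℤ.+ b) e         ≃⟨ ℚ.toℚᵘ-fromℚᵘ (ℚᵘ.mkℚᵘ (ℤ.+ b) e) ⟨
  toℚᵘ (fraction b e)  ∎)
  where open ℚᵘ.≤-Reasoning

fraction-≤⁻¹ : ∀ a d b e → fraction a d ℚ.≤ fraction b e → a * suc e ≤ b * suc d
fraction-≤⁻¹ a d b e h = ℤ.drop‿+≤+ (subst₂ ℤ._≤_ (sym (ℤ.pos-* a (suc e))) (sym (ℤ.pos-* b (suc d)))
  (ℚᵘ.drop-*≤* (begin
    ℚᵘ.mkℚᵘ (ℤ.+ a) d         ≃⟨ ℚ.toℚᵘ-fromℚᵘ (ℚᵘ.mkℚᵘ (ℤ.+ a) d) ⟨
    toℚᵘ (fraction a d)  ≤⟨ ℚ.toℚᵘ-mono-≤ h ⟩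
    toℚᵘ (fraction b e)  ≃⟨ ℚ.toℚᵘ-fromℚᵘ (ℚᵘ.mkℚᵘ (ℤ.+ b) e) ⟩
    ℚᵘ.mkℚᵘ (ℤ.+ b) e         ∎)))
  where open ℚᵘ.≤-Reasoning

fraction-+ : ∀ a d b e → fraction a d ℚ.+ fraction b e ≡ fraction (a * suc e + b * suc d) (e + d * suc e)
fraction-+ a d b e = ℚ.toℚᵘ-injective (begin
  toℚᵘ (fraction a d ℚ.+ fraction b e)           ≈⟨ ℚ.toℚᵘ-homo-+ (fraction a d) (fraction b e) ⟩
  toℚᵘ (fraction a d) ℚᵘ.+ toℚᵘ (fraction b e)   ≈⟨ ℚᵘ.+-cong (ℚ.toℚᵘ-fromℚᵘ (ℚᵘ.mkℚᵘ (ℤ.+ a) d)) (ℚ.toℚᵘ-fromℚᵘ (ℚᵘ.mkℚᵘ (ℤ.+ b) e)) ⟩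
  ℚᵘ.mkℚᵘ (ℤ.+ a) d ℚᵘ.+ ℚᵘ.mkℚᵘ (ℤ.+ b) e                 ≡⟨ cong (λ z → ℚᵘ.mkℚᵘ z (e + d * suc e))
                                                      (trans (cong₂ ℤ._+_ (sym (ℤ.pos-* a (suc e))) (sym (ℤ.pos-* b (suc d))))
                                                             (sym (ℤ.pos-+ (a * suc e) (b * suc d)))) ⟩
  ℚᵘ.mkℚᵘ (ℤ.+ (a * suc e + b * suc d)) (e + d * suc e)  ≈⟨ ℚ.toℚᵘ-fromℚᵘ (ℚᵘ.mkℚᵘ (ℤ.+ (a * suc e + b * suc d)) (e + d * suc e)) ⟨
  toℚᵘ (fraction (a * suc e + b * suc d) (e + d * suc e)) ∎)
  where open ℚᵘ.≃-Reasoning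

fraction-* : ∀ a d b e → fraction a d ℚ.* fraction b e ≡ fraction (a * b) (e + d * suc e)
fraction-* a d b e = ℚ.toℚᵘ-injective (begin
  toℚᵘ (fraction a d ℚ.* fraction b e)           ≈⟨ ℚ.toℚᵘ-homo-* (fraction a d) (fraction b e) ⟩
  toℚᵘ (fraction a d) ℚᵘ.* toℚᵘ (fraction b e)   ≈⟨ ℚᵘ.*-cong (ℚ.toℚᵘ-fromℚᵘ (ℚᵘ.mkℚᵘ (ℤ.+ a) d)) (ℚ.toℚᵘ-fromℚᵘ (ℚᵘ.mkℚᵘ (ℤ.+ b) e)) ⟩
  ℚᵘ.mkℚᵘ (ℤ.+ a) d ℚᵘ.* ℚᵘ.mkℚᵘ (ℤ.+ b) e                 ≡⟨ cong (λ z → ℚᵘ.mkℚᵘ z (e + d * suc e)) (sym (ℤ.pos-* a b)) ⟩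
  ℚᵘ.mkℚᵘ (ℤ.+ (a * b)) (e + d * suc e)               ≈⟨ ℚ.toℚᵘ-fromℚᵘ (ℚᵘ.mkℚᵘ (ℤ.+ (a * b)) (e + d * suc e)) ⟨
  toℚᵘ (fraction (a * b) (e + d * suc e))        ∎)
  where open ℚᵘ.≃-Reasoning

0≤fraction : ∀ a d → 0ℚ ℚ.≤ fraction a d
0≤fraction a d = fraction-≤ 0 0 a d z≤n

fraction-*-mono : ∀ a d b e {p q} → fraction a d ℚ.≤ p → fraction b e ℚ.≤ q →
                  fraction (a * b) (e + d * suc e) ℚ.≤ p ℚ.* q
fraction-*-mono a d b e {p} {q} x≤p y≤q = begin
  fraction (a * b) (e + d * suc e)  ≡⟨ fraction-* a d b e ⟨
  fraction a d ℚ.* fraction b e     ≤⟨ ℚ.*-monoʳ-≤-nonNeg (fraction b e) {{ℚ.nonNegative (0≤fraction b e)}} x≤p ⟩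
  p ℚ.* fraction b e                ≤⟨ ℚ.*-monoˡ-≤-nonNeg p {{ℚ.nonNegative (ℚ.≤-trans (0≤fraction a d) x≤p)}} y≤q ⟩
  p ℚ.* q                           ∎
  where open ℚ.≤-Reasoning

-- Each of the `m` terms has a denominator of at most `2 * suc a`; `fraction` adds 1 to its second
-- argument, whence `a + suc a`.
harmonic-lower : ∀ a m → m ≤ suc a → fraction m (a + suc a) ℚ.≤ harmonic (suc a) m
harmonic-lower a zero    _    = fraction-≤ 0 (a + suc a) 0 0 z≤n
harmonic-lower a (suc m) m<1+a = begin
  fraction (suc m) D                                         ≤⟨ fraction-≤ (suc m) D (m * suc s + 1 * suc D) (s + D * suc s) step ⟩
  fraction (m * suc s + 1 * suc D) (s + D * suc s)           ≡⟨ fraction-+ m D 1 s ⟨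
  fraction m D ℚ.+ fraction 1 s                              ≤⟨ ℚ.+-monoˡ-≤ (fraction 1 s) (harmonic-lower a m (ℕ.<⇒≤ m<1+a)) ⟩
  harmonic (suc a) m ℚ.+ fraction 1 s                        ∎
  where
  open ℚ.≤-Reasoning
  D = a + suc a
  s = suc a + m
  step : suc m * (suc D * suc s) ≤ (m * suc s + 1 * suc D) * suc D
  step = ℕ.≤-trans (ℕ.≤-reflexive (solve 3 (λ m d s → (con 1 :+ m) :* (d :* s) := (s :+ m :* s) :* d) refl m (suc D) (suc s)))
    (ℕ.*-monoˡ-≤ (suc D) (ℕ.≤-trans (ℕ.+-monoˡ-≤ (m * suc s) bound)
      (ℕ.≤-reflexive (solve 2 (λ x y → x :+ y := y :+ con 1 :* x) refl (suc D) (m * suc s)))))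
    where
    open ℕ.+-*-Solver
    bound : suc s ≤ suc D
    bound = s≤s (ℕ.≤-trans (ℕ.≤-reflexive (sym (ℕ.+-suc a m))) (ℕ.+-monoʳ-≤ a m<1+a))

harmonic-mono : ∀ a m t → harmonic a m ℚ.≤ harmonic a (t + m)
harmonic-mono a m zero    = ℚ.≤-refl
harmonic-mono a m (suc t) = begin
  harmonic a m                                  ≤⟨ harmonic-mono a m t ⟩
  harmonic a (t + m)                            ≡⟨ ℚ.+-identityʳ _ ⟨
  harmonic a (t + m) ℚ.+ 0ℚ                     ≤⟨ ℚ.+-monoʳ-≤ (harmonic a (t + m)) (0≤fraction 1 (a + (t + m))) ⟩
  harmonic a (t + m) ℚ.+ fraction 1 (a + (t + m)) ∎
  where open ℚ.≤-Reasoning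

-- The part of the Riemann sum over the interval from 1 to 2 consists of the first `2 ^ j` terms,
-- and each is at least half the mesh.
half≤logSeq : ∀ k j → fraction 1 1 ℚ.≤ logSeq (2 + k) j
half≤logSeq k j with 2 ^ j | ℕ.m^n>0 2 j
... | suc a | _ = begin
  fraction 1 1                    ≤⟨ fraction-≤ 1 1 (suc a) (a + suc a)
      (ℕ.≤-reflexive (solve 1 (λ a → con 1 :* ((con 1 :+ a) :+ (con 1 :+ a)) := (con 1 :+ a) :* con 2) refl a)) ⟩
  fraction (suc a) (a + suc a)    ≤⟨ harmonic-lower a (suc a) ℕ.≤-refl ⟩
  harmonic (suc a) (suc a)        ≤⟨ harmonic-mono (suc a) (suc a) (k * suc a) ⟩
  harmonic (suc a) (k * suc a + suc a) ≡⟨ cong (harmonic (suc a)) (ℕ.+-comm (k * suc a) (suc a)) ⟩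
  harmonic (suc a) (suc k * suc a) ∎
  where
  open ℚ.≤-Reasoning
  open ℕ.+-*-Solver

-- As the logarithm is at least 1/2, the hypothesis at precision 1 yields `300 * k * k <= n + 1`,
-- whereas `n < k * k` would bound `n + 1` by `k * k`.
square-below : ∀ k n → 2 ≤ k → fromℕ 1200 *ᴿ (fromℕ k *ᴿ log k) ² ≤ᴿ fromℕ n → k * k ≤ n
square-below (suc (suc k′)) n (s≤s (s≤s _)) hyp with hyp 1ℚ (ℚ.positive⁻¹ 1ℚ)
... | N , h = ℕ.≮⇒≥ λ n<k² → ℕ.<⇒≱ (strict n<k²) bound
  where
  k = suc (suc k′)
  k/2≤ : fraction (k * 1) 1 ℚ.≤ fraction k 0 ℚ.* logSeq k N
  k/2≤ = fraction-*-mono k 0 1 1 ℚ.≤-refl (half≤logSeq k′ N)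
  lower : fraction (1200 * ((k * 1) * (k * 1))) 3 ℚ.≤ _
  lower = fraction-*-mono 1200 0 ((k * 1) * (k * 1)) 3 ℚ.≤-refl (fraction-*-mono (k * 1) 1 (k * 1) 1 k/2≤ k/2≤)
  bound : 1200 * ((k * 1) * (k * 1)) * 1 ≤ (n * 1 + 1 * 1) * 4
  bound = fraction-≤⁻¹ (1200 * ((k * 1) * (k * 1))) 3 (n * 1 + 1 * 1) 0
      (ℚ.≤-trans lower (ℚ.≤-trans (h N ℕ.≤-refl) (ℚ.≤-reflexive (fraction-+ n 0 1 0))))

  strict : n < k * k → (n * 1 + 1 * 1) * 4 < 1200 * ((k * 1) * (k * 1)) * 1
  strict n<k² = begin-strict
    (n * 1 + 1 * 1) * 4                ≡⟨ solve 1 (λ n → (n :* con 1 :+ con 1 :* con 1) :* con 4 := con 4 :* (con 1 :+ n)) refl n ⟩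
    4 * suc n                          ≤⟨ ℕ.*-monoʳ-≤ 4 n<k² ⟩
    4 * (k * k)                        <⟨ ℕ.*-monoˡ-< (k * k) (ℕ.m≤m+n 5 1195) ⟩
    1200 * (k * k)                     ≡⟨ solve 1 (λ k → con 1200 :* (k :* k) := con 1200 :* ((k :* con 1) :* (k :* con 1)) :* con 1) refl k ⟩
    1200 * ((k * 1) * (k * 1)) * 1     ∎
    where
    open ℕ.≤-Reasoning
    open ℕ.+-*-Solver

square-mono-< : ∀ {a b} → a < b → a * a < b * b
square-mono-< a<b = ℕ.*-mono-< a<b a<b

isqrt-square-≤ : ∀ n → isqrt n * isqrt n ≤ n
isqrt-square-≤ zero = z≤n
isqrt-square-≤ (suc n) with suc (isqrt n) * suc (isqrt n) ℕ.≤? suc n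
... | yes p = p
... | no  _ = ℕ.m≤n⇒m≤1+n (isqrt-square-≤ n)

isqrt-square-> : ∀ n → n < suc (isqrt n) * suc (isqrt n)
isqrt-square-> zero = s≤s z≤n
isqrt-square-> (suc n) with suc (isqrt n) * suc (isqrt n) ℕ.≤? suc n
... | yes _ = ℕ.≤-<-trans (isqrt-square-> n) (square-mono-< (ℕ.n<1+n (suc (isqrt n))))
... | no  p = ℕ.≰⇒> p

square-cancel-< : ∀ a b → a * a < b * b → a < b
square-cancel-< a b h = ℕ.≰⇒> λ b≤a → ℕ.<⇒≱ h (ℕ.*-mono-≤ b≤a b≤a)

square-^ : ∀ a k → (a * a) ^ k ≡ a ^ k * a ^ k
square-^ a zero    = refl
square-^ a (suc k) = trans (cong (a * a *_) (square-^ a k))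
  (solve 2 (λ a p → a :* a :* (p :* p) := (a :* p) :* (a :* p)) refl a (a ^ k))
  where open ℕ.+-*-Solver

-- The positive gap `η` separates `r` from the root already when truncated to a multiple of 2⁻ᴺ.
-- This is an inequality of integers, which can be squared.
below-√ : ∀ r m → fromℕ r <ᴿ √ m → r * r < m
below-√ r m (η , 0<η , N , h) = ℕ.*-cancelʳ-< (p * p) (r * r) m (begin-strict
  r * r * (p * p)  ≡⟨ solve 2 (λ r p → r :* r :* (p :* p) := (r :* p) :* (r :* p)) refl r p ⟩
  (r * p) * (r * p) <⟨ square-mono-< rp<s ⟩
  s * s            ≤⟨ isqrt-square-≤ (m * 4 ^ N) ⟩
  m * 4 ^ N        ≡⟨ cong (m *_) (four N) ⟩
  m * (p * p)      ∎)
  where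
  open ℕ.≤-Reasoning
  open ℕ.+-*-Solver
  p = 2 ^ N
  s = isqrt (m * 4 ^ N)
  four : ∀ N → 4 ^ N ≡ 2 ^ N * 2 ^ N
  four zero    = refl
  four (suc N) = trans (cong (4 *_) (four N)) (solve 1 (λ p → con 4 :* (p :* p) := (con 2 :* p) :* (con 2 :* p)) refl (2 ^ N))
  quotient-≤ : ∀ a d b .{{_ : NonZero d}} → a ≤ b * d → ℤ.+ a ℚ./ d ℚ.≤ fraction b 0
  quotient-≤ a (suc d) b h = fraction-≤ a d b 0 (ℕ.≤-trans (ℕ.≤-reflexive (ℕ.*-identityʳ a)) h)
  rp<s : r * p < s
  rp<s = ℕ.≰⇒> λ s≤rp → ℚ.<-irrefl refl (ℚ.<-≤-trans
    (ℚ.≤-<-trans (ℚ.≤-reflexive (sym (ℚ.+-identityʳ (fraction r 0)))) (ℚ.+-monoʳ-< (fraction r 0) 0<η))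
    (ℚ.≤-trans (h N ℕ.≤-refl) (quotient-≤ s p r {{ℕ.m^n≢0 2 N}} s≤rp)))

fromℕ-≤ : ∀ a b c → a ≤ b * c → fromℕ a ≤ᴿ fromℕ b *ᴿ fromℕ c
fromℕ-≤ a b c a≤bc η 0<η = 0 , λ _ _ → begin
  fraction a 0                          ≤⟨ fraction-≤ a 0 (b * c) 0 (ℕ.*-monoˡ-≤ 1 a≤bc) ⟩
  fraction (b * c) 0                    ≡⟨ fraction-* b 0 c 0 ⟨
  fraction b 0 ℚ.* fraction c 0         ≡⟨ ℚ.+-identityʳ (fraction b 0 ℚ.* fraction c 0) ⟨
  fraction b 0 ℚ.* fraction c 0 ℚ.+ 0ℚ  ≤⟨ ℚ.+-monoʳ-≤ (fraction b 0 ℚ.* fraction c 0) (ℚ.<⇒≤ 0<η) ⟩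
  fraction b 0 ℚ.* fraction c 0 ℚ.+ η   ∎
  where open ℚ.≤-Reasoning

-- The graphs

anyBool? : {P : Bool → Set} → (∀ d → Dec (P d)) → Dec (∃ P)
anyBool? {P} P? = map′ (λ { (inj₁ p) → false , p ; (inj₂ p) → true , p })
  (λ { (false , p) → inj₁ p ; (true , p) → inj₂ p }) (P? false ⊎-dec P? true)

allBool? : {P : Bool → Set} → (∀ d → Dec (P d)) → Dec (∀ d → P d)
allBool? {P} P? = map′ (λ { (p , _) false → p ; (_ , q) true → q })
  (λ f → f false , f true) (P? false ×-dec P? true)

close? : ∀ x y → Dec (Close x y)
close? x y = (x ℕ.≤? suc y) ×-dec (y ℕ.≤? suc x)

prev : ∀ {m} → Fin (suc m) → Fin (suc m)
prev zero    = Fin.fromℕ _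
prev (suc i) = inject₁ i

prev-injective : ∀ {m} {i j : Fin (suc m)} → prev i ≡ prev j → i ≡ j
prev-injective {i = zero}  {zero}  _ = refl
prev-injective {i = zero}  {suc j} e = ⊥-elim (Fin.fromℕ≢inject₁ e)
prev-injective {i = suc i} {zero}  e = ⊥-elim (Fin.fromℕ≢inject₁ (sym e))
prev-injective {i = suc i} {suc j} e = cong suc (Fin.inject₁-injective e)

isZero : ∀ {m} → Fin m → Bool
isZero zero    = true
isZero (suc _) = false

module Construction (k′ μ : ℕ) where
  open Counter μ public

  k E N : ℕ
  k = suc (suc k′)
  E = suc (suc k)
  N = E + (top + E)

  -- Clamping extends gates and counter values to the end parts of the paths, where a digit rests at
  -- 0 or at `top`.
  digit : ℕ → ℕ
  digit p = (p ∸ E) ⊓ top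

  Middle : ℕ → Set
  Middle p = E ≤ p × p ≤ E + top

  Gated : Fin k → ℕ → ℕ → Set
  Gated zero    p q = ⊤
  Gated (suc _) p q = Gate top (digit p) (digit q)

  -- Row r sees the position p of cell prev r and the position q of cell r; cell 0 holds
  -- the slowest digit of the counter, and row 0 closes the ring without constraining it.
  Admissible : Fin k → ℕ → ℕ → Set
  Admissible r p q = Gated r p q × (Middle p × Middle q ⊎ Close p q)

  gated? : ∀ r p q → Dec (Gated r p q)
  gated? zero    p q = yes tt
  gated? (suc _) p q = gate? top (digit p) (digit q)

  admissible? : ∀ r p q → Dec (Admissible r p q)
  admissible? r p q = gated? r p q ×-dec ((middle? p ×-dec middle? q) ⊎-dec close? p q)
    where
    middle? : ∀ p → Dec (Middle p)
    middle? p = (E ℕ.≤? p) ×-dec (p ℕ.≤? E + top)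

  digit-high : ∀ {p} → E + top ≤ p → digit p ≡ top
  digit-high {p} h = ℕ.m≥n⇒m⊓n≡n (ℕ.≤-trans (ℕ.≤-reflexive (sym (ℕ.m+n∸m≡n E top))) (ℕ.∸-monoˡ-≤ E h))

  digit-low : ∀ {p} → p ≤ E → digit p ≡ 0
  digit-low {p} h = cong (_⊓ top) (ℕ.m≤n⇒m∸n≡0 h)

  digit-middle : ∀ {q} → q ≤ top → digit (E + q) ≡ q
  digit-middle {q} h = trans (cong (_⊓ top) (ℕ.m+n∸m≡n E q)) (ℕ.m≤n⇒m⊓n≡m h)

  gated-high : ∀ r {p q} → E + top ≤ p → E + top ≤ q → Gated r p q
  gated-high zero    _ _ = tt
  gated-high (suc _) h h′ = subst₂ (Gate top) (sym (digit-high h)) (sym (digit-high h′)) (gate-top top)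

  gated-low : ∀ r {p q} → p ≤ E → q ≤ E → Gated r p q
  gated-low zero    _ _ = tt
  gated-low (suc _) h h′ = subst₂ (Gate top) (sym (digit-low h)) (sym (digit-low h′)) refl

  -- Kind 0 stands for the state (a , b) of a row, kinds 1 and 2 for the transitions
  -- from (a , b) to (a + 1 , b) and to (a , b + 1).
  Node : Set
  Node = Fin k × Fin (suc N) × Fin (suc N) × Fin 3

  row : Node → Fin k
  row (r , _) = r

  kind : Node → Fin 3
  kind (_ , _ , _ , κ) = κ

  -- The Boolean selects an end: `false` the source and `true` the target of a transition. The two
  -- ends of a state coincide.
  first second : Bool → Node → ℕ
  first true  (_ , a , b , 1F) = suc (toℕ a)
  first _     (_ , a , b , _)  = toℕ a
  second true (_ , a , b , 2F) = suc (toℕ b)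
  second _    (_ , a , b , _)  = toℕ b

  Valid : Node → Set
  Valid n = ∀ d → Admissible (row n) (first d n) (second d n)

  abstract
    valid? : ∀ n → Dec (Valid n)
    valid? n = allBool? λ d → admissible? (row n) (first d n) (second d n)

  -- The two bits are the values at the source and at the target of a transition.
  CFIVertex : Set
  CFIVertex = Node × Bool × Bool

  node : CFIVertex → Node
  node = proj₁

  bit : Bool → CFIVertex → Bool
  bit false (_ , x , _) = x
  bit true  (_ , _ , y) = y

  record Incident (v w : CFIVertex) : Set where
    constructor incident
    field
      v-state      : kind (node v) ≡ 0F
      w-transition : kind (node w) ≢ 0F
      same-row     : row (node v) ≡ row (node w)
      w-valid      : Valid (node w)
      end          : ∃ λ d → first d (node w) ≡ first false (node v)
                           × second d (node w) ≡ second false (node v) × bit d w ≡ bit false v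

  -- The moving cell is the second one of the row of `v` and the first one of the row of `w`. Only
  -- the flips of the two rows are compared, so single values may change while the sum over all rows
  -- does not.
  record Synchronous (v w : CFIVertex) : Set where
    constructor synchronous
    field
      v-second  : kind (node v) ≡ 2F
      w-first   : kind (node w) ≡ 1F
      neighbour : prev (row (node w)) ≡ row (node v)
      same-move : second false (node v) ≡ first false (node w)
      v-valid   : Valid (node v)
      w-valid   : Valid (node w)
      same-flip : bit false v xor bit true v ≡ bit false w xor bit true w

  Linked : CFIVertex → CFIVertex → Set
  Linked v w = Incident v w ⊎ Synchronous v w

  Adjacent : CFIVertex → CFIVertex → Set
  Adjacent v w = Linked v w ⊎ Linked w v

  abstract
    incident? : ∀ v w → Dec (Incident v w)
    incident? v w = map′ (λ (a , b , c , d , e) → incident a b c d e) (λ (incident a b c d e) → a , b , c , d , e)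
      ((kind (node v) Fin.≟ 0F) ×-dec ¬? (kind (node w) Fin.≟ 0F) ×-dec (row (node v) Fin.≟ row (node w)) ×-dec valid? (node w)
        ×-dec anyBool? λ d → (first d (node w) ℕ.≟ first false (node v))
                ×-dec (second d (node w) ℕ.≟ second false (node v)) ×-dec (bit d w Bool.≟ bit false v))

    synchronous? : ∀ v w → Dec (Synchronous v w)
    synchronous? v w = map′ (λ (a , b , c , d , e , f , g) → synchronous a b c d e f g)
      (λ (synchronous a b c d e f g) → a , b , c , d , e , f , g)
      ((kind (node v) Fin.≟ 2F) ×-dec (kind (node w) Fin.≟ 1F) ×-dec (prev (row (node w)) Fin.≟ row (node v))
        ×-dec (second false (node v) ℕ.≟ first false (node w)) ×-dec valid? (node v) ×-dec valid? (node w)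
        ×-dec ((bit false v xor bit true v) Bool.≟ (bit false w xor bit true w)))

  linked? : ∀ v w → Dec (Linked v w)
  linked? v w = incident? v w ⊎-dec synchronous? v w

  adjacent? : ∀ v w → Dec (Adjacent v w)
  adjacent? v w = linked? v w ⊎-dec linked? w v

  ¬linked-self : ∀ v → ¬ Linked v v
  ¬linked-self v (inj₁ i) = Incident.w-transition i (Incident.v-state i)
  ¬linked-self v (inj₂ s) with trans (sym (Synchronous.v-second s)) (Synchronous.w-first s)
  ... | ()

  Corner : ℕ → Node → Set
  Corner p n = kind n ≡ 0F × first false n ≡ p × second false n ≡ p

  corner? : ∀ p n → Dec (Corner p n)
  corner? p n = (kind n Fin.≟ 0F) ×-dec (first false n ℕ.≟ p) ×-dec (second false n ℕ.≟ p)

  -- At the two corners the flag shows the value of the state, except that in the twisted graph row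
  -- 0 shows its complement at `N`. Elsewhere the flag is constant.
  flag : Bool → CFIVertex → Bool
  flag twist v = (does (corner? 0 (node v)) ∧ bit false v)
               ∨ (does (corner? N (node v)) ∧ (bit false v xor (twist ∧ isZero (row (node v)))))

  size : ℕ
  size = (k * (suc N * (suc N * 3))) * (2 * 2)

  abstract
    code : CFIVertex ↔ Fin size
    code = ↔-trans ((↔-trans (↔-refl ×-↔ ↔-trans (↔-refl ×-↔ ↔-sym Fin.*↔×) (↔-sym Fin.*↔×)) (↔-sym Fin.*↔×))
                      ×-↔ ↔-trans (↔-sym Fin.2↔Bool ×-↔ ↔-sym Fin.2↔Bool) (↔-sym Fin.*↔×))
                   (↔-sym Fin.*↔×)

  open Inverse code public using () renaming (to to encode; from to decode; strictlyInverseˡ to encode-decode; strictlyInverseʳ to decode-encode)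

  encode-injective : ∀ {v w} → encode v ≡ encode w → v ≡ w
  encode-injective {v} {w} e = trans (sym (decode-encode v)) (trans (cong decode e) (decode-encode w))

  nodeOf : Fin size → Node
  nodeOf v = node (decode v)

  graph : Bool → ColoredGraph
  graph twist = record
    { order     = size
    ; adjacent  = λ v w → does (adjacent? (decode v) (decode w))
    ; symmetric = λ v w → does-⇔ (mk⇔ swap swap) (adjacent? (decode v) (decode w)) (adjacent? (decode w) (decode v))
    ; loopless  = λ v → dec-false (adjacent? (decode v) (decode v)) λ { (inj₁ l) → ¬linked-self (decode v) l ; (inj₂ l) → ¬linked-self (decode v) l }
    -- The code of a vertex with this node and with the flag as its bit numbers the pairs of a node
    -- and a flag injectively.
    ; color     = λ v → toℕ (encode (node (decode v) , flag twist (decode v) , false))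
    }

  above : ℕ → ℕ → Bool
  above θ p = θ <ᵇ p

  -- Adding potential u θ r p q to the value at every state (p , q) of every row r preserves
  -- all links, except that row 0 is twisted between the positions θ and θ + 1.
  potential : (Fin k → ℕ → Bool) → ℕ → Fin k → ℕ → ℕ → Bool
  potential u θ r p q = (u (prev r) p xor u r q) xor (isZero r ∧ above θ p)

  -- Invalid nodes are isolated and may see positions far apart. Leaving their bits alone keeps them
  -- from restricting where the twist can go.
  shift : (Fin k → ℕ → Bool) → ℕ → Node → Bool → Bool
  shift u θ n d = does (valid? n) ∧ potential u θ (row n) (first d n) (second d n)

  shift-valid : ∀ u θ n d → Valid n → shift u θ n d ≡ potential u θ (row n) (first d n) (second d n)
  shift-valid u θ n d val = cong (_∧ potential u θ (row n) (first d n) (second d n)) (dec-true (valid? n) val)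

  shift-invalid : ∀ u θ n d → ¬ Valid n → shift u θ n d ≡ false
  shift-invalid u θ n d ¬val = cong (_∧ potential u θ (row n) (first d n) (second d n)) (dec-false (valid? n) ¬val)

  translate : (Fin k → ℕ → Bool) → ℕ → CFIVertex → CFIVertex
  translate u θ v@(n , x , y) = n , x xor shift u θ n false , y xor shift u θ n true

  translate-bit : ∀ u θ d v → bit d (translate u θ v) ≡ bit d v xor shift u θ (node v) d
  translate-bit u θ false v = refl
  translate-bit u θ true  v = refl

  translate-involutive : ∀ u θ v → translate u θ (translate u θ v) ≡ v
  translate-involutive u θ (n , x , y) = cong₂ (λ x y → n , x , y) (twice x (shift u θ n false)) (twice y (shift u θ n true))
    where
    twice : ∀ x s → (x xor s) xor s ≡ x
    twice x s = trans (Bool.xor-assoc x s s) (trans (cong (x xor_) (Bool.xor-same s)) (Bool.xor-identityʳ x))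

  -- The first positions decide whether the links of row 0 survive the twist. With the second ones
  -- included, a band between two uncut gaps contains all positions seen by a node or none.
  Uncut : ℕ → Node → Set
  Uncut θ n = Valid n → ∀ d → above θ (first d n) ≡ above θ (first false n) × above θ (second d n) ≡ above θ (first false n)

  state-valid : ∀ {v w} → Incident v w → Valid (node v)
  state-valid {(r , a , b , 0F) , _} (incident refl _ refl val (d , e , e′ , _)) false = subst₂ (Admissible r) e e′ (val d)
  state-valid {(r , a , b , 0F) , _} (incident refl _ refl val (d , e , e′ , _)) true  = subst₂ (Admissible r) e e′ (val d)

  translate-incident : ∀ u θ {v w} → Incident v w → Incident (translate u θ v) (translate u θ w)
  translate-incident u θ {v} {w} i@(incident s t refl val (d , e , e′ , same)) = incident s t refl val (d , e , e′ , (begin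
    bit d (translate u θ w)                  ≡⟨ translate-bit u θ d w ⟩
    bit d w xor shift u θ (node w) d         ≡⟨ cong₂ _xor_ same (begin
      shift u θ (node w) d                     ≡⟨ shift-valid u θ (node w) d val ⟩
      potential u θ (row (node w)) (first d (node w)) (second d (node w)) ≡⟨ cong₂ (potential u θ (row (node w))) e e′ ⟩
      potential u θ (row (node v)) (first false (node v)) (second false (node v)) ≡⟨ shift-valid u θ (node v) false (state-valid i) ⟨
      shift u θ (node v) false                 ∎) ⟩
    bit false v xor shift u θ (node v) false ∎))
    where open ≡-Reasoning

  -- In each flip the potential of the resting cell cancels, and that of the moving cell occurs in
  -- both flips. The twist depends on the first position, which rests in the transition `v`; in `w`
  -- it moves, but not across the gap `θ`.
  translate-synchronous : ∀ u θ {v w} → Uncut θ (node w) → Synchronous v w → Synchronous (translate u θ v) (translate u θ w)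
  translate-synchronous u θ {v@((r , a , b , 2F) , x , y)} {w@((r′ , a′ , b′ , 1F) , x′ , y′)} uncut (synchronous refl refl refl move val val′ same) =
    synchronous refl refl refl move val val′ (begin
      (x xor shift u θ (node v) false) xor (y xor shift u θ (node v) true)
        ≡⟨ cong₂ (λ s t → (x xor s) xor (y xor t)) (shift-valid u θ (node v) false val) (shift-valid u θ (node v) true val) ⟩
      (x xor ((p xor q) xor z)) xor (y xor ((p xor q′) xor z))
        ≡⟨ solve 6 (λ x y p q q′ z → (x :+ ((p :+ q) :+ z)) :+ (y :+ ((p :+ q′) :+ z)) := (x :+ y) :+ (q :+ q′)) refl x y p q q′ z ⟩
      (x xor y) xor (q xor q′)
        ≡⟨ cong₂ _xor_ same (cong (λ c → u r c xor u r (suc c)) move) ⟩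
      (x′ xor y′) xor (u r (toℕ a′) xor u r (suc (toℕ a′)))
        ≡⟨ solve 6 (λ x y p q q′ z → (x :+ y) :+ (q :+ q′) := (x :+ ((q :+ p) :+ z)) :+ (y :+ ((q′ :+ p) :+ z))) refl x′ y′ (u r′ (toℕ b′))
            (u r (toℕ a′)) (u r (suc (toℕ a′))) z′ ⟩
      (x′ xor ((u r (toℕ a′) xor u r′ (toℕ b′)) xor z′)) xor (y′ xor ((u r (suc (toℕ a′)) xor u r′ (toℕ b′)) xor z′))
        ≡⟨ cong (λ z → (x′ xor ((u r (toℕ a′) xor u r′ (toℕ b′)) xor z′)) xor
            (y′ xor ((u r (suc (toℕ a′)) xor u r′ (toℕ b′)) xor (isZero r′ ∧ z)))) (sym (proj₁ (uncut val′ true))) ⟩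
      (x′ xor potential u θ r′ (toℕ a′) (toℕ b′)) xor (y′ xor potential u θ r′ (suc (toℕ a′)) (toℕ b′))
        ≡⟨ cong₂ (λ s t → (x′ xor s) xor (y′ xor t)) (shift-valid u θ (node w) false val′) (shift-valid u θ (node w) true val′) ⟨
      (x′ xor shift u θ (node w) false) xor (y′ xor shift u θ (node w) true) ∎)
    where
    open ≡-Reasoning
    open xor-∧-Solver
    p = u (prev r) (toℕ a)
    q = u r (toℕ b)
    q′ = u r (suc (toℕ b))
    z = isZero r ∧ above θ (toℕ a)
    z′ = isZero r′ ∧ above θ (toℕ a′)

  translate-adjacent : ∀ u θ {v w} → Uncut θ (node v) → Uncut θ (node w) → Adjacent v w → Adjacent (translate u θ v) (translate u θ w)
  translate-adjacent u θ _  _  (inj₁ (inj₁ i)) = inj₁ (inj₁ (translate-incident u θ i))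
  translate-adjacent u θ _  cw (inj₁ (inj₂ s)) = inj₁ (inj₂ (translate-synchronous u θ cw s))
  translate-adjacent u θ _  _  (inj₂ (inj₁ i)) = inj₂ (inj₁ (translate-incident u θ i))
  translate-adjacent u θ cv _  (inj₂ (inj₂ s)) = inj₂ (inj₂ (translate-synchronous u θ cv s))

-- Duplicator

prev-surjective : ∀ {m} (c : Fin (2 + m)) → ∃ λ r → prev r ≡ c × r ≢ c
prev-surjective c with view c
... | ‵fromℕ     = zero , refl , λ ()
... | ‵inject₁ i = suc i , refl , λ e → ℕ.1+n≢n (trans (cong toℕ e) (Fin.toℕ-inject₁ i))

anyVec? : ∀ {n} m {P : Vec (Fin n) m → Set} → (∀ v → Dec (P v)) → Dec (∃ P)
anyVec? zero    P? = map′ ([] ,_) (λ { ([] , p) → p }) (P? [])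
anyVec? (suc m) P? = map′ (λ (x , v , p) → x ∷ v , p) (λ { (x ∷ v , p) → x , v , p })
  (Fin.any? λ x → anyVec? m λ v → P? (x ∷ v))

-- Otherwise ρ r lies outside the image of σ, and both together embed Fin (suc m) into Fin m.
sections-agree : ∀ {m} (row σ ρ : Fin m → Fin m) → (∀ r → row (σ r) ≡ r) → (∀ r → row (ρ r) ≡ r) →
                 ∀ r → σ r ≡ ρ r
sections-agree {m} row σ ρ rσ rρ r with σ r Fin.≟ ρ r
... | yes e = e
... | no ne with Fin.pigeonhole (ℕ.n<1+n m) f
  where
  f : Fin (suc m) → Fin m
  f zero    = ρ r
  f (suc i) = σ i
... | zero  , suc j , _ , e = ⊥-elim (ne (trans (cong σ (trans (sym (rρ r)) (trans (cong row e) (rσ j)))) (sym e)))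
... | suc i , suc j , s≤s i<j , e = ⊥-elim (ℕ.<⇒≢ i<j (cong toℕ (trans (sym (rσ i)) (trans (cong row e) (rσ j)))))

sections-agree-off-one : ∀ {m} (row : Fin (suc m) → Fin m) (σ ρ : Fin m → Fin (suc m)) →
  (∀ r → row (σ r) ≡ r) → (∀ r → row (ρ r) ≡ r) → ∀ r r′ → r ≢ r′ → σ r ≡ ρ r ⊎ σ r′ ≡ ρ r′
sections-agree-off-one {m} row σ ρ rσ rρ r r′ r≢r′ with σ r Fin.≟ ρ r | σ r′ Fin.≟ ρ r′
... | yes e | _     = inj₁ e
... | _     | yes e = inj₂ e
... | no ne | no ne′ with Fin.pigeonhole (ℕ.n<1+n (suc m)) f
  where
  f : Fin (2 + m) → Fin (suc m)
  f zero          = ρ r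
  f (suc zero)    = ρ r′
  f (suc (suc i)) = σ i
... | zero        , suc zero    , _ , e = ⊥-elim (r≢r′ (trans (sym (rρ r)) (trans (cong row e) (rρ r′))))
... | zero        , suc (suc j) , _ , e = ⊥-elim (ne (trans (cong σ (trans (sym (rρ r)) (trans (cong row e) (rσ j)))) (sym e)))
... | suc zero    , suc (suc j) , _ , e = ⊥-elim (ne′ (trans (cong σ (trans (sym (rρ r′)) (trans (cong row e) (rσ j)))) (sym e)))
... | suc zero    , suc zero    , s≤s () , _
... | suc (suc i) , suc (suc j) , s≤s (s≤s i<j) , e = ⊥-elim (ℕ.<⇒≢ i<j (cong toℕ (trans (sym (rσ i)) (trans (cong row e) (rσ j)))))

-- Fronts of pebbles, their distance from the ends, and uncut gaps

module Duplicator (k′ μ : ℕ) where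
  open Construction k′ μ

  first-bounds : ∀ (n : Node) d → toℕ (proj₁ (proj₂ n)) ≤ first d n × first d n ≤ suc (toℕ (proj₁ (proj₂ n)))
  first-bounds (_ , _ , _ , 0F) false = ℕ.≤-refl , ℕ.n≤1+n _
  first-bounds (_ , _ , _ , 0F) true  = ℕ.≤-refl , ℕ.n≤1+n _
  first-bounds (_ , _ , _ , 1F) false = ℕ.≤-refl , ℕ.n≤1+n _
  first-bounds (_ , _ , _ , 1F) true  = ℕ.n≤1+n _ , ℕ.≤-refl
  first-bounds (_ , _ , _ , 2F) false = ℕ.≤-refl , ℕ.n≤1+n _
  first-bounds (_ , _ , _ , 2F) true  = ℕ.≤-refl , ℕ.n≤1+n _

  second-bounds : ∀ (n : Node) d → toℕ (proj₁ (proj₂ (proj₂ n))) ≤ second d n × second d n ≤ suc (toℕ (proj₁ (proj₂ (proj₂ n))))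
  second-bounds (_ , _ , _ , 0F) false = ℕ.≤-refl , ℕ.n≤1+n _
  second-bounds (_ , _ , _ , 0F) true  = ℕ.≤-refl , ℕ.n≤1+n _
  second-bounds (_ , _ , _ , 1F) false = ℕ.≤-refl , ℕ.n≤1+n _
  second-bounds (_ , _ , _ , 1F) true  = ℕ.≤-refl , ℕ.n≤1+n _
  second-bounds (_ , _ , _ , 2F) false = ℕ.≤-refl , ℕ.n≤1+n _
  second-bounds (_ , _ , _ , 2F) true  = ℕ.n≤1+n _ , ℕ.≤-refl

  within : ∀ {p x y} → p ≤ x × x ≤ suc p → p ≤ y × y ≤ suc p → Close x y
  within (p≤x , x≤) (p≤y , y≤) = ℕ.≤-trans x≤ (s≤s p≤y) , ℕ.≤-trans y≤ (s≤s p≤x)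

  first-close : ∀ n d d′ → Close (first d n) (first d′ n)
  first-close n d d′ = within (first-bounds n d) (first-bounds n d′)

  second-close : ∀ n d d′ → Close (second d n) (second d′ n)
  second-close n d d′ = within (second-bounds n d) (second-bounds n d′)

  -- At most one of the two cells moves, so each position seen of one cell occurs together with each
  -- position seen of the other.
  rectangle : ∀ n d d′ → ∃ λ d″ → first d″ n ≡ first d n × second d″ n ≡ second d′ n
  rectangle (_ , _ , _ , 0F) false false = false , refl , refl
  rectangle (_ , _ , _ , 0F) true  false = false , refl , refl
  rectangle (_ , _ , _ , 0F) false true  = false , refl , refl
  rectangle (_ , _ , _ , 0F) true  true  = false , refl , refl
  rectangle (_ , _ , _ , 1F) false false = false , refl , refl
  rectangle (_ , _ , _ , 1F) true  false = true  , refl , refl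
  rectangle (_ , _ , _ , 1F) false true  = false , refl , refl
  rectangle (_ , _ , _ , 1F) true  true  = true  , refl , refl
  rectangle (_ , _ , _ , 2F) false false = false , refl , refl
  rectangle (_ , _ , _ , 2F) true  false = false , refl , refl
  rectangle (_ , _ , _ , 2F) false true  = true  , refl , refl
  rectangle (_ , _ , _ , 2F) true  true  = true  , refl , refl

  -- The target of a transition may be the position `N + 1`, hence `2 + N` positions.
  Configuration : Set
  Configuration = Vec (Fin (2 + N)) k

  position : Configuration → Fin k → ℕ
  position a c = toℕ (lookup a c)

  record Shown {m} (S : Vec Node m) (a : Configuration) (r : Fin k) (j : Fin m) : Set where
    constructor shown
    field
      valid   : Valid (lookup S j)
      in-row  : row (lookup S j) ≡ r
      end     : Bool
      first≡  : first end (lookup S j) ≡ position a (prev r)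
      second≡ : second end (lookup S j) ≡ position a r

  -- Each row chooses its pebble and the end of it independently, so the same pebbles can have many
  -- fronts.
  record Front {m} (S : Vec Node m) (a : Configuration) : Set where
    constructor front
    field
      pebble : Fin k → Fin m
      shows  : ∀ r → Shown S a r (pebble r)

  open Front

  abstract
    front? : ∀ {m} (S : Vec Node m) a → Dec (Front S a)
    front? S a = map′ (λ f → front (proj₁ ∘ f) λ r → let v , i , d , e , e′ = proj₂ (f r) in shown v i d e e′)
      (λ (front p s) r → p r , let shown v i d e e′ = s r in v , i , d , e , e′)
      (Fin.all? λ r → Fin.any? λ j → valid? (lookup S j) ×-dec (row (lookup S j) Fin.≟ r)
        ×-dec anyBool? λ d → (first d (lookup S j) ℕ.≟ position a (prev r)) ×-dec (second d (lookup S j) ℕ.≟ position a r))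

  shown-close : ∀ {m} {S : Vec Node m} {a a′ r j j′} → Shown S a r j → Shown S a′ r j′ → j ≡ j′ →
    Close (position a (prev r)) (position a′ (prev r)) × Close (position a r) (position a′ r)
  shown-close {S = S} {j = j} (shown _ _ d e₁ e₂) (shown _ _ d′ e₁′ e₂′) refl =
    subst₂ Close e₁ e₁′ (first-close (lookup S j) d d′) , subst₂ Close e₂ e₂′ (second-close (lookup S j) d d′)

  -- Each cell is seen by two rows. With one pebble more than rows, two fronts use the same pebble
  -- in at least one of these two, and the ends of a pebble are close.
  fronts-close : {W : Vec Node (suc k)} → ∀ {a a′} → Front W a → Front W a′ → ∀ c → Close (position a c) (position a′ c)
  fronts-close {W} F F′ c with prev-surjective c
  ... | r , refl , r≢c with sections-agree-off-one (row ∘ lookup W) (pebble F) (pebble F′)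
                             (Shown.in-row ∘ shows F) (Shown.in-row ∘ shows F′) r c r≢c
  ... | inj₁ e = proj₁ (shown-close (shows F r) (shows F′ r) e)
  ... | inj₂ e = proj₂ (shown-close (shows F c) (shows F′ c) e)

  digits : Configuration → Vec ℕ k
  digits = Vec.map (digit ∘ toℕ)

  lookup-digits : ∀ a c → lookup (digits a) c ≡ digit (position a c)
  lookup-digits a c = Vec.lookup-map c (digit ∘ toℕ) a

  digit-close : ∀ {p q} → Close p q → Close (digit p) (digit q)
  digit-close (h , h′) = one h , one h′
    where
    one : ∀ {p q} → p ≤ suc q → digit p ≤ suc (digit q)
    one {p} {q} h = begin
      (p ∸ E) ⊓ top           ≤⟨ ℕ.⊓-monoˡ-≤ top (ℕ.m≤n+o⇒m∸n≤o p E
          (ℕ.≤-trans h (ℕ.≤-trans (s≤s (ℕ.m≤n+m∸n q E)) (ℕ.≤-reflexive (sym (ℕ.+-suc E (q ∸ E))))))) ⟩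
      suc (q ∸ E) ⊓ top       ≤⟨ ℕ.⊓-monoʳ-≤ (suc (q ∸ E)) (ℕ.n≤1+n top) ⟩
      suc (q ∸ E) ⊓ suc top   ∎
      where open ℕ.≤-Reasoning

  front-chain : ∀ {m} {S : Vec Node m} {a} → Front S a → Chain (digits a)
  front-chain {S = S} {a} F = chain (digits a)
    (λ c → ℕ.≤-trans (ℕ.≤-reflexive (lookup-digits a c)) (ℕ.m⊓n≤n (position a c ∸ E) top))
    λ i → subst₂ (Gate top) (sym (lookup-digits a (inject₁ i))) (sym (lookup-digits a (suc i))) (gate i)
    where
    gate : ∀ i → Gate top (digit (position a (inject₁ i))) (digit (position a (suc i)))
    gate i with pebble F (suc i) | shows F (suc i)
    ... | j | shown val e d e₁ e₂ = subst₂ (Gated (suc i)) e₁ e₂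
        (subst (λ r → Gated r (first d (lookup S j)) (second d (lookup S j))) e (proj₁ (val d)))

  Maximum : ℕ
  Maximum = maximum (suc k′)

  -- The number of steps of the counter from its lower end (false) or its upper end (true).
  distance : Bool → Configuration → ℕ
  distance false a = value (digits a)
  distance true  a = Maximum ∸ value (digits a)

  distance-close : ∀ side {m m′} {S : Vec Node m} {S′ : Vec Node m′} {a a′} → Front S a → Front S′ a′ →
    (∀ c → Close (position a c) (position a′ c)) → Close (distance side a) (distance side a′)
  distance-close side {a = a} {a′} F F′ close = go side
    where
    values : Close (value (digits a)) (value (digits a′))
    values = value-close (front-chain F) (front-chain F′) λ c →
      subst₂ Close (sym (lookup-digits a c)) (sym (lookup-digits a′ c)) (digit-close (close c))
    ∸-close : ∀ {x y} → y ≤ suc x → Maximum ∸ x ≤ suc (Maximum ∸ y)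
    ∸-close {x} {y} h = ℕ.m≤n+o⇒m∸n≤o Maximum x (ℕ.≤-trans (ℕ.m≤n+m∸n Maximum y)
      (ℕ.≤-trans (ℕ.+-monoˡ-≤ (Maximum ∸ y) h) (ℕ.≤-reflexive (sym (ℕ.+-suc x (Maximum ∸ y))))))
    go : ∀ side → Close (distance side a) (distance side a′)
    go false = values
    go true  = ∸-close (proj₂ values) , ∸-close (proj₁ values)

  distance-opposite : ∀ side {m} {S : Vec Node m} {a} → Front S a → Maximum ∸ distance side a ≡ distance (not side) a
  distance-opposite false F = refl
  distance-opposite true F = ℕ.m∸[m∸n]≡n (value-≤ (front-chain F))

  -- A number θ stands for the gap between the positions θ and θ + 1; each zone has k + 2 gaps.
  Zone : Bool → ℕ → Set
  Zone false θ = θ < E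
  Zone true  θ = E + top ≤ θ × θ < N

  band : ℕ → ℕ → ℕ → Bool
  band θ θ′ p = above θ p xor above θ′ p

  above-true : ∀ {θ p} → θ < p → above θ p ≡ true
  above-true h = dec-true (_ ℕ.<? _) h

  above-false : ∀ {θ p} → p ≤ θ → above θ p ≡ false
  above-false h = dec-false (_ ℕ.<? _) (ℕ.≤⇒≯ h)

  zone-N : ∀ side {θ} → Zone side θ → θ < N
  zone-N false h       = ℕ.≤-trans h (ℕ.m≤m+n E _)
  zone-N true  (_ , h) = h

  -- Between two gaps of one zone the slowest digit, held by cell 0, is at an end of its range, and
  -- this alone determines the value of the counter.
  distance-in-band : ∀ side {θ θ′} → Zone side θ → Zone side θ′ → ∀ a → band θ θ′ (position a zero) ≡ true → distance side a ≡ 0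
  distance-in-band false {θ} {θ′} z z′ (p ∷ a) inside = value-bottom (digits (p ∷ a)) (digit-low (below (toℕ p ℕ.≤? E)))
    where
    below : Dec (toℕ p ≤ E) → toℕ p ≤ E
    below (yes h) = h
    below (no ¬h) with trans (sym inside) (cong₂ _xor_ (above-true (ℕ.<-trans z (ℕ.≰⇒> ¬h))) (above-true (ℕ.<-trans z′ (ℕ.≰⇒> ¬h))))
    ... | ()
  distance-in-band true {θ} {θ′} (z , _) (z′ , _) (p ∷ a) inside = ℕ.m≤n⇒m∸n≡0 (ℕ.≤-reflexive
    (sym (value-top (digits (p ∷ a)) (digit-high (beyond (E + top ℕ.≤? toℕ p))))))
    where
    beyond : Dec (E + top ≤ toℕ p) → E + top ≤ toℕ p
    beyond (yes h) = h
    beyond (no ¬h) with trans (sym inside) (cong₂ _xor_ (above-false (ℕ.≤-trans (ℕ.<⇒≤ (ℕ.≰⇒> ¬h)) z))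
        (above-false (ℕ.≤-trans (ℕ.<⇒≤ (ℕ.≰⇒> ¬h)) z′)))
    ... | ()

  uncut? : ∀ θ n → Dec (Uncut θ n)
  uncut? θ n = valid? n →-dec allBool? λ d → (above θ (first d n) Bool.≟ above θ (first false n))
                                       ×-dec (above θ (second d n) Bool.≟ above θ (first false n))

  zone-avoids-middle : ∀ side {θ p q} → Zone side θ → p ≤ θ → θ < q → Middle p → Middle q → ⊥
  zone-avoids-middle false z       p≤ _  (E≤ , _) _       = ℕ.<⇒≱ (ℕ.≤-<-trans p≤ z) E≤
  zone-avoids-middle true  (z , _) _  <q _        (_ , q≤) = ℕ.<⇒≱ (ℕ.≤-<-trans z <q) q≤

  -- A gap in a zone separates no two middle positions. Admissible positions on different sides of
  -- it are therefore close, which leaves only the two next to the gap.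
  cut-straight : ∀ side r {p q θ} → Admissible r p q → Zone side θ →
                 above θ p ≡ above θ q ⊎ (p ≡ θ × q ≡ suc θ) ⊎ (p ≡ suc θ × q ≡ θ)
  cut-straight side r {p} {q} {θ} (_ , adm) z with θ ℕ.<? p | θ ℕ.<? q | adm
  ... | yes h | yes h′ | _ = inj₁ (trans (above-true h) (sym (above-true h′)))
  ... | no ¬h | no ¬h′ | _ = inj₁ (trans (above-false (ℕ.≮⇒≥ ¬h)) (sym (above-false (ℕ.≮⇒≥ ¬h′))))
  ... | yes h | no ¬h′ | inj₁ (m , m′) = ⊥-elim (zone-avoids-middle side z (ℕ.≮⇒≥ ¬h′) h m′ m)
  ... | no ¬h | yes h′ | inj₁ (m , m′) = ⊥-elim (zone-avoids-middle side z (ℕ.≮⇒≥ ¬h) h′ m m′)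
  ... | yes h | no ¬h′ | inj₂ (p≤ , _) =
    inj₂ (inj₂ (ℕ.≤-antisym (ℕ.≤-trans p≤ (s≤s (ℕ.≮⇒≥ ¬h′))) h , ℕ.≤-antisym (ℕ.≮⇒≥ ¬h′) (s≤s⁻¹ (ℕ.≤-trans h p≤))))
  ... | no ¬h | yes h′ | inj₂ (_ , q≤) =
    inj₂ (inj₁ (ℕ.≤-antisym (ℕ.≮⇒≥ ¬h) (s≤s⁻¹ (ℕ.≤-trans h′ q≤)) , ℕ.≤-antisym (ℕ.≤-trans q≤ (s≤s (ℕ.≮⇒≥ ¬h))) h′))

  above-step : ∀ {θ p} → θ ≢ p → above θ (suc p) ≡ above θ p
  above-step {θ} {p} ne with θ ℕ.<? p
  ... | yes h = trans (above-true (ℕ.m≤n⇒m≤1+n h)) (sym (above-true h))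
  ... | no ¬h = trans (above-false (ℕ.≤∧≢⇒< (ℕ.≮⇒≥ ¬h) (ne ∘ sym))) (sym (above-false (ℕ.≮⇒≥ ¬h)))

  -- In a zone the positions seen by a row differ by at most 1, so a node cuts at most one gap.
  cutAt : Node → ℕ
  cutAt (_ , a , b , 0F) = toℕ a ⊓ toℕ b
  cutAt (_ , a , b , 1F) = toℕ a
  cutAt (_ , a , b , 2F) = toℕ b

  uncut-elsewhere : ∀ side {θ} n → Zone side θ → θ ≢ cutAt n → Uncut θ n
  uncut-elsewhere side {θ} (r , a , b , 0F) z ne val = λ { false → refl , eq ; true → refl , eq }
    where
    eq : above θ (toℕ b) ≡ above θ (toℕ a)
    eq with cut-straight side r (val false) z
    ... | inj₁ e = sym e
    ... | inj₂ (inj₁ (e , e′)) = ⊥-elim (ne (sym (trans (cong₂ _⊓_ e e′) (ℕ.m≤n⇒m⊓n≡m (ℕ.n≤1+n θ)))))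
    ... | inj₂ (inj₂ (e , e′)) = ⊥-elim (ne (sym (trans (cong₂ _⊓_ e e′) (ℕ.m≥n⇒m⊓n≡n (ℕ.n≤1+n θ)))))
  uncut-elsewhere side {θ} (r , a , b , 1F) z ne val = λ { false → refl , eq ; true → above-step ne , eq }
    where
    eq : above θ (toℕ b) ≡ above θ (toℕ a)
    eq with cut-straight side r (val false) z | cut-straight side r (val true) z
    ... | inj₁ e | _ = sym e
    ... | inj₂ (inj₁ (e , e′)) | _ = ⊥-elim (ne (sym e))
    ... | inj₂ (inj₂ _) | inj₁ e = trans (sym e) (above-step ne)
    ... | inj₂ (inj₂ (e , e′)) | inj₂ (inj₁ (f , _)) = ⊥-elim (ℕ.<⇒≢ (ℕ.≤-trans (ℕ.n<1+n θ) (ℕ.≤-trans (ℕ.≤-reflexive (sym e)) (ℕ.n≤1+n _))) (sym f))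
    ... | inj₂ (inj₂ (e , e′)) | inj₂ (inj₂ (f , _)) = ⊥-elim (ℕ.1+n≢n (trans f (sym e)))
  uncut-elsewhere side {θ} (r , a , b , 2F) z ne val = λ { false → refl , eq ; true → refl , trans (above-step ne) eq }
    where
    eq : above θ (toℕ b) ≡ above θ (toℕ a)
    eq with cut-straight side r (val false) z | cut-straight side r (val true) z
    ... | inj₁ e | _ = sym e
    ... | inj₂ (inj₂ (e , e′)) | _ = ⊥-elim (ne (sym e′))
    ... | inj₂ (inj₁ _) | inj₁ e = sym (trans e (above-step ne))
    ... | inj₂ (inj₁ (e , e′)) | inj₂ (inj₂ (_ , f)) = ⊥-elim (ℕ.<⇒≢ (ℕ.≤-trans (ℕ.n<1+n θ) (ℕ.≤-trans (ℕ.≤-reflexive (sym e′)) (ℕ.n≤1+n _))) (sym f))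
    ... | inj₂ (inj₁ (e , e′)) | inj₂ (inj₁ (_ , f)) = ⊥-elim (ℕ.1+n≢n (trans f (sym e′)))

  gap : Bool → Fin E → ℕ
  gap false i = toℕ i
  gap true  i = E + top + toℕ i

  gap-zone : ∀ side i → Zone side (gap side i)
  gap-zone false i = Fin.toℕ<n i
  gap-zone true  i = ℕ.m≤m+n _ _ , ℕ.≤-trans (ℕ.≤-reflexive (sym (ℕ.+-suc (E + top) (toℕ i))))
    (ℕ.≤-trans (ℕ.+-monoʳ-≤ (E + top) (Fin.toℕ<n i)) (ℕ.≤-reflexive (ℕ.+-assoc E top E)))

  gap-injective : ∀ side {i j} → gap side i ≡ gap side j → i ≡ j
  gap-injective false e = Fin.toℕ-injective e
  gap-injective true  e = Fin.toℕ-injective (ℕ.+-cancelˡ-≡ (E + top) _ _ e)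

  uncut-gap : ∀ side (W : Vec Node (suc k)) → ∃ λ θ → Zone side θ × (∀ j → Uncut θ (lookup W j))
  uncut-gap side W with Fin.any? (λ i → Fin.all? λ j → uncut? (gap side i) (lookup W j))
  ... | yes (i , u) = gap side i , gap-zone side i , u
  ... | no none = ⊥-elim (collision (Fin.pigeonhole (ℕ.n<1+n (suc k)) (proj₁ ∘ cutter)))
    where
    cutter : ∀ i → ∃ λ j → ¬ Uncut (gap side i) (lookup W j)
    cutter i = Fin.¬∀⟶∃¬ (suc k) _ (λ j → uncut? (gap side i) (lookup W j)) λ u → none (i , u)
    at : ∀ i → gap side i ≡ cutAt (lookup W (proj₁ (cutter i)))
    at i with gap side i ℕ.≟ cutAt (lookup W (proj₁ (cutter i)))
    ... | yes e = e
    ... | no ne = ⊥-elim (proj₂ (cutter i) (uncut-elsewhere side _ (gap-zone side i) ne))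
    collision : ¬ ∃₂ λ i j → i Fin.< j × proj₁ (cutter i) ≡ proj₁ (cutter j)
    collision (i , j , i<j , e) = Fin.<⇒≢ i<j (gap-injective side
      (trans (at i) (trans (cong (cutAt ∘ lookup W) e) (sym (at j)))))

-- Moving the twist across a band of positions

before : ∀ {m} → Fin m → Fin m → Bool
before i j = toℕ i <ᵇ toℕ j

before-step : ∀ {m} (i j : Fin m) → (toℕ i <ᵇ suc (toℕ j)) xor before i j ≡ does (i Fin.≟ j)
before-step zero    zero    = refl
before-step zero    (suc j) = refl
before-step (suc i) zero    = refl
before-step (suc i) (suc j) = before-step i j

-- Going round the ring, the indicator of the cells before `f` changes at the rows 0 and `f` only.
-- Flipping these cells thus carries a twist from row 0 to row `f`.
before-prev : ∀ {m} (r f : Fin (suc m)) → (before (prev r) f xor before r f) xor isZero r ≡ does (r Fin.≟ f)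
before-prev {m} zero f = trans (cong (λ x → (x xor before zero f) xor true) last-before) (first f)
  where
  last-before : before (Fin.fromℕ m) f ≡ false
  last-before = dec-false (toℕ (Fin.fromℕ m) ℕ.<? toℕ f)
    (ℕ.≤⇒≯ (ℕ.≤-trans (s≤s⁻¹ (Fin.toℕ<n f)) (ℕ.≤-reflexive (sym (Fin.toℕ-fromℕ m)))))
  first : ∀ (f : Fin (suc m)) → before {suc m} zero f xor true ≡ does (zero Fin.≟ f)
  first zero    = refl
  first (suc f) = refl
before-prev (suc i) f = trans (Bool.xor-identityʳ _)
  (trans (cong (λ x → (x <ᵇ toℕ f) xor before (suc i) f) (Fin.toℕ-inject₁ i)) (go f))
  where
  go : ∀ f → (toℕ i <ᵇ toℕ f) xor before (suc i) f ≡ does (suc i Fin.≟ f)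
  go zero    = refl
  go (suc f) = before-step i f

module DuplicatorMoves (k′ μ : ℕ) where
  open Construction k′ μ
  open Duplicator k′ μ

  Potential : Set
  Potential = Fin k → ℕ → Bool

  -- The colors reveal the bits at the corners, so there the cells must not contribute and the twist
  -- alone acts.
  Grounded : Potential → Set
  Grounded u = ∀ c → u c 0 ≡ false × u c N ≡ false

  module Move (S : Vec Node k) (u : Potential) (ground : Grounded u) (θ θ′ : ℕ) (θ<N : θ < N) (θ′<N : θ′ < N)
              (uncut : ∀ j → Uncut θ (lookup S j)) (uncut′ : ∀ j → Uncut θ′ (lookup S j)) where

    inside : ℕ → Bool
    inside = band θ θ′

    Inside : Fin k → Set
    Inside j = Valid (lookup S j) × inside (first false (lookup S j)) ≡ true

    inside? : ∀ j → Dec (Inside j)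
    inside? j = valid? (lookup S j) ×-dec (inside (first false (lookup S j)) Bool.≟ true)

    inside-first : ∀ j → Valid (lookup S j) → ∀ d → inside (first d (lookup S j)) ≡ inside (first false (lookup S j))
    inside-first j val d = cong₂ _xor_ (proj₁ (uncut j val d)) (proj₁ (uncut′ j val d))

    inside-second : ∀ j → Valid (lookup S j) → ∀ d → inside (second d (lookup S j)) ≡ inside (first false (lookup S j))
    inside-second j val d = cong₂ _xor_ (proj₂ (uncut j val d)) (proj₂ (uncut′ j val d))

    Meeting : Fin k → Set
    Meeting f = ∃₂ λ j j′ → (Inside j × row (lookup S j) ≡ f) × (Inside j′ × prev (row (lookup S j′)) ≡ f)
                          × ∃₂ λ d d′ → second d (lookup S j) ≡ first d′ (lookup S j′)

    meeting? : ∀ f → Dec (Meeting f)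
    meeting? f = Fin.any? λ j → Fin.any? λ j′ → (inside? j ×-dec (row (lookup S j) Fin.≟ f))
      ×-dec (inside? j′ ×-dec (prev (row (lookup S j′)) Fin.≟ f))
      ×-dec anyBool? λ d → anyBool? λ d′ → second d (lookup S j) ℕ.≟ first d′ (lookup S j′)

    -- If no position of cell f is shown both by row f and by the other row of f, then
    -- the twist can cross the band by flipping the cells before f in the whole band
    -- and the cell f at the positions shown by row f.
    module Cross (f : Fin k) (apart : ¬ Meeting f) where

      Marked : ℕ → Set
      Marked p = ∃ λ j → (Inside j × row (lookup S j) ≡ f) × ∃ λ d → second d (lookup S j) ≡ p

      marked? : ∀ p → Dec (Marked p)
      marked? p = Fin.any? λ j → (inside? j ×-dec (row (lookup S j) Fin.≟ f)) ×-dec anyBool? λ d → second d (lookup S j) ℕ.≟ p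

      marked-inside : ∀ {p} → Marked p → inside p ≡ true
      marked-inside (j , ((val , i) , _) , d , refl) = trans (inside-second j val d) i

      δ : Potential
      δ c p = (before c f ∧ inside p) xor (does (c Fin.≟ f) ∧ does (marked? p))

      δ-outside : ∀ c p → inside p ≡ false → δ c p ≡ false
      δ-outside c p out = cong₂ _xor_
        (trans (cong (before c f ∧_) out) (Bool.∧-zeroʳ (before c f)))
        (trans (cong (does (c Fin.≟ f) ∧_) (dec-false (marked? p) λ m → case trans (sym (marked-inside m)) out of λ ()))
               (Bool.∧-zeroʳ (does (c Fin.≟ f))))

      u′ : Potential
      u′ c p = u c p xor δ c p

      ground′ : Grounded u′
      ground′ c = cong₂ _xor_ (proj₁ (ground c)) (δ-outside c 0 refl) ,
                  cong₂ _xor_ (proj₂ (ground c)) (δ-outside c N (cong₂ _xor_ (above-true θ<N) (above-true θ′<N)))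

      -- The band is constant on a pebbled node. Flipping the cells before `f` turns the twist in
      -- row 0 into one in row `f`, where the marked positions cancel it; in the other row of `f` a
      -- pebble seeing a marked position would be a meeting.
      vanish : ∀ j → Valid (lookup S j) → ∀ d → let n = lookup S j in
               (δ (prev (row n)) (first d n) xor δ (row n) (second d n)) xor (isZero (row n) ∧ inside (first d n)) ≡ false
      vanish j val d = begin
        (((b₁ ∧ inside p) xor (e₁ ∧ m₁)) xor ((b₂ ∧ inside q) xor (e₂ ∧ m₂))) xor (z ∧ inside p)
          ≡⟨ cong₂ (λ x y → (((b₁ ∧ x) xor (e₁ ∧ m₁)) xor ((b₂ ∧ y) xor (e₂ ∧ m₂))) xor (z ∧ x)) (inside-first j val d) (inside-second j val d) ⟩
        (((b₁ ∧ β) xor (e₁ ∧ m₁)) xor ((b₂ ∧ β) xor (e₂ ∧ m₂))) xor (z ∧ β)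
          ≡⟨ solve 6 (λ b₁ b₂ z β s t → ((b₁ :* β :+ s) :+ (b₂ :* β :+ t)) :+ z :* β := ((b₁ :+ b₂) :+ z) :* β :+ (s :+ t)) refl b₁ b₂ z β
              (e₁ ∧ m₁) (e₂ ∧ m₂) ⟩
        (((b₁ xor b₂) xor z) ∧ β) xor ((e₁ ∧ m₁) xor (e₂ ∧ m₂))
          ≡⟨ cong₂ (λ x y → (x ∧ β) xor (y xor (e₂ ∧ m₂))) (before-prev r f) unmarked ⟩
        (e₂ ∧ β) xor (e₂ ∧ m₂)
          ≡⟨ cong ((e₂ ∧ β) xor_) marked ⟩
        (e₂ ∧ β) xor (e₂ ∧ β)
          ≡⟨ Bool.xor-same (e₂ ∧ β) ⟩
        false ∎
        where
        open ≡-Reasoning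
        open xor-∧-Solver
        n = lookup S j
        r = row n
        p = first d n
        q = second d n
        β = inside (first false n)
        b₁ = before (prev r) f
        b₂ = before r f
        e₁ = does (prev r Fin.≟ f)
        e₂ = does (r Fin.≟ f)
        m₁ = does (marked? p)
        m₂ = does (marked? q)
        z = isZero r
        unmarked : e₁ ∧ m₁ ≡ false
        unmarked with prev r Fin.≟ f
        ... | no _ = refl
        ... | yes e = dec-false (marked? p) λ (j′ , s , d′ , e′) → apart (j′ , j , s ,
          ((val , trans (sym (inside-first j val d)) (marked-inside (j′ , s , d′ , e′))) , e) , d′ , d , e′)
        marked : e₂ ∧ m₂ ≡ e₂ ∧ β
        marked with r Fin.≟ f | β in eq
        ... | no _  | _     = refl
        ... | yes e | true  = dec-true (marked? q) (j , ((val , eq) , e) , d , refl)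
        ... | yes e | false = dec-false (marked? q) λ m →
          case trans (sym (marked-inside m)) (trans (inside-second j val d) eq) of λ ()

      same-shift : ∀ j d → shift u θ (lookup S j) d ≡ shift u′ θ′ (lookup S j) d
      same-shift j d = go (valid? n)
        where
        open ≡-Reasoning
        open xor-∧-Solver
        n = lookup S j
        x = u (prev (row n)) (first d n)
        y = u (row n) (second d n)
        z = isZero (row n)
        a = above θ (first d n)
        a′ = above θ′ (first d n)
        s = δ (prev (row n)) (first d n)
        t = δ (row n) (second d n)
        go : Dec (Valid n) → shift u θ n d ≡ shift u′ θ′ n d
        go (no ¬val) = trans (shift-invalid u θ n d ¬val) (sym (shift-invalid u′ θ′ n d ¬val))
        go (yes val) = begin
          shift u θ n d
            ≡⟨ shift-valid u θ n d val ⟩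
          (x xor y) xor (z ∧ a)
            ≡⟨ Bool.xor-identityʳ _ ⟨
          ((x xor y) xor (z ∧ a)) xor false
            ≡⟨ cong (((x xor y) xor (z ∧ a)) xor_) (vanish j val d) ⟨
          ((x xor y) xor (z ∧ a)) xor ((s xor t) xor (z ∧ (a xor a′)))
            ≡⟨ solve 7 (λ x y z a a′ s t → ((x :+ y) :+ z :* a) :+ ((s :+ t) :+ z :* (a :+ a′)) :=
                ((x :+ s) :+ (y :+ t)) :+ z :* a′) refl x y z a a′ s t ⟩
          ((x xor s) xor (y xor t)) xor (z ∧ a′)
            ≡⟨ shift-valid u′ θ′ n d val ⟨
          shift u′ θ′ n d ∎

    -- Every cell has a position in the band that both of its rows show. As there are only `k`
    -- pebbles for `k` rows, each row uses the same pebble for both of its cells, and `rectangle`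
    -- finds one end that shows both positions.
    meet-front : (∀ f → Meeting f) → ∃ λ a → Front S a × inside (position a zero) ≡ true
    meet-front meet = a , front σ shows-all , trans (cong inside (position-a zero)) (inside-at zero)
      where
      σ ρ : Fin k → Fin k
      σ f = proj₁ (meet f)
      ρ r = proj₁ (proj₂ (meet (prev r)))
      row-σ : ∀ f → row (lookup S (σ f)) ≡ f
      row-σ f = let _ , _ , (_ , e) , _ = meet f in e
      row-ρ : ∀ r → row (lookup S (ρ r)) ≡ r
      row-ρ r = let _ , _ , _ , (_ , e) , _ = meet (prev r) in prev-injective e
      place : Fin k → ℕ
      place f = let j , _ , _ , _ , d , _ = meet f in second d (lookup S j)
      bounded : ∀ f → place f < 2 + N
      bounded f = let j , _ , _ , _ , d , _ = meet f in
        s≤s (ℕ.≤-trans (proj₂ (second-bounds (lookup S j) d)) (Fin.toℕ<n (proj₁ (proj₂ (proj₂ (lookup S j))))))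
      a : Configuration
      a = tabulate λ f → Fin.fromℕ< (bounded f)
      position-a : ∀ f → position a f ≡ place f
      position-a f = trans (cong toℕ (Vec.lookup∘tabulate (λ f → Fin.fromℕ< (bounded f)) f)) (Fin.toℕ-fromℕ< (bounded f))
      inside-at : ∀ f → inside (place f) ≡ true
      inside-at f = let j , _ , ((val , i) , _) , _ , d , _ = meet f in trans (inside-second j val d) i
      shows-all : ∀ r → Shown S a r (σ r)
      shows-all r = shown (proj₁ (proj₁ (proj₁ (proj₂ (proj₂ (meet r)))))) (row-σ r) (proj₁ corner)
        (trans (proj₁ (proj₂ corner)) (trans (cong (λ j → first d′ (lookup S j)) (sections-agree (row ∘ lookup S) σ ρ row-σ row-ρ r))
          (trans (sym same) (sym (position-a (prev r))))))
        (trans (proj₂ (proj₂ corner)) (sym (position-a r)))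
        where
        d = proj₁ (proj₂ (proj₂ (proj₂ (proj₂ (meet r)))))
        d′ = proj₁ (proj₂ (proj₂ (proj₂ (proj₂ (proj₂ (meet (prev r)))))))
        same = proj₂ (proj₂ (proj₂ (proj₂ (proj₂ (proj₂ (meet (prev r)))))))
        corner = rectangle (lookup S (σ r)) d′ d

    move : (∃ λ u′ → Grounded u′ × ∀ j d → shift u θ (lookup S j) d ≡ shift u′ θ′ (lookup S j) d)
         ⊎ (∃ λ a → Front S a × inside (position a zero) ≡ true)
    move with Fin.all? meeting?
    ... | yes meet = inj₂ (meet-front meet)
    ... | no ¬meet with Fin.¬∀⟶∃¬ k Meeting meeting? ¬meet
    ... | f , apart = inj₁ (Cross.u′ f apart , Cross.ground′ f apart , Cross.same-shift f apart)

-- Keeping the twist away from the shown configurations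

lookup-extensional : ∀ {A : Set} {n} {xs ys : Vec A n} → (∀ i → lookup xs i ≡ lookup ys i) → xs ≡ ys
lookup-extensional {xs = xs} {ys} eq =
  trans (sym (Vec.tabulate∘lookup xs)) (trans (Vec.tabulate-cong eq) (Vec.tabulate∘lookup ys))

does-∧-cong : ∀ {P : Set} (p? : Dec P) {x y} → (P → x ≡ y) → does p? ∧ x ≡ does p? ∧ y
does-∧-cong (no _)  _  = refl
does-∧-cong (yes p) eq = eq p

module Survival (k′ μ : ℕ) where
  open Construction k′ μ
  open Duplicator k′ μ
  open DuplicatorMoves k′ μ

  -- Whichever entry `x` replaces, the new pebbles are among the `k + 1` pebbles `x ∷ S`. A choice
  -- that suits all of these suits every `i`.
  origin : Fin k → Fin k → Fin (suc k)
  origin i j with j Fin.≟ i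
  ... | yes _ = zero
  ... | no  _ = suc j

  lookup-origin : ∀ (S : Vec Node k) i x j → lookup (S [ i ]≔ x) j ≡ lookup (x ∷ S) (origin i j)
  lookup-origin S i x j with j Fin.≟ i
  ... | yes refl = Vec.lookup∘update i S x
  ... | no  j≢i  = Vec.lookup∘update′ j≢i S x

  front-embed : ∀ {m m′} {S : Vec Node m} {S′ : Vec Node m′} (f : Fin m → Fin m′) → (∀ j → lookup S j ≡ lookup S′ (f j)) →
                ∀ {a} → Front S a → Front S′ a
  front-embed {S = S} {S′} f eq {a} (front p s) = front (f ∘ p) λ r → embed r (s r)
    where
    embed : ∀ r → Shown S a r (p r) → Shown S′ a r (f (p r))
    embed r (shown v i d e e′) = shown (subst Valid same v) (trans (cong row (sym same)) i) d
      (trans (cong (first d) (sym same)) e) (trans (cong (second d) (sym same)) e′)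
      where same = eq (p r)

  FarSide : ℕ → Bool → Vec Node (suc k) → Set
  FarSide T side W = (∀ a → Front W a → T < distance side a)
                   ⊎ (∃ λ a₀ → Front W a₀ × distance side a₀ ≤ T × ∀ a → Front W a → T < distance (not side) a)

  -- The fronts of `W` differ by at most 1 in distance. If one is within `T` of the end `side`, all
  -- are within `T + 1`, hence more than `T` away from the other end.
  far-side : ∀ T → suc (T + T) < Maximum → ∀ side W → FarSide T side W
  far-side T T< side W = decide (anyVec? k λ a → front? W a ×-dec (distance side a ℕ.≤? T))
    where
    decide : Dec (∃ λ a → Front W a × distance side a ≤ T) → FarSide T side W
    decide (no  none)             = inj₁ λ a F → ℕ.≰⇒> λ h → none (a , F , h)
    decide (yes (a₀ , F₀ , near)) = inj₂ (a₀ , F₀ , near , λ a F → subst (T <_) (distance-opposite side F)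
      (ℕ.≤-trans (ℕ.m+n≤o⇒m≤o∸n (suc T) (ℕ.≤-trans (ℕ.≤-reflexive (ℕ.+-suc (suc T) T)) T<))
        (ℕ.∸-monoʳ-≤ Maximum (ℕ.≤-trans (proj₁ (distance-close side F F₀ (fronts-close F F₀))) (s≤s near)))))

  -- `T` is the number of rounds left: a front moves by at most one step per round, so none can get
  -- to the end that hides the twist.
  record Safe (T : ℕ) (S : Vec Node k) (u : Potential) (θ : ℕ) : Set where
    field
      side   : Bool
      zone   : Zone side θ
      ground : Grounded u
      uncut  : ∀ j → Uncut θ (lookup S j)
      far    : ∀ a → Front S a → T < distance side a

  record Response (T : ℕ) (S : Vec Node k) (u : Potential) (θ : ℕ) (x : Node) : Set where
    field
      u′         : Potential
      θ′         : ℕ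
      same-shift : ∀ j d → shift u θ (lookup S j) d ≡ shift u′ θ′ (lookup S j) d
      safe       : ∀ i → Safe T (S [ i ]≔ x) u′ θ′

  cross : ∀ {T S u θ x} (now : Safe (suc T) S u θ) side′ →
    (∀ a → Front (x ∷ S) a → T < distance side′ a) →
    (∀ θ′ → Zone side′ θ′ → ∀ a → Front S a → band θ θ′ (position a zero) ≢ true) →
    Response T S u θ x
  cross {T} {S} {u} {θ} {x} now side′ far′ unobstructed = go (uncut-gap side′ (x ∷ S))
    where
    open Safe now
    go : (∃ λ θ′ → Zone side′ θ′ × (∀ j → Uncut θ′ (lookup (x ∷ S) j))) → Response T S u θ x
    go (θ′ , zone′ , uncut′) = moved (Move.move S u ground θ θ′ (zone-N side zone) (zone-N side′ zone′) uncut (uncut′ ∘ suc))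
      where
      moved : _ ⊎ _ → Response T S u θ x
      moved (inj₂ (a , F , inside)) = ⊥-elim (unobstructed θ′ zone′ a F inside)
      moved (inj₁ (u′ , ground′ , same)) = record
        { u′ = u′ ; θ′ = θ′ ; same-shift = same
        ; safe = λ i → record
          { side   = side′
          ; zone   = zone′
          ; ground = ground′
          ; uncut  = λ j → subst (Uncut θ′) (sym (lookup-origin S i x j)) (uncut′ (origin i j))
          ; far    = λ a F → far′ a (front-embed (origin i) (lookup-origin S i x) F)
          }
        }

  abstract
    -- The twist changes sides when the pebbles may next show a configuration close to its side;
    -- they do not show one now, since that would already be too close.
    advance : ∀ {T} → suc (T + T) < Maximum → ∀ {S u θ} → Safe (suc T) S u θ → ∀ x → Response T S u θ x
    advance {T} T< {S} {u} {θ} now x = choose (far-side T T< side (x ∷ S))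
      where
      open Safe now
      choose : FarSide T side (x ∷ S) → Response T S u θ x
      choose (inj₁ far′) = cross now side far′ λ θ′ zone′ a F inside →
        ℕ.<⇒≢ (ℕ.≤-<-trans z≤n (far a F)) (sym (distance-in-band side zone zone′ a inside))
      choose (inj₂ (a₀ , F₀ , near , far′)) = cross now (not side) far′ λ _ _ a F _ →
        ℕ.<⇒≱ (far a F) (ℕ.≤-trans (proj₁ (distance-close side F F₀ (fronts-close (front-embed suc (λ _ → refl) F) F₀))) (s≤s near))

    start : ∀ {T} → suc (T + T) < Maximum → ∀ S → ∃ λ θ → Safe T S (λ _ _ → false) θ
    -- Before the first round there are only `k` pebbles; one is repeated to make `k + 1`.
    start {T} T< S = choose (far-side T T< false (lookup S zero ∷ S))
      where
      place : ∀ side → (∀ a → Front (lookup S zero ∷ S) a → T < distance side a) → ∃ λ θ → Safe T S (λ _ _ → false) θ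
      place side far = let θ , zone , uncut = uncut-gap side (lookup S zero ∷ S) in θ , record
        { side   = side
        ; zone   = zone
        ; ground = λ _ → refl , refl
        ; uncut  = uncut ∘ suc
        ; far    = λ a F → far a (front-embed suc (λ _ → refl) F)
        }
      choose : FarSide T false (lookup S zero ∷ S) → ∃ λ θ → Safe T S (λ _ _ → false) θ
      choose (inj₁ far)               = place false far
      choose (inj₂ (_ , _ , _ , far)) = place true far

-- From safe positions to equal colors

module Indistinguishability (k′ μ : ℕ) where
  open Construction k′ μ
  open Duplicator k′ μ
  open DuplicatorMoves k′ μ
  open Survival k′ μ

  nodes : ∀ {m} → Vec (Fin size) m → Vec Node m
  nodes = Vec.map nodeOf

  shifted : Potential → ℕ → Fin size → Fin size
  shifted u θ v = encode (translate u θ (decode v))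

  decode-shifted : ∀ u θ v → decode (shifted u θ v) ≡ translate u θ (decode v)
  decode-shifted u θ v = decode-encode (translate u θ (decode v))

  nodeOf-shifted : ∀ u θ v → nodeOf (shifted u θ v) ≡ nodeOf v
  nodeOf-shifted u θ v = cong node (decode-shifted u θ v)

  shifted-involutive : ∀ u θ v → shifted u θ (shifted u θ v) ≡ v
  shifted-involutive u θ v = trans (cong (encode ∘ translate u θ) (decode-shifted u θ v))
    (trans (cong encode (translate-involutive u θ (decode v))) (encode-decode v))

  shifted-cong : ∀ {u θ u′ θ′} v → (∀ d → shift u θ (nodeOf v) d ≡ shift u′ θ′ (nodeOf v) d) → shifted u θ v ≡ shifted u′ θ′ v
  shifted-cong v same = cong encode (cong₂ (λ s t → nodeOf v , bit false (decode v) xor s , bit true (decode v) xor t) (same false) (same true))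

  corner-low-shift : ∀ {u θ} → Grounded u → ∀ n → Corner 0 n → shift u θ n false ≡ false
  corner-low-shift {u} {θ} ground n (_ , e , e′) = go (valid? n)
    where
    r = row n
    go : Dec (Valid n) → shift u θ n false ≡ false
    go (no ¬val) = shift-invalid u θ n false ¬val
    go (yes val) = trans (shift-valid u θ n false val) (trans (cong₂ (potential u θ r) e e′)
      (cong₂ _xor_ (cong₂ _xor_ (proj₁ (ground (prev r))) (proj₁ (ground r))) (Bool.∧-zeroʳ (isZero r))))

  corner-valid : ∀ n → Corner N n → Valid n
  corner-valid (r , a , b , 0F) (refl , e , e′) = λ { false → adm ; true → adm }
    where
    high : ∀ {p} → p ≡ N → E + top ≤ p
    high refl = ℕ.+-monoʳ-≤ E (ℕ.m≤m+n top E)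
    adm : Admissible r (toℕ a) (toℕ b)
    adm = gated-high r (high e) (high e′) , inj₂ (subst₂ Close (sym e) (sym e′) close-refl)

  corner-high-shift : ∀ {u θ} → Grounded u → θ < N → ∀ n → Corner N n → shift u θ n false ≡ isZero (row n)
  corner-high-shift {u} {θ} ground θ<N n c@(_ , e , e′) = trans (shift-valid u θ n false (corner-valid n c))
    (trans (cong₂ (potential u θ r) e e′)
      (cong₂ _xor_ (cong₂ _xor_ (proj₂ (ground (prev r))) (proj₂ (ground r)))
        (trans (cong (isZero r ∧_) (above-true θ<N)) (Bool.∧-identityʳ (isZero r)))))
    where r = row n

  -- Wherever the twist is, it lies above 0 and below `N`. With grounded potentials it flips, among
  -- the bits at the corners, exactly that of row 0 at `N`, and this makes up for the different
  -- flags of the two graphs.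
  flag-translate : ∀ {u θ} → Grounded u → θ < N → ∀ v → flag false v ≡ flag true (translate u θ v)
  flag-translate {u} {θ} ground θ<N v@(n , x , _) = cong₂ _∨_ low high
    where
    low : does (corner? 0 n) ∧ x ≡ does (corner? 0 n) ∧ (x xor shift u θ n false)
    low = does-∧-cong (corner? 0 n) λ c → sym (trans (cong (x xor_) (corner-low-shift {u} {θ} ground n c)) (Bool.xor-identityʳ x))
    high : does (corner? N n) ∧ (x xor false) ≡ does (corner? N n) ∧ ((x xor shift u θ n false) xor isZero (row n))
    high = does-∧-cong (corner? N n) λ c → sym (trans (cong (λ s → (x xor s) xor isZero (row n)) (corner-high-shift {u} {θ} ground θ<N n c))
      (trans (Bool.xor-assoc x _ _) (cong (x xor_) (Bool.xor-same (isZero (row n))))))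

  shifted-tupleIso : ∀ {u θ} → Grounded u → θ < N → (t : Vec (Fin size) k) → (∀ j → Uncut θ (nodeOf (lookup t j))) →
    TupleIso k (graph false , t) (graph true , Vec.map (shifted u θ) t)
  shifted-tupleIso {u} {θ} ground θ<N t uncut = equality , adjacency , colors
    where
    f = shifted u θ
    image : ∀ i → lookup (Vec.map f t) i ≡ f (lookup t i)
    image i = Vec.lookup-map i f t
    decode-image : ∀ i → decode (lookup (Vec.map f t) i) ≡ translate u θ (decode (lookup t i))
    decode-image i = trans (cong decode (image i)) (decode-shifted u θ (lookup t i))
    equality : ∀ i j → _
    equality i j = mk⇔ (λ e → trans (image i) (trans (cong f e) (sym (image j))))
      (λ e → trans (sym (shifted-involutive u θ (lookup t i)))
          (trans (cong f (trans (sym (image i)) (trans e (image j)))) (shifted-involutive u θ (lookup t j))))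
    adjacency : ∀ i j → adjacent (graph false) (lookup t i) (lookup t j)
                      ≡ adjacent (graph true) (lookup (Vec.map f t) i) (lookup (Vec.map f t) j)
    adjacency i j = trans (does-⇔ (mk⇔ (translate-adjacent u θ (uncut i) (uncut j))
        (λ adj → subst₂ Adjacent (translate-involutive u θ v) (translate-involutive u θ w) (translate-adjacent u θ (uncut i) (uncut j) adj)))
        (adjacent? v w) (adjacent? (translate u θ v) (translate u θ w)))
      (cong₂ (λ v w → does (adjacent? v w)) (sym (decode-image i)) (sym (decode-image j)))
      where
      v = decode (lookup t i)
      w = decode (lookup t j)
    colors : ∀ i → color (graph false) (lookup t i) ≡ color (graph true) (lookup (Vec.map f t) i)
    colors i = cong toℕ (trans
      (cong (λ b → encode (nodeOf (lookup t i) , b , false)) (flag-translate {u} {θ} ground θ<N (decode (lookup t i))))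
      (cong (λ v → encode (node v , flag true v , false)) (sym (decode-image i))))

  duplicator-wins : ∀ T → suc (T + T) < Maximum → ∀ t {u θ} → Safe T (nodes t) u θ →
    SameColor T (graph false) (graph true) t (Vec.map (shifted u θ) t)
  duplicator-wins zero T< t {u} {θ} safe = tupleIso⇒sameColor (shifted-tupleIso {u} {θ} ground (zone-N side zone) t
    λ j → subst (Uncut θ) (Vec.lookup-map j nodeOf t) (uncut j))
    where open Safe safe
  duplicator-wins (suc T) T< t {u} {θ} safe = match T (graph false) (graph true) t (Vec.map (shifted u θ) t)
    (duplicator-wins T T<′ t weaker) β (involution-↭ β-involutive (allFin size) (Unique.allFin⁺ size) ∈-allFin) replies
    where
    T<′ : suc (T + T) < Maximum
    T<′ = ℕ.<-trans (s≤s (s≤s (ℕ.+-monoʳ-≤ T (ℕ.n≤1+n T)))) T<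
    weaker : Safe T (nodes t) u θ
    weaker = record { Safe safe ; far = λ a F → ℕ.<-trans (ℕ.n<1+n T) (Safe.far safe a F) }
    response : ∀ x → Response T (nodes t) u θ x
    response = advance T<′ safe
    u′ : Node → Potential
    u′ x = Response.u′ (response x)
    θ′ : Node → ℕ
    θ′ x = Response.θ′ (response x)
    -- The response depends only on the node of `w`, which a shift preserves; so `β` is an
    -- involution although the potential varies with `w`.
    β : Fin size → Fin size
    β w = shifted (u′ (nodeOf w)) (θ′ (nodeOf w)) w
    β-involutive : ∀ w → β (β w) ≡ w
    β-involutive w = trans (cong (λ x → shifted (u′ x) (θ′ x) (β w)) (nodeOf-shifted (u′ (nodeOf w)) (θ′ (nodeOf w)) w))
      (shifted-involutive (u′ (nodeOf w)) (θ′ (nodeOf w)) w)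
    replies : ∀ w i → SameColor T (graph false) (graph true) (t [ i ]≔ w) (Vec.map (shifted u θ) t [ i ]≔ β w)
    replies w i = subst (SameColor T (graph false) (graph true) (t [ i ]≔ w)) same-tuple
      (duplicator-wins T T<′ (t [ i ]≔ w) (subst (λ S → Safe T S (u′ x) (θ′ x)) (sym (Vec.map-[]≔ nodeOf t i)) (Response.safe (response x) i)))
      where
      x = nodeOf w
      same : ∀ j → lookup (Vec.map (shifted (u′ x) (θ′ x)) t) j ≡ lookup (Vec.map (shifted u θ) t) j
      same j = trans (Vec.lookup-map j (shifted (u′ x) (θ′ x)) t) (trans
        (sym (shifted-cong {u} {θ} {u′ x} {θ′ x} (lookup t j) λ d → subst (λ n → shift u θ n d ≡ shift (u′ x) (θ′ x) n d)
            (Vec.lookup-map j nodeOf t) (Response.same-shift (response x) j d)))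
        (sym (Vec.lookup-map j (shifted u θ) t)))
      same-tuple : Vec.map (shifted (u′ x) (θ′ x)) (t [ i ]≔ w) ≡ Vec.map (shifted u θ) t [ i ]≔ β w
      same-tuple = trans (Vec.map-[]≔ (shifted (u′ x) (θ′ x)) t i) (cong (_[ i ]≔ β w) (lookup-extensional same))

  survives : ∀ T → suc (T + T) < Maximum → ¬ DistinguishesAfter k T (graph false) (graph true)
  survives T T< = indistinguishable T (graph false) (graph true) π
    (involution-↭ π-involutive (tuples k size) (tuples-unique k size) (tuples-complete k)) λ t → duplicator-wins T T< t (proj₂ (start T< (nodes t)))
    where
    θ : Vec Node k → ℕ
    θ S = proj₁ (start T< S)
    π : Vec (Fin size) k → Vec (Fin size) k
    π t = Vec.map (shifted (λ _ _ → false) (θ (nodes t))) t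
    nodes-π : ∀ t → nodes (π t) ≡ nodes t
    nodes-π t = trans (sym (Vec.map-∘ nodeOf _ t)) (Vec.map-cong (nodeOf-shifted (λ _ _ → false) (θ (nodes t))) t)
    π-involutive : ∀ t → π (π t) ≡ t
    π-involutive t = trans (cong (λ S → Vec.map (shifted (λ _ _ → false) (θ S)) (π t)) (nodes-π t))
      (trans (sym (Vec.map-∘ _ _ t)) (trans (Vec.map-cong (shifted-involutive (λ _ _ → false) (θ (nodes t))) t) (Vec.map-id t)))

-- Spoiler

bitSum : ∀ {A : Set} {m} → (A → Bool) → Vec A m → Bool
bitSum f []       = false
bitSum f (x ∷ xs) = f x xor bitSum f xs

bitSum-update : ∀ {A : Set} {m} (f : A → Bool) (xs : Vec A m) i {x y} → lookup xs i ≡ x →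
                bitSum f (xs [ i ]≔ y) ≡ bitSum f xs xor (f x xor f y)
bitSum-update f (x ∷ xs) zero {y = y} refl =
  solve 3 (λ x y p → y :+ p := (x :+ p) :+ (x :+ y)) refl (f x) (f y) (bitSum f xs)
  where open xor-∧-Solver
bitSum-update f (z ∷ xs) (suc i) {x} {y} e = trans (cong (f z xor_) (bitSum-update f xs i e))
  (sym (Bool.xor-assoc (f z) (bitSum f xs) (f x xor f y)))

bitSum-false : ∀ {A : Set} {m} (f : A → Bool) (xs : Vec A m) → (∀ i → f (lookup xs i) ≡ false) → bitSum f xs ≡ false
bitSum-false f []       _  = refl
bitSum-false f (x ∷ xs) eq = cong₂ _xor_ (eq zero) (bitSum-false f xs (eq ∘ suc))

module Spoiler (k′ μ : ℕ) where
  open Construction k′ μ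

  G H : ColoredGraph
  G = graph false
  H = graph true

  plain : Node → Fin size
  plain n = encode (n , false , false)

  bitAt : Bool → Fin size → Bool
  bitAt d v = bit d (decode v)

  same-color : ∀ {v w} → color G v ≡ color H w → nodeOf v ≡ nodeOf w × flag false (decode v) ≡ flag true (decode w)
  same-color e = let e₁ , e₂ = Product.,-injective (encode-injective (Fin.toℕ-injective e))
                 in e₁ , proj₁ (Product.,-injective e₂)

  record IncidentAt (e : Bool) (s n : Node) : Set where
    constructor incidentAt
    field
      s-state      : kind s ≡ 0F
      n-transition : kind n ≢ 0F
      same-row     : row s ≡ row n
      n-valid      : Valid n
      first≡       : first e n ≡ first false s
      second≡      : second e n ≡ second false s

  end-injective : ∀ n → kind n ≢ 0F → ∀ d e → first d n ≡ first e n → second d n ≡ second e n → d ≡ e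
  end-injective n ne false false _ _ = refl
  end-injective n ne true  true  _ _ = refl
  end-injective (_ , _ , _ , 0F) ne _ _ _ _ = ⊥-elim (ne refl)
  end-injective (_ , _ , _ , 1F) ne false true e _ = ⊥-elim (ℕ.1+n≢n (sym e))
  end-injective (_ , _ , _ , 1F) ne true false e _ = ⊥-elim (ℕ.1+n≢n e)
  end-injective (_ , _ , _ , 2F) ne false true _ e = ⊥-elim (ℕ.1+n≢n (sym e))
  end-injective (_ , _ , _ , 2F) ne true false _ e = ⊥-elim (ℕ.1+n≢n e)

  incident-adjacent : ∀ {e s n} → IncidentAt e s n → Adjacent (s , false , false) (n , false , false)
  incident-adjacent {e} (incidentAt a b c d f g) = inj₁ (inj₁ (incident a b c d (e , f , g , zeros e)))
    where
    zeros : ∀ {n} e → bit e (n , false , false) ≡ false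
    zeros false = refl
    zeros true  = refl

  -- The two ends of a transition are different states, so the positions tell which of its bits the
  -- link compares.
  adjacent-incident : ∀ {e s n v w} → IncidentAt e s n → node v ≡ s → node w ≡ n → Adjacent v w → bit e w ≡ bit false v
  adjacent-incident {e} {n = n} {v} {w} (incidentAt a b c d f g) refl refl (inj₁ (inj₁ (incident _ _ _ _ (e′ , f′ , g′ , same)))) =
    subst (λ e → bit e w ≡ bit false v) (end-injective n b e′ e (trans f′ (sym f)) (trans g′ (sym g))) same
  adjacent-incident (incidentAt a _ _ _ _ _) refl refl (inj₁ (inj₂ s)) = case trans (sym a) (Synchronous.v-second s) of λ ()
  adjacent-incident (incidentAt a _ _ _ _ _) refl refl (inj₂ (inj₁ i)) = ⊥-elim (Incident.w-transition i a)
  adjacent-incident (incidentAt a _ _ _ _ _) refl refl (inj₂ (inj₂ s)) = case trans (sym a) (Synchronous.w-first s) of λ ()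

  adjacent-synchronous : ∀ {v w} → kind (node v) ≡ 2F → kind (node w) ≡ 1F → Adjacent v w →
                         bit false v xor bit true v ≡ bit false w xor bit true w
  adjacent-synchronous e e′ (inj₁ (inj₂ s)) = Synchronous.same-flip s
  adjacent-synchronous e e′ (inj₁ (inj₁ i)) = case trans (sym e) (Incident.v-state i) of λ ()
  adjacent-synchronous e e′ (inj₂ (inj₁ i)) = case trans (sym e′) (Incident.v-state i) of λ ()
  adjacent-synchronous e e′ (inj₂ (inj₂ s)) = case trans (sym e′) (Synchronous.v-second s) of λ ()

  module _ {R : ℕ} {t t′ : Vec (Fin size) k} (same : SameColor R G H t t′) where
    private
      iso : TupleIso k (G , t) (H , t′)
      iso = sameColor⇒tupleIso R same

    node-preserved : ∀ i {n x} → lookup t i ≡ plain n → lookup t′ i ≡ x → nodeOf x ≡ n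
    node-preserved i {n} e refl = trans (sym (proj₁ (same-color (proj₂ (proj₂ iso) i))))
      (trans (cong nodeOf e) (cong node (decode-encode (n , false , false))))

    flag-preserved : ∀ i {n} → lookup t i ≡ plain n → flag true (decode (lookup t′ i)) ≡ flag false (n , false , false)
    flag-preserved i {n} e = trans (sym (proj₂ (same-color (proj₂ (proj₂ iso) i))))
      (cong (flag false) (trans (cong decode e) (decode-encode (n , false , false))))

    adjacent-preserved : ∀ i j {m n x y} → lookup t i ≡ plain m → lookup t′ i ≡ x → lookup t j ≡ plain n → lookup t′ j ≡ y →
      Adjacent (m , false , false) (n , false , false) → Adjacent (decode x) (decode y)
    adjacent-preserved i j {m} {n} e refl f refl adj = witness (adjacent? (decode (lookup t′ i)) (decode (lookup t′ j)))
      (trans (sym (proj₁ (proj₂ iso) i j)) (dec-true (adjacent? (decode (lookup t i)) (decode (lookup t j)))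
        (subst₂ Adjacent (sym (trans (cong decode e) (decode-encode (m , false , false))))
                         (sym (trans (cong decode f) (decode-encode (n , false , false)))) adj)))
      where
      witness : ∀ {P : Set} (p? : Dec P) → does p? ≡ true → P
      witness (yes p) _ = p

    incidence : ∀ i j {e s n x y} → lookup t i ≡ plain s → lookup t′ i ≡ x → lookup t j ≡ plain n → lookup t′ j ≡ y →
      IncidentAt e s n → bitAt e y ≡ bitAt false x
    incidence i j e e′ f f′ at = adjacent-incident at (node-preserved i e e′) (node-preserved j f f′)
      (adjacent-preserved i j e e′ f f′ (incident-adjacent at))

    synchrony : ∀ i j {m n x y} → lookup t i ≡ plain m → lookup t′ i ≡ x → lookup t j ≡ plain n → lookup t′ j ≡ y →
      Synchronous (m , false , false) (n , false , false) →
      bitAt false x xor bitAt true x ≡ bitAt false y xor bitAt true y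
    synchrony i j e e′ f f′ s = adjacent-synchronous
      (trans (cong kind (node-preserved i e e′)) (Synchronous.v-second s))
      (trans (cong kind (node-preserved j f f′)) (Synchronous.w-first s))
      (adjacent-preserved i j e e′ f f′ (inj₁ (inj₂ s)))

  place : ℕ → Fin (suc N)
  place p = Fin.fromℕ< (s≤s (ℕ.m⊓n≤n p N))

  toℕ-place : ∀ {p} → p ≤ N → toℕ (place p) ≡ p
  toℕ-place {p} p≤N = trans (Fin.toℕ-fromℕ< (s≤s (ℕ.m⊓n≤n p N))) (ℕ.m≤n⇒m⊓n≡m p≤N)

  state : (Fin k → ℕ) → Fin k → Node
  state a r = r , place (a (prev r)) , place (a r) , 0F

  states : (Fin k → ℕ) → Vec (Fin size) k
  states a = tabulate (plain ∘ state a)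

  -- All bits of `states a` are 0, so the answer in `H` must have the same sum. `R` rounds let
  -- Spoiler play from `a` back to the first configuration.
  Forced : (Fin k → ℕ) → Set
  Forced a = ∃ λ R → ∀ t → SameColor R G H (states a) t → bitSum (bitAt false) t ≡ false

  forced-cong : ∀ {a b} → (∀ c → a c ≡ b c) → Forced a → Forced b
  forced-cong eq (R , f) = R , λ t same → f t (subst (λ u → SameColor R G H u t)
    (sym (Vec.tabulate-cong λ r → cong plain (cong₂ (λ p q → r , place p , place q , 0F) (eq (prev r)) (eq r)))) same)

  record Step (lo hi : Fin k → ℕ) : Set where
    field
      cell      : Fin k
      increment : hi cell ≡ suc (lo cell)
      elsewhere : ∀ c → c ≢ cell → hi c ≡ lo c
      bounded   : ∀ c → hi c ≤ N
      lo-valid  : ∀ r → Admissible r (lo (prev r)) (lo r)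
      hi-valid  : ∀ r → Admissible r (hi (prev r)) (hi r)

  module _ {lo hi : Fin k → ℕ} (step : Step lo hi) where
    open Step step

    config : Bool → Fin k → ℕ
    config false = lo
    config true  = hi

    private
      j g : Fin k
      j = cell
      g = proj₁ (prev-surjective cell)

      prev-g : prev g ≡ j
      prev-g = proj₁ (proj₂ (prev-surjective cell))

      g≢j : g ≢ j
      g≢j = proj₂ (proj₂ (prev-surjective cell))

      prev-j≢j : prev j ≢ j
      prev-j≢j e = g≢j (prev-injective (trans prev-g (sym e)))

      lo-bounded : ∀ c → lo c ≤ N
      lo-bounded c with c Fin.≟ j
      ... | yes refl = ℕ.≤-trans (ℕ.n≤1+n _) (ℕ.≤-trans (ℕ.≤-reflexive (sym increment)) (bounded c))
      ... | no ne    = ℕ.≤-trans (ℕ.≤-reflexive (sym (elsewhere c ne))) (bounded c)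

      fixed : ∀ d c → c ≢ j → toℕ (place (lo c)) ≡ config d c
      fixed false c ne = toℕ-place (lo-bounded c)
      fixed true  c ne = trans (toℕ-place (lo-bounded c)) (sym (elsewhere c ne))

      config-bounded : ∀ d c → config d c ≤ N
      config-bounded false = lo-bounded
      config-bounded true  = bounded

      config-valid : ∀ d r → Admissible r (config d (prev r)) (config d r)
      config-valid false = lo-valid
      config-valid true  = hi-valid

      n m : Node
      n = j , place (lo (prev j)) , place (lo j) , 2F
      m = g , place (lo j) , place (lo g) , 1F

      n-first : ∀ d → first d n ≡ config d (prev j)
      n-first false = fixed false (prev j) prev-j≢j
      n-first true  = fixed true (prev j) prev-j≢j

      n-second : ∀ d → second d n ≡ config d j
      n-second false = toℕ-place (lo-bounded j)
      n-second true  = trans (cong suc (toℕ-place (lo-bounded j))) (sym increment)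

      m-first : ∀ d → first d m ≡ config d (prev g)
      m-first false = trans (toℕ-place (lo-bounded j)) (cong lo (sym prev-g))
      m-first true  = trans (cong suc (toℕ-place (lo-bounded j))) (trans (sym increment) (cong hi (sym prev-g)))

      m-second : ∀ d → second d m ≡ config d g
      m-second false = fixed false g g≢j
      m-second true  = fixed true g g≢j

      n-valid : Valid n
      n-valid d = subst₂ (Admissible j) (sym (n-first d)) (sym (n-second d)) (config-valid d j)

      m-valid : Valid m
      m-valid d = subst₂ (Admissible g) (sym (m-first d)) (sym (m-second d)) (config-valid d g)

      n-at : ∀ d → IncidentAt d (state (config d) j) n
      n-at d = incidentAt refl (λ ()) refl n-valid
        (trans (n-first d) (sym (toℕ-place (config-bounded d (prev j)))))
        (trans (n-second d) (sym (toℕ-place (config-bounded d j))))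

      m-at : ∀ d → IncidentAt d (state (config d) g) m
      m-at d = incidentAt refl (λ ()) refl m-valid
        (trans (m-first d) (sym (toℕ-place (config-bounded d (prev g)))))
        (trans (m-second d) (sym (toℕ-place (config-bounded d g))))

      n-m : Synchronous (n , false , false) (m , false , false)
      n-m = synchronous refl refl prev-g refl n-valid m-valid refl

      config-agree : ∀ d e c → c ≢ j → config d c ≡ config e c
      config-agree d e c ne = trans (sym (fixed d c ne)) (fixed e c ne)

    -- In four rounds the states of the two rows j and g that see the moving cell are
    -- replaced by transitions, whose flips agree, and these by the states at the other end.
    forced-step : ∀ d e → (∀ w → bitAt e w xor bitAt d w ≡ bitAt false w xor bitAt true w) → Forced (config d) → Forced (config e)
    forced-step d e opposite (R , f) = 4 + R , win
      where
      win : ∀ t → SameColor (4 + R) G H (states (config e)) t → bitSum (bitAt false) t ≡ false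
      win t same = begin
        bitSum b t
          ≡⟨ solve 2 (λ s z → s := s :+ (z :+ z)) refl (bitSum b t) (b w₁ xor bitAt true w₁) ⟩
        bitSum b t xor ((b w₁ xor bitAt true w₁) xor (b w₁ xor bitAt true w₁))
          ≡⟨ cong (λ z → bitSum b t xor ((b w₁ xor bitAt true w₁) xor z)) synchronized ⟩
        bitSum b t xor ((b w₁ xor bitAt true w₁) xor (b w₂ xor bitAt true w₂))
          ≡⟨ cong₂ (λ y z → bitSum b t xor (y xor z)) (opposite w₁) (opposite w₂) ⟨
        bitSum b t xor ((bitAt e w₁ xor bitAt d w₁) xor (bitAt e w₂ xor bitAt d w₂))
          ≡⟨ cong₂ (λ y z → bitSum b t xor (y xor z)) (cong₂ _xor_ n-source n-target) (cong₂ _xor_ m-source m-target) ⟩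
        bitSum b t xor ((b x xor b w₃) xor (b y xor b w₄))
          ≡⟨ solve 7 (λ s x y w₁ w₂ w₃ w₄ → s :+ ((x :+ w₃) :+ (y :+ w₄)) :=
                (((s :+ (x :+ w₁)) :+ (y :+ w₂)) :+ (w₁ :+ w₃)) :+ (w₂ :+ w₄)) refl (bitSum b t) (b x) (b y) (b w₁) (b w₂) (b w₃) (b w₄) ⟩
        (((bitSum b t xor (b x xor b w₁)) xor (b y xor b w₂)) xor (b w₁ xor b w₃)) xor (b w₂ xor b w₄)
          ≡⟨ cong (λ s → ((s xor (b y xor b w₂)) xor (b w₁ xor b w₃)) xor (b w₂ xor b w₄)) (bitSum-update b t j refl) ⟨
        ((bitSum b t₁ xor (b y xor b w₂)) xor (b w₁ xor b w₃)) xor (b w₂ xor b w₄)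
          ≡⟨ cong (λ s → (s xor (b w₁ xor b w₃)) xor (b w₂ xor b w₄)) (bitSum-update b t₁ g t₁-g) ⟨
        (bitSum b t₂ xor (b w₁ xor b w₃)) xor (b w₂ xor b w₄)
          ≡⟨ cong (_xor (b w₂ xor b w₄)) (bitSum-update b t₂ j t₂-j) ⟨
        bitSum b t₃ xor (b w₂ xor b w₄)
          ≡⟨ bitSum-update b t₃ g t₃-g ⟨
        bitSum b t₄
          ≡⟨ f t₄ (subst (λ u → SameColor R G H u t₄) (lookup-extensional reached) (s₄ g)) ⟩
        false ∎
        where
        open ≡-Reasoning
        open xor-∧-Solver
        b = bitAt false
        x = lookup t j
        y = lookup t g
        u₀ = states (config e)
        r₁ = reply (3 + R) G H u₀ t same (plain n)
        w₁ = proj₁ r₁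
        s₁ = proj₂ r₁
        u₁ = u₀ [ j ]≔ plain n
        t₁ = t [ j ]≔ w₁
        r₂ = reply (2 + R) G H u₁ t₁ (s₁ j) (plain m)
        w₂ = proj₁ r₂
        s₂ = proj₂ r₂
        u₂ = u₁ [ g ]≔ plain m
        t₂ = t₁ [ g ]≔ w₂
        r₃ = reply (1 + R) G H u₂ t₂ (s₂ g) (plain (state (config d) j))
        w₃ = proj₁ r₃
        s₃ = proj₂ r₃
        u₃ = u₂ [ j ]≔ plain (state (config d) j)
        t₃ = t₂ [ j ]≔ w₃
        r₄ = reply R G H u₃ t₃ (s₃ j) (plain (state (config d) g))
        w₄ = proj₁ r₄
        s₄ = proj₂ r₄
        t₄ = t₃ [ g ]≔ w₄
        j≢g : j ≢ g
        j≢g = g≢j ∘ sym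
        t₁-g : lookup t₁ g ≡ y
        t₁-g = Vec.lookup∘update′ g≢j t w₁
        t₂-j : lookup t₂ j ≡ w₁
        t₂-j = trans (Vec.lookup∘update′ j≢g t₁ w₂) (Vec.lookup∘update j t w₁)
        t₃-g : lookup t₃ g ≡ w₂
        t₃-g = trans (Vec.lookup∘update′ g≢j t₂ w₃) (Vec.lookup∘update g t₁ w₂)
        u₀-at : ∀ i → lookup u₀ i ≡ plain (state (config e) i)
        u₀-at = Vec.lookup∘tabulate (plain ∘ state (config e))
        u₁-g : lookup u₁ g ≡ plain (state (config e) g)
        u₁-g = trans (Vec.lookup∘update′ g≢j u₀ _) (u₀-at g)
        u₂-j : lookup u₂ j ≡ plain n
        u₂-j = trans (Vec.lookup∘update′ j≢g u₁ _) (Vec.lookup∘update j u₀ _)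
        u₂-g : lookup u₂ g ≡ plain m
        u₂-g = Vec.lookup∘update g u₁ _
        u₃-g : lookup u₃ g ≡ plain m
        u₃-g = trans (Vec.lookup∘update′ g≢j u₂ _) u₂-g

        -- The answer `w₁` is going to replace `x`. To compare the two, it is put in the place `g`
        -- instead; the other comparisons work alike.
        n-source : bitAt e w₁ ≡ b x
        n-source = incidence (s₁ g) j g
          (trans (Vec.lookup∘update′ j≢g u₀ _) (u₀-at j)) (Vec.lookup∘update′ j≢g t w₁)
          (Vec.lookup∘update g u₀ _) (Vec.lookup∘update g t w₁) (n-at e)
        m-source : bitAt e w₂ ≡ b y
        m-source = incidence (s₂ j) g j
          (trans (Vec.lookup∘update′ g≢j u₁ _) u₁-g) (trans (Vec.lookup∘update′ g≢j t₁ w₂) t₁-g)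
          (Vec.lookup∘update j u₁ _) (Vec.lookup∘update j t₁ w₂) (m-at e)
        synchronized : b w₁ xor bitAt true w₁ ≡ b w₂ xor bitAt true w₂
        synchronized = synchrony (s₂ g) j g
          u₂-j t₂-j u₂-g (Vec.lookup∘update g t₁ w₂) n-m
        n-target : bitAt d w₁ ≡ b w₃
        n-target = incidence (s₃ g) g j
          (Vec.lookup∘update g u₂ _) (Vec.lookup∘update g t₂ w₃)
          (trans (Vec.lookup∘update′ j≢g u₂ _) u₂-j) (trans (Vec.lookup∘update′ j≢g t₂ w₃) t₂-j) (n-at d)
        m-target : bitAt d w₂ ≡ b w₄
        m-target = incidence (s₄ j) j g
          (Vec.lookup∘update j u₃ _) (Vec.lookup∘update j t₃ w₄)
          (trans (Vec.lookup∘update′ g≢j u₃ _) u₃-g) (trans (Vec.lookup∘update′ g≢j t₃ w₄) t₃-g) (m-at d)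

        reached : ∀ i → lookup (u₃ [ g ]≔ plain (state (config d) g)) i ≡ lookup (states (config d)) i
        reached i = trans (at i (i Fin.≟ g) (i Fin.≟ j)) (sym (Vec.lookup∘tabulate (plain ∘ state (config d)) i))
          where
          at : ∀ i → Dec (i ≡ g) → Dec (i ≡ j) → lookup (u₃ [ g ]≔ plain (state (config d) g)) i ≡ plain (state (config d) i)
          at i (yes refl) _ = Vec.lookup∘update g u₃ _
          at i (no i≢g) (yes refl) = trans (Vec.lookup∘update′ i≢g u₃ _) (Vec.lookup∘update j u₂ _)
          at i (no i≢g) (no i≢j) = trans (Vec.lookup∘update′ i≢g u₃ _) (trans (Vec.lookup∘update′ i≢j u₂ _)
            (trans (Vec.lookup∘update′ i≢g u₁ _) (trans (Vec.lookup∘update′ i≢j u₀ _) (trans (u₀-at i)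
              (cong plain (cong₂ (λ p q → i , place p , place q , 0F)
                (config-agree e d (prev i) λ h → i≢g (prev-injective (trans h (sym prev-g)))) (config-agree e d i i≢j)))))))

  forced-up : ∀ {lo hi} → Step lo hi → Forced lo → Forced hi
  forced-up step = forced-step step false true λ w → Bool.xor-comm (bitAt true w) (bitAt false w)

  forced-down : ∀ {lo hi} → Step lo hi → Forced hi → Forced lo
  forced-down step = forced-step step true false λ _ → refl

-- Forcing the sum from the first configuration to the last

module SpoilerWins (k′ μ : ℕ) where
  open Construction k′ μ
  open Spoiler k′ μ

  -- The cells move one after the other. Meanwhile all of them are at `p` or `suc p`, so any two are
  -- close and only the gates have to be checked.
  shiftColumn : ∀ p → suc p ≤ N → (∀ {q q′} → p ≤ q → q ≤ suc p → p ≤ q′ → q′ ≤ suc p → ∀ r → Gated r q q′) →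
    Forced (λ _ → p) → Forced (λ _ → suc p)
  shiftColumn p p<N gates F = forced-cong (λ c → cong (λ b → if b then suc p else p) (dec-true (toℕ c ℕ.<? k) (Fin.toℕ<n c)))
    (go k ℕ.≤-refl)
    where
    mixed : ℕ → Fin k → ℕ
    mixed i c = if toℕ c <ᵇ i then suc p else p

    mixed-bounds : ∀ i c → p ≤ mixed i c × mixed i c ≤ suc p
    mixed-bounds i c with toℕ c <ᵇ i
    ... | true  = ℕ.n≤1+n p , ℕ.≤-refl
    ... | false = ℕ.≤-refl , ℕ.n≤1+n p

    mixed-valid : ∀ i r → Admissible r (mixed i (prev r)) (mixed i r)
    mixed-valid i r = gates (proj₁ x) (proj₂ x) (proj₁ y) (proj₂ y) r ,
      inj₂ (ℕ.≤-trans (proj₂ x) (s≤s (proj₁ y)) , ℕ.≤-trans (proj₂ y) (s≤s (proj₁ x)))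
      where
      x = mixed-bounds i (prev r)
      y = mixed-bounds i r

    step : ∀ {i} → i < k → Step (mixed i) (mixed (suc i))
    step {i} i<k = record
      { cell      = Fin.fromℕ< i<k
      ; increment = trans (branch true (dec-true (toℕ c ℕ.<? suc i) (s≤s (ℕ.≤-reflexive (Fin.toℕ-fromℕ< i<k)))))
                          (cong suc (sym (branch false (dec-false (toℕ c ℕ.<? i) (ℕ.≤⇒≯ (ℕ.≤-reflexive (sym (Fin.toℕ-fromℕ< i<k))))))))
      ; elsewhere = λ c′ ne → cong (λ b → if b then suc p else p) (same c′ λ e → ne (Fin.toℕ-injective (trans e (sym (Fin.toℕ-fromℕ< i<k)))))
      ; bounded   = λ c′ → ℕ.≤-trans (proj₂ (mixed-bounds (suc i) c′)) p<N
      ; lo-valid  = mixed-valid i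
      ; hi-valid  = mixed-valid (suc i)
      }
      where
      c = Fin.fromℕ< i<k
      branch : ∀ b {b′} → b′ ≡ b → (if b′ then suc p else p) ≡ (if b then suc p else p)
      branch b refl = refl
      same : ∀ c′ → toℕ c′ ≢ i → (toℕ c′ <ᵇ suc i) ≡ (toℕ c′ <ᵇ i)
      same c′ ne with toℕ c′ ℕ.<? i
      ... | yes h = trans (dec-true (toℕ c′ ℕ.<? suc i) (ℕ.m≤n⇒m≤1+n h)) (sym (dec-true (toℕ c′ ℕ.<? i) h))
      ... | no ¬h = trans (dec-false (toℕ c′ ℕ.<? suc i) λ h → ¬h (ℕ.≤∧≢⇒< (s≤s⁻¹ h) ne)) (sym (dec-false (toℕ c′ ℕ.<? i) ¬h))

    go : ∀ i → i ≤ k → Forced (mixed i)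
    go zero    _   = F
    go (suc i) i<k = forced-up (step i<k) (go i (ℕ.<⇒≤ i<k))

  counter : Vec ℕ k → Fin k → ℕ
  counter v c = E + lookup v c

  counter-valid : ∀ {v} → Chain v → ∀ r → Admissible r (counter v (prev r)) (counter v r)
  counter-valid {v} c r = gates r , inj₁ (middle (prev r) , middle r)
    where
    middle : ∀ i → Middle (counter v i)
    middle i = ℕ.m≤m+n E _ , ℕ.+-monoʳ-≤ E (chain-bound c i)
    gates : ∀ r → Gated r (counter v (prev r)) (counter v r)
    gates zero    = tt
    gates (suc i) = subst₂ (Gate top) (sym (digit-middle (chain-bound c (inject₁ i)))) (sym (digit-middle (chain-bound c (suc i)))) (chain-gate c i)

  tick-step : ∀ {v v′ : Vec ℕ k} → Tick v v′ → Step (counter v) (counter v′)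
  tick-step {v} {v′} (tick j increment elsewhere before after) = record
    { cell      = j
    ; increment = trans (cong (E +_) increment) (ℕ.+-suc E (lookup v j))
    ; elsewhere = λ c ne → cong (E +_) (elsewhere c ne)
    ; bounded   = λ c → ℕ.+-monoʳ-≤ E (ℕ.≤-trans (chain-bound after c) (ℕ.m≤m+n top E))
    ; lo-valid  = counter-valid before
    ; hi-valid  = counter-valid after
    }

  forced-ticks : ∀ {v v′ : Vec ℕ k} → EqClosure Tick v v′ → Forced (counter v) → Forced (counter v′)
  forced-ticks ε             F = F
  forced-ticks (fwd t ◅ ts) F = forced-ticks ts (forced-up (tick-step t) F)
  forced-ticks (bwd t ◅ ts) F = forced-ticks ts (forced-down (tick-step t) F)


  flag-unmarked : ∀ twist n → flag twist (n , false , false) ≡ does (corner? N n) ∧ (twist ∧ isZero (row n))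
  flag-unmarked twist n = cong (_∨ (does (corner? N n) ∧ (twist ∧ isZero (row n)))) (Bool.∧-zeroʳ (does (corner? 0 n)))

  flag-of : ∀ {p} → p ≤ N → ∀ {R t} → SameColor R G H (states (λ _ → p)) t → ∀ i →
    (does (corner? 0 (state (λ _ → p) i)) ∧ bitAt false (lookup t i))
      ∨ (does (corner? N (state (λ _ → p) i)) ∧ (bitAt false (lookup t i) xor isZero i)) ≡ false
  flag-of {p} p≤N {R} {t} same i = begin
    (does (corner? 0 n) ∧ x) ∨ (does (corner? N n) ∧ (x xor isZero i))
      ≡⟨ cong (λ n → (does (corner? 0 n) ∧ x) ∨ (does (corner? N n) ∧ (x xor isZero (row n)))) (node-preserved same i (at i) refl) ⟨
    flag true (decode (lookup t i))
      ≡⟨ flag-preserved same i (at i) ⟩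
    flag false (n , false , false)
      ≡⟨ flag-unmarked false n ⟩
    does (corner? N n) ∧ false
      ≡⟨ Bool.∧-zeroʳ (does (corner? N n)) ⟩
    false ∎
    where
    open ≡-Reasoning
    n = state (λ _ → p) i
    x = bitAt false (lookup t i)
    at : ∀ i → lookup (states (λ _ → p)) i ≡ plain (state (λ _ → p) i)
    at = Vec.lookup∘tabulate (plain ∘ state (λ _ → p))

  corner-at : ∀ {p} → p ≤ N → ∀ i → Corner p (state (λ _ → p) i)
  corner-at p≤N i = refl , toℕ-place p≤N , toℕ-place p≤N

  corner-unique : ∀ {p q} n → Corner p n → p ≢ q → ¬ Corner q n
  corner-unique n (_ , e , _) ne (_ , f , _) = ne (trans (sym e) f)

  N≢0 : 0 ≢ N
  N≢0 ()

  forced-bottom : Forced (λ _ → 0)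
  forced-bottom = 0 , λ t same → bitSum-false (bitAt false) t λ i →
    simplify {y = bitAt false (lookup t i) xor isZero i} (corner? 0 (state (λ _ → 0) i)) (corner? N (state (λ _ → 0) i)) (corner-at z≤n i)
        (corner-unique (state (λ _ → 0) i) (corner-at z≤n i) N≢0) (flag-of z≤n same i)
    where
    simplify : ∀ {P Q : Set} {x y} (p? : Dec P) (q? : Dec Q) → P → ¬ Q → (does p? ∧ x) ∨ (does q? ∧ y) ≡ false → x ≡ false
    simplify (no ¬p) _       p _  _ = ⊥-elim (¬p p)
    simplify _       (yes q) _ ¬q _ = ⊥-elim (¬q q)
    simplify {x = x} (yes _) (no _) _ _ e = trans (sym (Bool.∨-identityʳ x)) e

  -- The flags of `states (λ _ → N)` in `G` are all `false`. In `H` row 0 shows the complement of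
  -- its bit, so exactly this row must have the bit `true`.
  ¬forced-top : ∀ R t → SameColor R G H (states (λ _ → N)) t → bitSum (bitAt false) t ≡ true
  ¬forced-top R t same = one-bit (bitAt false) t λ i →
    simplify (corner? 0 (state (λ _ → N) i)) (corner? N (state (λ _ → N) i)) (isZero i) (corner-at ℕ.≤-refl i)
        (corner-unique (state (λ _ → N) i) (corner-at ℕ.≤-refl i) (N≢0 ∘ sym)) (flag-of ℕ.≤-refl same i)
    where
    simplify : ∀ {P Q : Set} (p? : Dec P) (q? : Dec Q) {x} y → Q → ¬ P → (does p? ∧ x) ∨ (does q? ∧ (x xor y)) ≡ false → x ≡ y
    simplify (yes p) _       _ _ ¬p _ = ⊥-elim (¬p p)
    simplify _       (no ¬q) _ q _  _ = ⊥-elim (¬q q)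
    simplify (no _) (yes _) {true}  true  _ _ _ = refl
    simplify (no _) (yes _) {false} false _ _ _ = refl
    one-bit : ∀ {A : Set} {m} (f : A → Bool) (xs : Vec A (suc m)) → (∀ i → f (lookup xs i) ≡ isZero i) → bitSum f xs ≡ true
    one-bit f (x ∷ xs) eq = cong₂ _xor_ (eq zero) (bitSum-false f xs (eq ∘ suc))

  forced-top : Forced (λ _ → N)
  forced-top = forced-cong (λ _ → ℕ.+-assoc E top E) (high E ℕ.≤-refl)
    where
    low : ∀ p → p ≤ E → Forced (λ _ → p)
    low zero    _   = forced-bottom
    low (suc p) p<E = shiftColumn p (ℕ.≤-trans p<E (ℕ.m≤m+n E _))
      (λ _ q≤ _ q′≤ r → gated-low r (ℕ.≤-trans q≤ p<E) (ℕ.≤-trans q′≤ p<E)) (low p (ℕ.<⇒≤ p<E))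
    middle : Forced (λ _ → E + top)
    middle = forced-cong (λ c → cong (E +_) (Vec.lookup-replicate c top)) (forced-ticks (sweep (suc k′))
      (forced-cong (λ c → sym (trans (cong (E +_) (Vec.lookup-replicate c 0)) (ℕ.+-identityʳ E))) (low E ℕ.≤-refl)))
    high : ∀ p → p ≤ E → Forced (λ _ → E + top + p)
    high zero    _   = forced-cong (λ _ → sym (ℕ.+-identityʳ (E + top))) middle
    high (suc p) p<E = forced-cong (λ _ → sym (ℕ.+-suc (E + top) p)) (shiftColumn (E + top + p)
      (ℕ.≤-trans (ℕ.≤-reflexive (sym (ℕ.+-suc (E + top) p))) (ℕ.≤-trans (ℕ.+-monoʳ-≤ (E + top) p<E) (ℕ.≤-reflexive (ℕ.+-assoc E top E))))
      (λ ≤q _ ≤q′ _ r → gated-high r (ℕ.≤-trans (ℕ.m≤m+n (E + top) p) ≤q) (ℕ.≤-trans (ℕ.m≤m+n (E + top) p) ≤q′)) (high p (ℕ.<⇒≤ p<E)))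

  -- An answer in `H` to the last configuration of `G` would have sum 0 by the run of the counter
  -- and sum 1 by its colors.
  distinguished : ∃ λ R → DistinguishesAfter k R G H
  distinguished = R , distinguishable R G H (states (λ _ → N)) λ t same →
    case trans (sym (proj₂ forced-top t same)) (¬forced-top R t same) of λ ()
    where R = proj₁ forced-top

-- Choice of the parameters

module _ (k′ n : ℕ) (k²≤n : suc (suc k′) * suc (suc k′) ≤ n) where

  private
    s = isqrt n
    open Construction k′ s

    k≤s : k ≤ s
    k≤s = s≤s⁻¹ (square-cancel-< k (suc s) (ℕ.≤-<-trans k²≤n (isqrt-square-> n)))

    -- Since `2 <= k <= s`, the constant 7 is at most `4 * s` and the end parts contribute at most
    -- `2 * s`.
    length≤10s : suc N ≤ 10 * s
    length≤10s = begin
      suc N                              ≡⟨ solve 2 (λ k s → con 1 :+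
          (con 2 :+ k :+ (s :* con 4 :+ con 2 :+ (con 2 :+ k))) := con 2 :* k :+ con 7 :+ con 4 :* s) refl k s ⟩
      2 * k + 7 + 4 * s                  ≤⟨ ℕ.+-monoˡ-≤ (4 * s)
          (ℕ.+-mono-≤ (ℕ.*-monoʳ-≤ 2 k≤s) (ℕ.≤-trans (ℕ.n≤1+n 7) (ℕ.*-monoʳ-≤ 4 (ℕ.≤-trans (s≤s (s≤s z≤n)) k≤s)))) ⟩
      2 * s + 4 * s + 4 * s              ≡⟨ solve 1 (λ s → con 2 :* s :+ con 4 :* s :+ con 4 :* s := con 10 :* s) refl s ⟩
      10 * s                             ∎
      where
      open ℕ.≤-Reasoning
      open ℕ.+-*-Solver

  -- Three kinds and four pairs of bits give the factor 12; two positions with at most `10 * s`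
  -- choices each give 100.
  size-bound : size ≤ 1200 * (k ^ 2 * n)
  size-bound = begin
    size                            ≡⟨ solve 2 (λ k l → k :* (l :* (l :* con 3)) :* con 4 := con 12 :* k :* (l :* l)) refl k (suc N) ⟩
    12 * k * (suc N * suc N)        ≤⟨ ℕ.*-monoʳ-≤ (12 * k) (ℕ.*-mono-≤ length≤10s length≤10s) ⟩
    12 * k * ((10 * s) * (10 * s))  ≡⟨ solve 2 (λ k s → con 12 :* k :* ((con 10 :* s) :* (con 10 :* s)) := con 1200 :* (k :* (s :* s))) refl k s ⟩
    1200 * (k * (s * s))            ≤⟨ ℕ.*-monoʳ-≤ 1200 (ℕ.*-mono-≤ (ℕ.m≤m*n k (k * 1)) (isqrt-square-≤ n)) ⟩
    1200 * (k ^ 2 * n)              ∎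
    where
    open ℕ.≤-Reasoning
    open ℕ.+-*-Solver

  -- From `n < (s + 1)²` it follows that `n ^ k` is at most the square of `(2 * s + 1) ^ k`, and the
  -- counter has twice that many steps.
  rounds-bound : ∀ r → r * r < n ^ k → suc (r + r) < maximum (suc k′)
  rounds-bound r r²< = begin
    suc (suc (r + r))  ≡⟨ solve 1 (λ r → con 2 :+ (r :+ r) := con 2 :* (con 1 :+ r)) refl r ⟩
    2 * suc r          ≤⟨ ℕ.*-monoʳ-≤ 2 (square-cancel-< r q r²<q²) ⟩
    2 * q              ≡⟨ maximum-power (suc k′) ⟨
    maximum (suc k′)   ∎
    where
    open ℕ.≤-Reasoning
    open ℕ.+-*-Solver
    q = (2 * s + 1) ^ k
    s<2s+1 : suc s ≤ 2 * s + 1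
    s<2s+1 = ℕ.≤-trans (ℕ.≤-reflexive (ℕ.+-comm 1 s)) (ℕ.+-monoˡ-≤ 1 (ℕ.m≤m+n s (s + 0)))
    r²<q² : r * r < q * q
    r²<q² = begin-strict
      r * r                                <⟨ r²< ⟩
      n ^ k                                ≤⟨ ℕ.^-monoˡ-≤ k (ℕ.≤-trans (ℕ.<⇒≤ (isqrt-square-> n)) (ℕ.*-mono-≤ s<2s+1 s<2s+1)) ⟩
      ((2 * s + 1) * (2 * s + 1)) ^ k      ≡⟨ square-^ (2 * s + 1) k ⟩
      q * q                                ∎

0<1200 : fromℕ 0 <ᴿ fromℕ 1200
0<1200 = 1ℚ , ℚ.positive⁻¹ 1ℚ , 0 , λ _ _ →
  ℚ.≤-trans (ℚ.≤-reflexive (fraction-+ 0 0 1 0)) (fraction-≤ 1 0 1200 0 (s≤s z≤n))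

corollary34 : ∃ λ (c : ℝ) → fromℕ 0 <ᴿ c ×
    (∀ (k n : ℕ) → 2 ≤ k → c *ᴿ (fromℕ k *ᴿ log k) ² ≤ᴿ fromℕ n →
    ∃₂ λ (G H : ColoredGraph) →
    (order G ≡ order H × fromℕ (order G) ≤ᴿ c *ᴿ fromℕ (k ^ 2 * n)) ×
    (∃ λ (r : ℕ) → DistinguishesAfter k r G H) ×
    (∀ (r : ℕ) → fromℕ r <ᴿ √ (n ^ k) → ¬ DistinguishesAfter k r G H))
corollary34 = fromℕ 1200 , 0<1200 , pair
  where
  pair : ∀ (k n : ℕ) → 2 ≤ k → fromℕ 1200 *ᴿ (fromℕ k *ᴿ log k) ² ≤ᴿ fromℕ n →
    ∃₂ λ (G H : ColoredGraph) →
    (order G ≡ order H × fromℕ (order G) ≤ᴿ fromℕ 1200 *ᴿ fromℕ (k ^ 2 * n)) ×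
    (∃ λ (r : ℕ) → DistinguishesAfter k r G H) ×
    (∀ (r : ℕ) → fromℕ r <ᴿ √ (n ^ k) → ¬ DistinguishesAfter k r G H)
  pair k@(suc (suc k′)) n 2≤k@(s≤s (s≤s _)) large =
    graph k′ (isqrt n) false , graph k′ (isqrt n) true ,
    (refl , fromℕ-≤ (size k′ (isqrt n)) 1200 (k ^ 2 * n) (size-bound k′ n k²≤n)) ,
    SpoilerWins.distinguished k′ (isqrt n) ,
    λ r r< → Indistinguishability.survives k′ (isqrt n) r (rounds-bound k′ n k²≤n r (below-√ r (n ^ k) r<))
    where
    open Construction using (graph; size)
    k²≤n = square-below k n 2≤k large
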